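{- Over a finite field $\mathbb F_q$ of characteristic at least $5$ there are at most $6q-2$ equivalence classes of cubic rational expressions.
   Context: A rational expression $R(x)=g(x)/h(x)$ with $g,h$ coprime has degree $\max(\deg g,\deg h)$; cubic means degree $3$. The group $G(\mathbb F_q)=\mathrm{PGL}_2(\mathbb F_q)\times\mathrm{PGL}_2(\mathbb F_q)$, with $\mathrm{PGL}_2(\mathbb F_q)$ identified with the group of degree-one rational expressions (Möbius transformations) over $\mathbb F_q$ under composition, acts on $\mathbb F_q(x)$ by $(B,A)\cdot R(x)=B(R(A^{ -1}(x)))$; the equivalence classes are the $G(\mathbb F_q)$-orbits. -}

module Defs where

open import Level using (Level; _⊔_)
open import Algebra.Bundles using (CommutativeRing)
open import Data.Nat using (ℕ; zero; suc; _<_; _≤_)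
open import Data.Fin using (Fin)
open import Data.List using (List; []; _∷_; map)
open import Data.Product using (Σ; ∃; _×_; _,_)
open import Data.Sum using (_⊎_)
open import Relation.Nullary using (¬_)
open import Relation.Binary.PropositionalEquality using (_≡_)

private variable c ℓ : Level

module Poly (R : CommutativeRing c ℓ) where
  open CommutativeRing R renaming (Carrier to K)

  natR : ℕ → K
  natR zero = 0#
  natR (suc n) = 1# + natR n

  record IsFiniteField (q : ℕ) : Set (c ⊔ ℓ) where
    field
      nontrivial : ¬ (1# ≈ 0#)
      inverse    : ∀ x → ¬ (x ≈ 0#) → Σ K (λ y → x * y ≈ 1#)
      enum       : Fin q → K
      enum-inj   : ∀ i j → enum i ≈ enum j → i ≡ j
      enum-surj  : ∀ x → Σ (Fin q) (λ i → enum i ≈ x)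

  CharAtLeast5 : Set ℓ
  CharAtLeast5 = ∀ n → 1 ≤ n → n < 5 → ¬ (natR n ≈ 0#)

  -- Polynomials in one variable x over K: coefficient lists, lowest degree first.
  Pol : Set c
  Pol = List K

  coeff : Pol → ℕ → K
  coeff []       _       = 0#
  coeff (a ∷ p)  zero    = a
  coeff (a ∷ p)  (suc i) = coeff p i

  -- equality of polynomials (trailing zeros ignored)
  _≈ₚ_ : Pol → Pol → Set ℓ
  p ≈ₚ r = ∀ i → coeff p i ≈ coeff r i

  _+ₚ_ : Pol → Pol → Pol
  []      +ₚ r       = r
  (a ∷ p) +ₚ []      = a ∷ p
  (a ∷ p) +ₚ (b ∷ r) = (a + b) ∷ (p +ₚ r)

  _·ₚ_ : K → Pol → Pol
  a ·ₚ p = map (a *_) p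

  _*ₚ_ : Pol → Pol → Pol
  []      *ₚ r = []
  (a ∷ p) *ₚ r = (a ·ₚ r) +ₚ (0# ∷ (p *ₚ r))

  _^ₚ_ : Pol → ℕ → Pol
  p ^ₚ zero  = 1# ∷ []
  p ^ₚ suc n = p *ₚ (p ^ₚ n)

  -- deg p ≤ n (the zero polynomial has degree ≤ n for every n)
  DegLe : Pol → ℕ → Set ℓ
  DegLe p n = ∀ i → n < i → coeff p i ≈ 0#

  Coprime : Pol → Pol → Set (c ⊔ ℓ)
  Coprime g h = ∀ d u v → (d *ₚ u) ≈ₚ g → (d *ₚ v) ≈ₚ h → DegLe d 0

  RatExpr : Set c
  RatExpr = Pol × Pol

  num den : RatExpr → Pol
  num (g , h) = g
  den (g , h) = h

  _≃_ : RatExpr → RatExpr → Set ℓ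
  (g , h) ≃ (g' , h') = (g *ₚ h') ≈ₚ (g' *ₚ h)

  Cubic : RatExpr → Set (c ⊔ ℓ)
  Cubic (g , h) = Coprime g h × ¬ (h ≈ₚ []) × DegLe g 3 × DegLe h 3
                  × (¬ (coeff g 3 ≈ 0#) ⊎ ¬ (coeff h 3 ≈ 0#))

  -- Möbius transformation x ↦ (a x + b)/(c x + d), with a d - b c ≠ 0
  record Mob : Set (c ⊔ ℓ) where
    constructor mob
    field
      ma mb mc md : K
      nondeg : ¬ (ma * md - mb * mc ≈ 0#)

  postcomp : Mob → RatExpr → RatExpr
  postcomp (mob a b c' d _) (g , h) =
    (((a ·ₚ g) +ₚ (b ·ₚ h)) , ((c' ·ₚ g) +ₚ (d ·ₚ h)))

  -- homogenised substitution for deg ≤ 3: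
  -- Σ_{i ≤ 3} p_i (a x + b)^i (c x + d)^(3-i)
  hsub3 : Mob → Pol → Pol
  hsub3 (mob a b c' d _) p =
    term 0 +ₚ (term 1 +ₚ (term 2 +ₚ term 3))
    where
      lin num' : Pol
      lin  = b ∷ a ∷ []
      num' = d ∷ c' ∷ []
      term : ℕ → Pol
      term i = coeff p i ·ₚ ((lin ^ₚ i) *ₚ (num' ^ₚ (3 Data.Nat.∸ i)))

  -- (g/h) ∘ A for a rational expression of degree ≤ 3:
  -- g(A x)/h(A x) = hsub3 A g / hsub3 A h  (common factor (c x + d)^3 cancelled)
  precomp3 : RatExpr → Mob → RatExpr
  precomp3 (g , h) A = (hsub3 A g , hsub3 A h)

  -- (B , A) · R = B ∘ R ∘ A⁻¹ ; S lies in the G-orbit of R iff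
  -- S = B ∘ R ∘ A' for some Möbius B, A' (A' = A⁻¹ ranges over all of PGL₂).
  SameOrbit : RatExpr → RatExpr → Set (c ⊔ ℓ)
  SameOrbit R S = Σ Mob (λ B → Σ Mob (λ A → S ≃ postcomp B (precomp3 R A)))

{-# OPTIONS --safe #-}
-- A ramification point defined over the field can be moved to ∞, which leaves x³ + c x,
-- (x³ + t)/x and (x³ + x² + t)/x up to scaling.  Otherwise R is (x³ + a x + b)/(x² − m) with a
-- Wronskian W free of rational roots.  A parity count of the points of y² = W(x) shows that the
-- resolvent cubic of W has a rational root, so that an involution of the line preserves the
-- four critical points and even the pencil spanned by numerator and denominator.  If its
-- fixed points are rational they can be moved to 0 and ∞, and R becomes the odd function
-- (x³ + e x)/(x² + m).  If they are conjugate, R is z³ + α z in the coordinate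
-- z = (x − ν)/(x + ν) over the quadratic extension, and what remains is α modulo squares of
-- elements of norm 1: at most two classes for every norm.  This leaves 3 polynomials, 2(q − 1)
-- other ramified classes, 2(q − 1) odd ones and 1 + 2(q − 1) conjugate ones.
module Submission where

open import Defs
open import Algebra.Bundles using (CommutativeRing)
import Algebra.Solver.Ring as RingSolver
open import Algebra.Solver.Ring.AlmostCommutativeRing using (_-Raw-AlmostCommutative⟶_; fromCommutativeRing)
open import Data.Bool using (Bool; true; false; _xor_)
open import Data.Bool.Properties using (xor-∧-commutativeRing)
open import Data.Fin as Fin using (Fin)
import Data.Fin.Properties as FinP
open import Data.Integer as ℤ using (ℤ; +_; -[1+_])
import Data.Integer.Properties as ℤP
open import Data.List as List using (List; []; _∷_; _++_; length)
import Data.List.Properties as ListP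
open import Data.List.Membership.Propositional using (_∈_)
open import Data.List.Membership.Propositional.Properties using (∈-++⁺ʳ; ∈-map⁺; ∈-concatMap⁺; ∈-tabulate⁺)
open import Data.List.Relation.Unary.All as All using (All)
import Data.List.Relation.Unary.All.Properties as AllP
open import Data.List.Relation.Unary.Any as Any using (Any; here; there)
import Data.List.Relation.Unary.Any.Properties as AnyP
open import Data.Maybe using (Maybe; just; nothing)
open import Data.Nat as ℕ using (ℕ; zero; suc; z≤n; s≤s)
import Data.Nat.Properties as ℕP
open import Data.Product using (Σ; ∃; _×_; _,_; proj₁; proj₂)
open import Data.Sum using (_⊎_; inj₁; inj₂; [_,_]′)
open import Data.Vec as Vec using (Vec; []; _∷_)
open import Data.Vec.N-ary using (N-ary; _$ⁿ_)
open import Function using (_∘_)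
open import Level using (Level; _⊔_)
open import Relation.Binary.PropositionalEquality as ≡ using (_≡_)
open import Relation.Nullary using (¬_; Dec; yes; no; contradiction)
open import Relation.Nullary.Decidable
  using (does; map′; _×-dec_; _⊎-dec_; ¬?; dec-true; dec-false; decidable-stable)

-- The argument runs on pencils of binary cubic forms, where ∞ is an ordinary point and composition
-- on either side is linear in the coefficients. Coprimality quantifies over all polynomials; it is
-- traded for the absence of a common factor of degree 1, 2 or 3, a finite search invariant under
-- equivalence. Each reduction uses it to exclude vanishing denominators, and degenerate members of
-- the normal families are filtered out by it. The involution comes from Ferrari's method. A root u
-- of the resolvent gives W = (x² - u)² + κ (x - s)². With X = x - s and j = s² - u, the map X ↦ j/X
-- multiplies both x² - u and x - s by j/X², hence preserves the roots of W. It preserves the pencil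
-- because the transform of the denominator lies in it. In the conjugate case the other member of
-- the pencil is the conjugate form, so that the full expression is (z³ + α z)/(ᾱ z² + 1). The maps
-- z ↦ (δ/δ̄) z, which fix both conjugate points, replace α by α (δ̄/δ)²; this is where the squares
-- of elements of norm 1 come from.

-- Binary cubic forms, pencils and their normal forms

record Cub {a} (A : Set a) : Set a where
  constructor cub
  field c₀ c₁ c₂ c₃ : A
open Cub

record Mat {a} (A : Set a) : Set a where
  constructor mat
  field m₁₁ m₁₂ m₂₁ m₂₂ : A

Pencil : ∀ {a} → Set a → Set a
Pencil A = Cub A × Cub A

-- The form operations are written over an arbitrary signature so that they can be
-- interpreted both in the field and in the syntax of the ring solver.
module Forms {a} {A : Set a} (_⊕_ _⊗_ : A → A → A) (⊝_ : A → A) (# : ℕ → A) where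

  det : Mat A → A
  det (mat a b c d) = (a ⊗ d) ⊕ (⊝ (b ⊗ c))

  adj : Mat A → Mat A
  adj (mat a b c d) = mat d (⊝ b) (⊝ c) a

  _∙_ : Mat A → Mat A → Mat A
  mat a b c d ∙ mat a′ b′ c′ d′ =
    mat ((a ⊗ a′) ⊕ (b ⊗ c′)) ((a ⊗ b′) ⊕ (b ⊗ d′)) ((c ⊗ a′) ⊕ (d ⊗ c′)) ((c ⊗ b′) ⊕ (d ⊗ d′))

  cube : A → A
  cube x = x ⊗ (x ⊗ x)

  scale : A → Cub A → Cub A
  scale k (cub p₀ p₁ p₂ p₃) = cub (k ⊗ p₀) (k ⊗ p₁) (k ⊗ p₂) (k ⊗ p₃)

  comb : A → A → Cub A → Cub A → Cub A
  comb α β (cub p₀ p₁ p₂ p₃) (cub r₀ r₁ r₂ r₃) =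
    cub ((α ⊗ p₀) ⊕ (β ⊗ r₀)) ((α ⊗ p₁) ⊕ (β ⊗ r₁)) ((α ⊗ p₂) ⊕ (β ⊗ r₂)) ((α ⊗ p₃) ⊕ (β ⊗ r₃))

  subst : Mat A → Cub A → Cub A
  subst (mat a b c d) (cub p₀ p₁ p₂ p₃) = cub
    (outer b d p₀ p₁ p₂ p₃) (inner a b c d p₀ p₁ p₂ p₃)
    -- Exchanging the two new variables exchanges the columns of the matrix, so the coefficient of
    -- x² is that of x with a, b and c, d swapped.
    (inner b a d c p₀ p₁ p₂ p₃) (outer a c p₀ p₁ p₂ p₃)
    where
    outer : A → A → A → A → A → A → A
    outer x y p q r s = (((p ⊗ cube y) ⊕ (q ⊗ (x ⊗ (y ⊗ y)))) ⊕ (r ⊗ (x ⊗ (x ⊗ y)))) ⊕ (s ⊗ cube x)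
    inner : A → A → A → A → A → A → A → A → A
    inner x y z w p q r s =
      (((# 3 ⊗ (p ⊗ (z ⊗ (w ⊗ w)))) ⊕ (q ⊗ ((x ⊗ (w ⊗ w)) ⊕ (# 2 ⊗ (y ⊗ (z ⊗ w))))))
        ⊕ (r ⊗ ((# 2 ⊗ (x ⊗ (y ⊗ w))) ⊕ (y ⊗ (y ⊗ z))))) ⊕ (# 3 ⊗ (s ⊗ (x ⊗ (y ⊗ y))))

  eval : Cub A → A → A → A
  eval (cub p₀ p₁ p₂ p₃) x z =
    (((p₀ ⊗ cube z) ⊕ (p₁ ⊗ (x ⊗ (z ⊗ z)))) ⊕ (p₂ ⊗ (x ⊗ (x ⊗ z)))) ⊕ (p₃ ⊗ cube x)

  substQ : Mat A → A × A × A → A × A × A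
  substQ (mat a b c d) (p₀ , p₁ , p₂) =
    ((p₀ ⊗ (d ⊗ d)) ⊕ (p₁ ⊗ (b ⊗ d))) ⊕ (p₂ ⊗ (b ⊗ b)) ,
    ((# 2 ⊗ (p₀ ⊗ (c ⊗ d))) ⊕ (p₁ ⊗ ((a ⊗ d) ⊕ (b ⊗ c)))) ⊕ (# 2 ⊗ (p₂ ⊗ (a ⊗ b))) ,
    ((p₀ ⊗ (c ⊗ c)) ⊕ (p₁ ⊗ (a ⊗ c))) ⊕ (p₂ ⊗ (a ⊗ a))

  substL : Mat A → A × A → A × A
  substL (mat a b c d) (p₀ , p₁) = (p₀ ⊗ d) ⊕ (p₁ ⊗ b) , (p₀ ⊗ c) ⊕ (p₁ ⊗ a)

  combL : A → A → A × A → A × A → A × A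
  combL α β (u₀ , u₁) (v₀ , v₁) = (α ⊗ u₀) ⊕ (β ⊗ v₀) , (α ⊗ u₁) ⊕ (β ⊗ v₁)

  mulQL : A × A × A → A × A → Cub A
  mulQL (p₀ , p₁ , p₂) (r₀ , r₁) = cub (p₀ ⊗ r₀) ((p₀ ⊗ r₁) ⊕ (p₁ ⊗ r₀)) ((p₁ ⊗ r₁) ⊕ (p₂ ⊗ r₀)) (p₂ ⊗ r₁)

  act : Mat A → Mat A → Pencil A → Pencil A
  act (mat α β γ δ) M (g , h) = comb α β (subst M g) (subst M h) , comb γ δ (subst M g) (subst M h)

  -- The Wronskian of (x³ + a x + b)/(x² − m).
  wronskian : A → A → A → A → A
  wronskian a b m x = ((((x ⊗ x) ⊗ (x ⊗ x)) ⊕ (⊝ (((# 3 ⊗ m) ⊕ a) ⊗ (x ⊗ x)))) ⊕ (⊝ (# 2 ⊗ (b ⊗ x)))) ⊕ (⊝ (a ⊗ m))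

  slope : A → A → A → A
  slope a m u = ((# 2 ⊗ u) ⊕ (⊝ (# 3 ⊗ m))) ⊕ (⊝ a)

  -- The curve y² = wronskian x with y = u − x².
  curve : A → A → A → A → A → A
  curve a b m x u = (((slope a m u ⊗ (x ⊗ x)) ⊕ (⊝ (# 2 ⊗ (b ⊗ x)))) ⊕ (⊝ (a ⊗ m))) ⊕ (⊝ (u ⊗ u))

  -- A quarter of the discriminant in x of the curve.
  resolvent : A → A → A → A → A
  resolvent a b m u = (b ⊗ b) ⊕ (slope a m u ⊗ ((u ⊗ u) ⊕ (a ⊗ m)))

  reduced : A → A → A → Pencil A
  reduced a b m = cub b a (# 0) (# 1) , cub (⊝ m) (# 0) (# 1) (# 0)

  -- The span of h = x² + 2 s x + l and its transform x³ h(n/x).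
  symmetric : A → A → A → Pencil A
  symmetric s l n = cub (# 0) (n ⊗ n) (# 2 ⊗ (s ⊗ n)) l , cub l (# 2 ⊗ s) (# 1) (# 0)

  mulL : A → A × A → A × A → A × A
  mulL n (x₀ , x₁) (y₀ , y₁) = (x₀ ⊗ y₀) ⊕ (n ⊗ (x₁ ⊗ y₁)) , (x₀ ⊗ y₁) ⊕ (x₁ ⊗ y₀)

  conj : A × A → A × A
  conj (x₀ , x₁) = x₀ , ⊝ x₁

  scaleL : A → A × A → A × A
  scaleL k (x₀ , x₁) = k ⊗ x₀ , k ⊗ x₁

  norm : A → A × A → A
  norm n (x₀ , x₁) = (x₀ ⊗ x₀) ⊕ (⊝ (n ⊗ (x₁ ⊗ x₁)))

  -- With ν² = n and α = α₀ + α₁ ν, the two cubics are the components over 1 and ν of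
  -- ω (x − ν)³ + α (x − ν)(x + ν)².
  twisted : A → A → A × A → Pencil A
  twisted n ω (α₀ , α₁) =
    cub (⊝ (n ⊗ (n ⊗ α₁))) ((# 3 ⊗ (ω ⊗ n)) ⊕ (⊝ (n ⊗ α₀))) (n ⊗ α₁) (ω ⊕ α₀) ,
    cub (⊝ ((ω ⊗ n) ⊕ (n ⊗ α₀))) (⊝ (n ⊗ α₁)) (α₀ ⊕ (⊝ (# 3 ⊗ ω))) α₁

  scale₂ : A → Pencil A → Pencil A
  scale₂ k (g , h) = scale k g , scale k h

-- Polynomial identities with integer coefficients

module IntSolver {c ℓ : Level} (K : CommutativeRing c ℓ) where
  open CommutativeRing K renaming (Carrier to A)
  open import Algebra.Properties.Ring ring
  open import Algebra.Properties.Semiring.Mult.TCOptimised semiring using (×-homo-+; ×1-homo-*; 1+×) renaming (_×_ to _⨯_)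
  open import Relation.Binary.Reasoning.Setoid setoid

  -- With the optimised multiples, the images of 0 and 1 reduce to `0#` and `1#`, so solver terms
  -- denote expressions with the literal constants.
  ⟦_⟧ℤ : ℤ → A
  ⟦ + n ⟧ℤ = n ⨯ 1#
  ⟦ -[1+ n ] ⟧ℤ = - (suc n ⨯ 1#)

  ⊖-homo : ∀ m n → ⟦ m ℤ.⊖ n ⟧ℤ ≈ m ⨯ 1# + - (n ⨯ 1#)
  ⊖-homo m zero = trans (sym (+-identityʳ _)) (+-congˡ (sym -0#≈0#))
  ⊖-homo zero (suc n) = sym (+-identityˡ _)
  ⊖-homo (suc m) (suc n) = begin
    ⟦ suc m ℤ.⊖ suc n ⟧ℤ                ≡⟨ ≡.cong ⟦_⟧ℤ (ℤP.[1+m]⊖[1+n]≡m⊖n m n) ⟩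
    ⟦ m ℤ.⊖ n ⟧ℤ                        ≈⟨ ⊖-homo m n ⟩
    m ⨯ 1# + - (n ⨯ 1#)                 ≈⟨ +-congʳ (sym (+-identityˡ _)) ⟩
    (0# + m ⨯ 1#) + - (n ⨯ 1#)          ≈⟨ +-congʳ (+-congʳ (sym (-‿inverseʳ 1#))) ⟩
    ((1# + - 1#) + m ⨯ 1#) + - (n ⨯ 1#) ≈⟨ +-congʳ (trans (+-assoc _ _ _) (trans (+-congˡ (+-comm _ _)) (sym (+-assoc _ _ _)))) ⟩
    ((1# + m ⨯ 1#) + - 1#) + - (n ⨯ 1#) ≈⟨ +-assoc _ _ _ ⟩
    (1# + m ⨯ 1#) + (- 1# + - (n ⨯ 1#)) ≈⟨ +-congˡ (-‿+-comm _ _) ⟩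
    (1# + m ⨯ 1#) + - (1# + n ⨯ 1#)     ≈⟨ +-cong (sym (1+× m 1#)) (-‿cong (sym (1+× n 1#))) ⟩
    suc m ⨯ 1# + - (suc n ⨯ 1#)         ∎

  neg-homo : ∀ i → ⟦ ℤ.- i ⟧ℤ ≈ - ⟦ i ⟧ℤ
  neg-homo (+ zero)   = sym -0#≈0#
  neg-homo (+ suc n)  = refl
  neg-homo (-[1+ n ]) = sym (-‿involutive _)

  plus-homo : ∀ i j → ⟦ i ℤ.+ j ⟧ℤ ≈ ⟦ i ⟧ℤ + ⟦ j ⟧ℤ
  plus-homo (+ m) (+ n) = ×-homo-+ 1# m n
  plus-homo (+ m) (-[1+ n ]) = ⊖-homo m (suc n)
  plus-homo (-[1+ m ]) (+ n) = trans (⊖-homo n (suc m)) (+-comm _ _)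
  plus-homo (-[1+ m ]) (-[1+ n ]) = begin
    - (suc (suc (m ℕ.+ n)) ⨯ 1#)      ≡⟨ ≡.cong (λ k → - (k ⨯ 1#)) (≡.sym (≡.cong suc (ℕP.+-suc m n))) ⟩
    - ((suc m ℕ.+ suc n) ⨯ 1#)        ≈⟨ -‿cong (×-homo-+ 1# (suc m) (suc n)) ⟩
    - (suc m ⨯ 1# + suc n ⨯ 1#)       ≈⟨ sym (-‿+-comm _ _) ⟩
    - (suc m ⨯ 1#) + - (suc n ⨯ 1#)   ∎

  mul-pos : ∀ m j → ⟦ + m ℤ.* j ⟧ℤ ≈ (m ⨯ 1#) * ⟦ j ⟧ℤ
  mul-pos m (+ n) = trans (reflexive (≡.cong ⟦_⟧ℤ (≡.sym (ℤP.pos-* m n)))) (×1-homo-* m n)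
  mul-pos m (-[1+ n ]) = begin
    ⟦ + m ℤ.* -[1+ n ] ⟧ℤ         ≡⟨ ≡.cong ⟦_⟧ℤ (≡.sym (ℤP.neg-distribʳ-* (+ m) (+ suc n))) ⟩
    ⟦ ℤ.- (+ m ℤ.* + suc n) ⟧ℤ    ≈⟨ neg-homo (+ m ℤ.* + suc n) ⟩
    - ⟦ + m ℤ.* + suc n ⟧ℤ        ≈⟨ -‿cong (mul-pos m (+ suc n)) ⟩
    - ((m ⨯ 1#) * (suc n ⨯ 1#))   ≈⟨ -‿distribʳ-* _ _ ⟩
    (m ⨯ 1#) * - (suc n ⨯ 1#)     ∎

  mul-homo : ∀ i j → ⟦ i ℤ.* j ⟧ℤ ≈ ⟦ i ⟧ℤ * ⟦ j ⟧ℤ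
  mul-homo (+ m) j = mul-pos m j
  mul-homo (-[1+ m ]) j = begin
    ⟦ -[1+ m ] ℤ.* j ⟧ℤ         ≡⟨ ≡.cong ⟦_⟧ℤ (≡.sym (ℤP.neg-distribˡ-* (+ suc m) j)) ⟩
    ⟦ ℤ.- (+ suc m ℤ.* j) ⟧ℤ    ≈⟨ neg-homo (+ suc m ℤ.* j) ⟩
    - ⟦ + suc m ℤ.* j ⟧ℤ        ≈⟨ -‿cong (mul-pos (suc m) j) ⟩
    - ((suc m ⨯ 1#) * ⟦ j ⟧ℤ)   ≈⟨ -‿distribˡ-* _ _ ⟩
    - (suc m ⨯ 1#) * ⟦ j ⟧ℤ     ∎

  morph : ℤ.+-*-rawRing -Raw-AlmostCommutative⟶ fromCommutativeRing K
  morph = record { ⟦_⟧ = ⟦_⟧ℤ ; +-homo = plus-homo ; *-homo = mul-homo ; -‿homo = neg-homo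
                 ; 0-homo = refl ; 1-homo = refl }

  dec : ∀ i j → Maybe (⟦ i ⟧ℤ ≈ ⟦ j ⟧ℤ)
  dec i j with i ℤ.≟ j
  ... | yes ≡.refl = just refl
  ... | no _ = nothing

  open RingSolver ℤ.+-*-rawRing (fromCommutativeRing K) morph dec public
    using (solve; _:=_; _:+_; _:*_; :-_; _:-_; con; Polynomial; prove; var; ⟦_⟧; ⟦_⟧↓)

  infix 4 _≋_ _≋₂_
  _≋_ : Cub A → Cub A → Set ℓ
  p ≋ r = (c₀ p ≈ c₀ r) × (c₁ p ≈ c₁ r) × (c₂ p ≈ c₂ r) × (c₃ p ≈ c₃ r)

  _≋₂_ : Pencil A → Pencil A → Set ℓ
  (g , h) ≋₂ (g′ , h′) = (g ≋ g′) × (h ≋ h′)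

  # : ℕ → A
  # n = n ⨯ 1#

  open Forms _+_ _*_ -_ # public
  module Syn {n} = Forms {A = Polynomial n} _:+_ _:*_ :-_ (λ k → con (+ k))

  mapC : ∀ {a b} {X : Set a} {Y : Set b} → (X → Y) → Cub X → Cub Y
  mapC f (cub p₀ p₁ p₂ p₃) = cub (f p₀) (f p₁) (f p₂) (f p₃)

  close : ∀ {b} {B : Set b} n → N-ary n (Polynomial n) B → B
  close n f = f $ⁿ Vec.map var (Vec.allFin n)

  normC sem : ∀ {n} → Vec A n → Cub (Polynomial n) → Cub A
  normC ρ = mapC (λ e → ⟦ e ⟧↓ ρ)
  sem ρ = mapC (λ e → ⟦ e ⟧ ρ)

  proveC : ∀ {n} (ρ : Vec A n) l r → normC ρ l ≡ normC ρ r → sem ρ l ≋ sem ρ r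
  proveC ρ l r eq =
    prove ρ (c₀ l) (c₀ r) (reflexive (≡.cong c₀ eq)) , prove ρ (c₁ l) (c₁ r) (reflexive (≡.cong c₁ eq)) ,
    prove ρ (c₂ l) (c₂ r) (reflexive (≡.cong c₂ eq)) , prove ρ (c₃ l) (c₃ r) (reflexive (≡.cong c₃ eq))

  semP : ∀ {n} → Vec A n → Pencil (Polynomial n) → Pencil A
  semP ρ (g , h) = sem ρ g , sem ρ h

  -- An equation of forms is four ring identities. Their normal forms are compared in one
  -- propositional equality, which `≡.refl` settles by computation.
  solveC : ∀ n (f : N-ary n (Polynomial n) (Cub (Polynomial n) × Cub (Polynomial n))) (ρ : Vec A n) →
           normC ρ (proj₁ (close n f)) ≡ normC ρ (proj₂ (close n f)) →
           sem ρ (proj₁ (close n f)) ≋ sem ρ (proj₂ (close n f))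
  solveC n f ρ = proveC ρ (proj₁ (close n f)) (proj₂ (close n f))

  solveP : ∀ n (f : N-ary n (Polynomial n) (Pencil (Polynomial n) × Pencil (Polynomial n))) (ρ : Vec A n) →
           (let l = proj₁ (close n f) ; r = proj₂ (close n f)) →
           normC ρ (proj₁ l) ≡ normC ρ (proj₁ r) → normC ρ (proj₂ l) ≡ normC ρ (proj₂ r) →
           (sem ρ (proj₁ l) , sem ρ (proj₂ l)) ≋₂ (sem ρ (proj₁ r) , sem ρ (proj₂ r))
  solveP n f ρ eq₁ eq₂ = proveC ρ (proj₁ l) (proj₁ r) eq₁ , proveC ρ (proj₂ l) (proj₂ r) eq₂
    where
    l = proj₁ (close n f)
    r = proj₂ (close n f)

-- Arithmetic of the field and equivalence of pencils

module Field {c ℓ : Level} (K : CommutativeRing c ℓ) (q : ℕ)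
             (finite : Poly.IsFiniteField K q) (char≥5 : Poly.CharAtLeast5 K) where
  open CommutativeRing K renaming (Carrier to A) public
  open IntSolver K public
  open Poly.IsFiniteField finite public
  open import Algebra.Properties.Ring ring public using (-0#≈0#; -‿involutive)
  open import Relation.Binary.Reasoning.Setoid setoid

  infix 4 _≟_

  index : A → Fin q
  index x = proj₁ (enum-surj x)

  enum-index : ∀ x → enum (index x) ≈ x
  enum-index x = proj₂ (enum-surj x)

  index-injective : ∀ {x y} → index x ≡ index y → x ≈ y
  index-injective {x} {y} eq = trans (sym (enum-index x)) (trans (reflexive (≡.cong enum eq)) (enum-index y))

  index-cong : ∀ {x y} → x ≈ y → index x ≡ index y
  index-cong x≈y = enum-inj _ _ (trans (enum-index _) (trans x≈y (sym (enum-index _))))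

  _≟_ : ∀ x y → Dec (x ≈ y)
  x ≟ y = map′ index-injective index-cong (index x Fin.≟ index y)

  any? : ∀ {p} {P : A → Set p} → (∀ x → Dec (P x)) → (∀ {x y} → x ≈ y → P x → P y) → Dec (∃ P)
  any? {P = P} P? resp = map′ (λ (i , p) → enum i , p) (λ (x , p) → index x , resp (sym (enum-index x)) p)
                              (FinP.any? (λ i → P? (enum i)))

  2≉0 : # 2 ≉ 0#
  2≉0 e = char≥5 2 (s≤s z≤n) (s≤s (s≤s (s≤s z≤n))) (trans (+-congˡ (+-identityʳ 1#)) e)

  3≉0 : # 3 ≉ 0#
  3≉0 e = char≥5 3 (s≤s z≤n) (s≤s (s≤s (s≤s (s≤s z≤n))))
    (trans (+-congˡ (+-congˡ (+-identityʳ 1#))) (trans (sym (+-assoc 1# 1# 1#)) e))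

  *-cancel-0 : ∀ {x y} → x ≉ 0# → x * y ≈ 0# → y ≈ 0#
  *-cancel-0 {x} {y} x≉0 xy≈0 = let x⁻¹ , inv = inverse x x≉0 in begin
    y               ≈⟨ sym (*-identityˡ y) ⟩
    1# * y          ≈⟨ *-congʳ (sym (trans (*-comm _ _) inv)) ⟩
    (x⁻¹ * x) * y   ≈⟨ *-assoc _ _ _ ⟩
    x⁻¹ * (x * y)   ≈⟨ *-congˡ xy≈0 ⟩
    x⁻¹ * 0#        ≈⟨ zeroʳ _ ⟩
    0#              ∎

  infixl 7 _*≉0_
  _*≉0_ : ∀ {x y} → x ≉ 0# → y ≉ 0# → x * y ≉ 0#
  (x≉0 *≉0 y≉0) xy≈0 = y≉0 (*-cancel-0 x≉0 xy≈0)

  -≉0 : ∀ {x} → x ≉ 0# → - x ≉ 0#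
  -≉0 {x} x≉0 -x≈0 = x≉0 (trans (sym (-‿involutive x)) (trans (-‿cong -x≈0) -0#≈0#))

  cube≉0 : ∀ {x} → x ≉ 0# → cube x ≉ 0#
  cube≉0 x≉0 = x≉0 *≉0 (x≉0 *≉0 x≉0)

  *≈0 : ∀ {x y} → x * y ≈ 0# → x ≈ 0# ⊎ y ≈ 0#
  *≈0 {x} e with x ≟ 0#
  ... | yes x≈0 = inj₁ x≈0
  ... | no  x≉0 = inj₂ (*-cancel-0 x≉0 e)

  ≉0-resp : ∀ {x y} → x ≈ y → x ≉ 0# → y ≉ 0#
  ≉0-resp x≈y x≉0 y≈0 = x≉0 (trans x≈y y≈0)

  abstract
    divide : ∀ x {y} → y ≉ 0# → Σ A (λ z → x ≈ y * z)
    divide x {y} y≉0 = let y⁻¹ , inv = inverse y y≉0 in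
      x * y⁻¹ , trans (sym (*-identityʳ x)) (trans (*-congˡ (sym inv))
        (solve 3 (λ x y z → x :* (y :* z) := y :* (x :* z)) refl x y y⁻¹))

  -- Consequences of polynomial hypotheses are proved by ideal membership: a solver identity writes
  -- the target as a sum of cofactor times hypothesis, and each `drop` discharges one summand.
  drop : ∀ {x y} z {e} → e ≈ 0# → x ≈ y + z * e → x ≈ y
  drop z e≈0 x≈ = trans x≈ (trans (+-congˡ (trans (*-congˡ e≈0) (zeroʳ z))) (+-identityʳ _))

  ≋-refl : ∀ {p} → p ≋ p
  ≋-refl = refl , refl , refl , refl

  ≋-sym : ∀ {p r} → p ≋ r → r ≋ p
  ≋-sym (a , b , c , d) = sym a , sym b , sym c , sym d

  ≋-trans : ∀ {p r s} → p ≋ r → r ≋ s → p ≋ s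
  ≋-trans (a , b , c , d) (a′ , b′ , c′ , d′) = trans a a′ , trans b b′ , trans c c′ , trans d d′

  ≋₂-sym : ∀ {R S} → R ≋₂ S → S ≋₂ R
  ≋₂-sym (p , r) = ≋-sym p , ≋-sym r

  ≋₂-trans : ∀ {R S T} → R ≋₂ S → S ≋₂ T → R ≋₂ T
  ≋₂-trans (p , r) (p′ , r′) = ≋-trans p p′ , ≋-trans r r′

  scale-cong : ∀ k {p r} → p ≋ r → scale k p ≋ scale k r
  scale-cong k (a , b , c , d) = *-congˡ a , *-congˡ b , *-congˡ c , *-congˡ d

  comb-cong : ∀ α β {p p′ r r′} → p ≋ p′ → r ≋ r′ → comb α β p r ≋ comb α β p′ r′
  comb-cong α β (a , b , c , d) (a′ , b′ , c′ , d′) =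
    +-cong (*-congˡ a) (*-congˡ a′) , +-cong (*-congˡ b) (*-congˡ b′) ,
    +-cong (*-congˡ c) (*-congˡ c′) , +-cong (*-congˡ d) (*-congˡ d′)

  subst-cong : ∀ M {p r} → p ≋ r → subst M p ≋ subst M r
  subst-cong M (e₀ , e₁ , e₂ , e₃) =
    +-cong (+-cong (+-cong (*-congʳ e₀) (*-congʳ e₁)) (*-congʳ e₂)) (*-congʳ e₃) ,
    +-cong (+-cong (+-cong (*-congˡ (*-congʳ e₀)) (*-congʳ e₁)) (*-congʳ e₂)) (*-congˡ (*-congʳ e₃)) ,
    +-cong (+-cong (+-cong (*-congˡ (*-congʳ e₀)) (*-congʳ e₁)) (*-congʳ e₂)) (*-congˡ (*-congʳ e₃)) ,
    +-cong (+-cong (+-cong (*-congʳ e₀) (*-congʳ e₁)) (*-congʳ e₂)) (*-congʳ e₃)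

  act-cong : ∀ B M {R S} → R ≋₂ S → act B M R ≋₂ act B M S
  act-cong (mat α β γ δ) M (p , r) =
    comb-cong α β (subst-cong M p) (subst-cong M r) , comb-cong γ δ (subst-cong M p) (subst-cong M r)

  subst-∙ : ∀ M N p → subst N (subst M p) ≋ subst (M ∙ N) p
  subst-∙ (mat a b c d) (mat a′ b′ c′ d′) (cub p₀ p₁ p₂ p₃) = solveC 12
    (λ a b c d a′ b′ c′ d′ p₀ p₁ p₂ p₃ → let M = mat a b c d ; N = mat a′ b′ c′ d′ ; p = cub p₀ p₁ p₂ p₃ in
      Syn.subst N (Syn.subst M p) , Syn.subst (M Syn.∙ N) p)
    (a ∷ b ∷ c ∷ d ∷ a′ ∷ b′ ∷ c′ ∷ d′ ∷ p₀ ∷ p₁ ∷ p₂ ∷ p₃ ∷ []) ≡.refl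

  subst-comb : ∀ N α β p r → subst N (comb α β p r) ≋ comb α β (subst N p) (subst N r)
  subst-comb (mat a b c d) α β (cub p₀ p₁ p₂ p₃) (cub r₀ r₁ r₂ r₃) = solveC 14
    (λ a b c d α β p₀ p₁ p₂ p₃ r₀ r₁ r₂ r₃ → let N = mat a b c d ; p = cub p₀ p₁ p₂ p₃ ; r = cub r₀ r₁ r₂ r₃ in
      Syn.subst N (Syn.comb α β p r) , Syn.comb α β (Syn.subst N p) (Syn.subst N r))
    (a ∷ b ∷ c ∷ d ∷ α ∷ β ∷ p₀ ∷ p₁ ∷ p₂ ∷ p₃ ∷ r₀ ∷ r₁ ∷ r₂ ∷ r₃ ∷ []) ≡.refl

  subst-scale : ∀ N k p → subst N (scale k p) ≋ scale k (subst N p)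
  subst-scale (mat a b c d) k (cub p₀ p₁ p₂ p₃) = solveC 9
    (λ a b c d k p₀ p₁ p₂ p₃ → let N = mat a b c d ; p = cub p₀ p₁ p₂ p₃ in
      Syn.subst N (Syn.scale k p) , Syn.scale k (Syn.subst N p))
    (a ∷ b ∷ c ∷ d ∷ k ∷ p₀ ∷ p₁ ∷ p₂ ∷ p₃ ∷ []) ≡.refl

  comb-comb : ∀ x y α β γ δ p r → comb x y (comb α β p r) (comb γ δ p r) ≋ comb (x * α + y * γ) (x * β + y * δ) p r
  comb-comb x y α β γ δ (cub p₀ p₁ p₂ p₃) (cub r₀ r₁ r₂ r₃) = solveC 14
    (λ x y α β γ δ p₀ p₁ p₂ p₃ r₀ r₁ r₂ r₃ → let p = cub p₀ p₁ p₂ p₃ ; r = cub r₀ r₁ r₂ r₃ in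
      Syn.comb x y (Syn.comb α β p r) (Syn.comb γ δ p r) , Syn.comb (x :* α :+ y :* γ) (x :* β :+ y :* δ) p r)
    (x ∷ y ∷ α ∷ β ∷ γ ∷ δ ∷ p₀ ∷ p₁ ∷ p₂ ∷ p₃ ∷ r₀ ∷ r₁ ∷ r₂ ∷ r₃ ∷ []) ≡.refl

  comb-scale : ∀ α β k p r → comb α β (scale k p) (scale k r) ≋ scale k (comb α β p r)
  comb-scale α β k (cub p₀ p₁ p₂ p₃) (cub r₀ r₁ r₂ r₃) = solveC 11
    (λ α β k p₀ p₁ p₂ p₃ r₀ r₁ r₂ r₃ → let p = cub p₀ p₁ p₂ p₃ ; r = cub r₀ r₁ r₂ r₃ in
      Syn.comb α β (Syn.scale k p) (Syn.scale k r) , Syn.scale k (Syn.comb α β p r))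
    (α ∷ β ∷ k ∷ p₀ ∷ p₁ ∷ p₂ ∷ p₃ ∷ r₀ ∷ r₁ ∷ r₂ ∷ r₃ ∷ []) ≡.refl

  scale-scale : ∀ k l p → scale k (scale l p) ≋ scale (k * l) p
  scale-scale k l p = sym (*-assoc _ _ _) , sym (*-assoc _ _ _) , sym (*-assoc _ _ _) , sym (*-assoc _ _ _)

  scale-congˡ : ∀ {k l} p → k ≈ l → scale k p ≋ scale l p
  scale-congˡ p e = *-congʳ e , *-congʳ e , *-congʳ e , *-congʳ e

  comb-congˡ : ∀ {α α′ β β′} p r → α ≈ α′ → β ≈ β′ → comb α β p r ≋ comb α′ β′ p r
  comb-congˡ p r e e′ = +-cong (*-congʳ e) (*-congʳ e′) , +-cong (*-congʳ e) (*-congʳ e′) ,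
    +-cong (*-congʳ e) (*-congʳ e′) , +-cong (*-congʳ e) (*-congʳ e′)

  -- Substitution acts from the right and recombination from the left, hence the opposite orders of
  -- the two products.
  act-∙ : ∀ B M B′ M′ R → act B′ M′ (act B M R) ≋₂ act (B′ ∙ B) (M ∙ M′) R
  act-∙ (mat α β γ δ) M (mat α′ β′ γ′ δ′) M′ (g , h) = line α′ β′ , line γ′ δ′
    where
    line : ∀ x y → comb x y (subst M′ (comb α β (subst M g) (subst M h))) (subst M′ (comb γ δ (subst M g) (subst M h)))
                   ≋ comb (x * α + y * γ) (x * β + y * δ) (subst (M ∙ M′) g) (subst (M ∙ M′) h)
    line x y = ≋-trans (comb-cong x y (subst-comb M′ α β _ _) (subst-comb M′ γ δ _ _))
      (≋-trans (comb-comb x y α β γ δ _ _) (comb-cong _ _ (subst-∙ M M′ g) (subst-∙ M M′ h)))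

  act-scale : ∀ B M k R → act B M (scale₂ k R) ≋₂ scale₂ k (act B M R)
  act-scale (mat α β γ δ) M k (g , h) = line α β , line γ δ
    where
    line : ∀ x y → comb x y (subst M (scale k g)) (subst M (scale k h)) ≋ scale k (comb x y (subst M g) (subst M h))
    line x y = ≋-trans (comb-cong x y (subst-scale M k g) (subst-scale M k h)) (comb-scale x y k _ _)

  -- The scalar `k` keeps the relation free of division: a pair of forms matters only up to a common
  -- factor.
  record Orbit (R S : Pencil A) : Set (c ⊔ ℓ) where
    constructor orbit
    field
      B M    : Mat A
      k      : A
      det-B  : det B ≉ 0#
      det-M  : det M ≉ 0#
      k≉0    : k ≉ 0#
      scaled : scale₂ k S ≋₂ act B M R

  det-∙ : ∀ M N → det (M ∙ N) ≈ det M * det N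
  det-∙ (mat a b c d) (mat a′ b′ c′ d′) = solve 8 (λ a b c d a′ b′ c′ d′ → let M = mat a b c d ; N = mat a′ b′ c′ d′ in
    Syn.det (M Syn.∙ N) := Syn.det M :* Syn.det N) refl a b c d a′ b′ c′ d′

  det-adj : ∀ M → det (adj M) ≈ det M
  det-adj (mat a b c d) = solve 4 (λ a b c d → Syn.det (Syn.adj (mat a b c d)) := Syn.det (mat a b c d)) refl a b c d

  Orbit-trans : ∀ {R S T} → Orbit R S → Orbit S T → Orbit R T
  Orbit-trans {R} {S} {T} (orbit B M k dB dM k≉0 e) (orbit B′ M′ k′ dB′ dM′ k′≉0 e′) =
    orbit (B′ ∙ B) (M ∙ M′) (k * k′) (≉0-resp (sym (det-∙ B′ B)) (dB′ *≉0 dB))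
          (≉0-resp (sym (det-∙ M M′)) (dM *≉0 dM′)) (k≉0 *≉0 k′≉0)
      (≋₂-trans (≋-sym (scale-scale k k′ _) , ≋-sym (scale-scale k k′ _))
      (≋₂-trans (scale-cong k (proj₁ e′) , scale-cong k (proj₂ e′))
      (≋₂-trans (≋₂-sym (act-scale B′ M′ k S))
      (≋₂-trans (act-cong B′ M′ e) (act-∙ B M B′ M′ R)))))

  -- Both products with an adjugate are scalar matrices; the one on the source enters a form of
  -- degree 3 by its cube.
  act-adj : ∀ B M R → act (adj B ∙ B) (M ∙ adj M) R ≋₂ scale₂ (det B * cube (det M)) R
  act-adj (mat α β γ δ) M (g , h) =
      ≋-trans (comb-congˡ _ _ refl (solve 4 (λ α β γ δ → δ :* β :+ :- β :* δ := con (+ 0)) refl α β γ δ)) (first _ _ _ (sub M g) )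
    , ≋-trans (comb-congˡ _ _ (solve 4 (λ α β γ δ → :- γ :* α :+ α :* γ := con (+ 0)) refl α β γ δ)
        (solve 4 (λ α β γ δ → :- γ :* β :+ α :* δ := δ :* α :+ :- β :* γ) refl α β γ δ)) (second _ _ _ (sub M h))
    where
    sub : ∀ M p → subst (M ∙ adj M) p ≋ scale (cube (det M)) p
    sub (mat a b c d) (cub p₀ p₁ p₂ p₃) = solveC 8 (λ a b c d p₀ p₁ p₂ p₃ → let M = mat a b c d ; p = cub p₀ p₁ p₂ p₃ in
      Syn.subst (M Syn.∙ Syn.adj M) p , Syn.scale (Syn.cube (Syn.det M)) p) (a ∷ b ∷ c ∷ d ∷ p₀ ∷ p₁ ∷ p₂ ∷ p₃ ∷ []) ≡.refl
    D = det (mat α β γ δ)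
    entry : ∀ u p r → (δ * α + - β * γ) * p + 0# * r ≈ D * p
    entry u p r = solve 6 (λ α β γ δ p r → (δ :* α :+ :- β :* γ) :* p :+ con (+ 0) :* r := Syn.det (mat α β γ δ) :* p) refl α β γ δ p r
    first : ∀ k p r {p′} → p′ ≋ scale k p → comb (δ * α + - β * γ) 0# p′ r ≋ scale (D * k) p
    first k p r e = ≋-trans (comb-cong _ _ e ≋-refl) (≋-trans (entry D _ _ , entry D _ _ , entry D _ _ , entry D _ _) (scale-scale D k p))
    second : ∀ k p r {p′} → p′ ≋ scale k p → comb 0# (δ * α + - β * γ) r p′ ≋ scale (D * k) p
    second k p r e = ≋-trans (+-comm _ _ , +-comm _ _ , +-comm _ _ , +-comm _ _) (first k p r e)

  Orbit-sym : ∀ {R S} → Orbit R S → Orbit S R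
  Orbit-sym {R} {S} (orbit B M k dB dM k≉0 e) =
    -- Applying the adjugates leaves a factor `k` next to `S`; the scalar matrix absorbs it without
    -- an inverse.
    orbit (mat k 0# 0# k ∙ adj B) (adj M) (det B * cube (det M))
      (≉0-resp (sym (trans (det-∙ (mat k 0# 0# k) (adj B)) (*-cong detk (det-adj B)))) ((k≉0 *≉0 k≉0) *≉0 dB))
      (≉0-resp (sym (det-adj M)) dM) (dB *≉0 cube≉0 dM)
      (≋₂-trans (≋₂-sym (act-adj B M R)) (≋₂-trans (≋₂-sym (act-∙ B M (adj B) (adj M) R))
        (≋₂-trans (act-cong (adj B) (adj M) (≋₂-sym e)) (≋₂-trans (act-scale (adj B) (adj M) k S) (scalar (adj B))))))
    where
    detk : det (mat k 0# 0# k) ≈ k * k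
    detk = solve 1 (λ k → Syn.det (mat k (con (+ 0)) (con (+ 0)) k) := k :* k) refl k
    entry₁ : ∀ x y z w p r → k * (x * p + y * r) ≈ (k * x + 0# * z) * p + (k * y + 0# * w) * r
    entry₁ = solve 7 (λ k x y z w p r → k :* (x :* p :+ y :* r) :=
      (k :* x :+ con (+ 0) :* z) :* p :+ (k :* y :+ con (+ 0) :* w) :* r) refl k
    entry₂ : ∀ x y z w p r → k * (x * p + y * r) ≈ (0# * z + k * x) * p + (0# * w + k * y) * r
    entry₂ = solve 7 (λ k x y z w p r → k :* (x :* p :+ y :* r) :=
      (con (+ 0) :* z :+ k :* x) :* p :+ (con (+ 0) :* w :+ k :* y) :* r) refl k
    scalar : ∀ N → scale₂ k (act N (adj M) S) ≋₂ act (mat k 0# 0# k ∙ N) (adj M) S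
    scalar (mat x y z w) =
      (entry₁ x y z w _ _ , entry₁ x y z w _ _ , entry₁ x y z w _ _ , entry₁ x y z w _ _) ,
      (entry₂ z w x y _ _ , entry₂ z w x y _ _ , entry₂ z w x y _ _ , entry₂ z w x y _ _)

  Orbit-reflexive : ∀ {R S} → R ≋₂ S → Orbit R S
  Orbit-reflexive {R} {S} R≋S = orbit I I 1# det-I det-I nontrivial
    (≋₂-trans (scale-cong 1# (≋-sym (proj₁ R≋S)) , scale-cong 1# (≋-sym (proj₂ R≋S))) (identity R))
    where
    I = mat 1# 0# 0# 1#
    det-I : det I ≉ 0#
    det-I e = nontrivial (trans (solve 0 (con (+ 1) := Syn.det (mat (con (+ 1)) (con (+ 0)) (con (+ 0)) (con (+ 1)))) refl) e)
    identity : ∀ R → scale₂ 1# R ≋₂ act I I R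
    identity (cub p₀ p₁ p₂ p₃ , cub r₀ r₁ r₂ r₃) = solveP 8 (λ p₀ p₁ p₂ p₃ r₀ r₁ r₂ r₃ →
      let R = cub p₀ p₁ p₂ p₃ , cub r₀ r₁ r₂ r₃ ; I = mat (con (+ 1)) (con (+ 0)) (con (+ 0)) (con (+ 1)) in
      Syn.scale₂ (con (+ 1)) R , Syn.act I I R) (p₀ ∷ p₁ ∷ p₂ ∷ p₃ ∷ r₀ ∷ r₁ ∷ r₂ ∷ r₃ ∷ []) ≡.refl ≡.refl

  -- A certificate for an equivalence with indeterminate coefficients. `left-det` and `right-det`
  -- are factored forms of the determinants, from which their nonvanishing can be read off.
  record Move (n : ℕ) : Set where
    constructor move
    field
      from to : Pencil (Polynomial n)
      left right : Mat (Polynomial n)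
      factor left-det right-det : Polynomial n

  private module M {n} = Move {n}

  solveOrbit : ∀ n (f : N-ary n (Polynomial n) (Move n)) (ρ : Vec A n) → (let m = f $ⁿ Vec.map var (Vec.allFin n)) →
    let l = Syn.scale₂ (M.factor m) (M.to m) ; r = Syn.act (M.left m) (M.right m) (M.from m) in
    normC ρ (proj₁ l) ≡ normC ρ (proj₁ r) → normC ρ (proj₂ l) ≡ normC ρ (proj₂ r) →
    ⟦ Syn.det (M.left m) ⟧↓ ρ ≡ ⟦ M.left-det m ⟧↓ ρ → ⟦ Syn.det (M.right m) ⟧↓ ρ ≡ ⟦ M.right-det m ⟧↓ ρ →
    ⟦ M.left-det m ⟧ ρ ≉ 0# → ⟦ M.right-det m ⟧ ρ ≉ 0# → ⟦ M.factor m ⟧ ρ ≉ 0# →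
    Orbit (semP ρ (M.from m)) (semP ρ (M.to m))
  solveOrbit n f ρ e₁ e₂ e₃ e₄ dB dM k≉0 =
    orbit (semM (M.left m)) (semM (M.right m)) (⟦ M.factor m ⟧ ρ)
      (≉0-resp (sym (prove ρ (Syn.det (M.left m)) (M.left-det m) (reflexive e₃))) dB)
      (≉0-resp (sym (prove ρ (Syn.det (M.right m)) (M.right-det m) (reflexive e₄))) dM) k≉0
      (proveC ρ (proj₁ l) (proj₁ r) e₁ , proveC ρ (proj₂ l) (proj₂ r) e₂)
    where
    m = f $ⁿ Vec.map var (Vec.allFin n)
    l = Syn.scale₂ (M.factor m) (M.to m)
    r = Syn.act (M.left m) (M.right m) (M.from m)
    semM : Mat (Polynomial n) → Mat A
    semM (mat a b c d) = mat (⟦ a ⟧ ρ) (⟦ b ⟧ ρ) (⟦ c ⟧ ρ) (⟦ d ⟧ ρ)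

-- Common factors of a pencil: decidability and invariance

module Degeneracy {c ℓ : Level} (K : CommutativeRing c ℓ) (q : ℕ)
             (finite : Poly.IsFiniteField K q) (char≥5 : Poly.CharAtLeast5 K) where
  open Field K q finite char≥5
  open import Relation.Binary.Reasoning.Setoid setoid

  zeroC : Cub A
  zeroC = cub 0# 0# 0# 0#

  -- The possible degrees 1, 2, 3 of a common factor. A linear one is a rational zero on the
  -- projective line, a cubic one makes the forms proportional, and an irreducible quadratic one
  -- shows only as a factorisation.
  CommonZero QuadraticFactor Dependent : Pencil A → Set (c ⊔ ℓ)
  CommonZero (g , h) = Σ A λ x → Σ A λ z → (x ≉ 0# ⊎ z ≉ 0#) × (eval g x z ≈ 0#) × (eval h x z ≈ 0#)
  QuadraticFactor R = Σ (A × A × A) λ d → Σ (A × A) λ u → Σ (A × A) λ v → R ≋₂ (mulQL d u , mulQL d v)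
  Dependent (g , h) = Σ A λ β → Σ A λ γ → (β ≉ 0# ⊎ γ ≉ 0#) × comb β γ g h ≋ zeroC

  Degenerate : Pencil A → Set (c ⊔ ℓ)
  Degenerate R = CommonZero R ⊎ QuadraticFactor R ⊎ Dependent R

  _≋?_ : ∀ p r → Dec (p ≋ r)
  p ≋? r = (c₀ p ≟ c₀ r) ×-dec (c₁ p ≟ c₁ r) ×-dec (c₂ p ≟ c₂ r) ×-dec (c₃ p ≟ c₃ r)

  nonzero? : ∀ x z → Dec (x ≉ 0# ⊎ z ≉ 0#)
  nonzero? x z = ¬? (x ≟ 0#) ⊎-dec ¬? (z ≟ 0#)

  nonzero-resp : ∀ {x x′ z z′} → x ≈ x′ → z ≈ z′ → x ≉ 0# ⊎ z ≉ 0# → x′ ≉ 0# ⊎ z′ ≉ 0#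
  nonzero-resp e e′ (inj₁ n) = inj₁ (≉0-resp e n)
  nonzero-resp e e′ (inj₂ n) = inj₂ (≉0-resp e′ n)

  eval-cong : ∀ {p r x x′ z z′} → p ≋ r → x ≈ x′ → z ≈ z′ → eval p x z ≈ eval r x′ z′
  eval-cong (e₀ , e₁ , e₂ , e₃) x z =
    +-cong (+-cong (+-cong (*-cong e₀ (cube-cong z)) (*-cong e₁ (*-cong x (*-cong z z))))
      (*-cong e₂ (*-cong x (*-cong x z)))) (*-cong e₃ (cube-cong x))
    where
    cube-cong : ∀ {y y′} → y ≈ y′ → cube y ≈ cube y′
    cube-cong y = *-cong y (*-cong y y)

  any₂? : ∀ {p} {P : A → A → Set p} → (∀ x z → Dec (P x z)) →
          (∀ {x x′ z z′} → x ≈ x′ → z ≈ z′ → P x z → P x′ z′) → Dec (Σ A λ x → Σ A (P x))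
  any₂? P? resp = any? (λ x → any? (P? x) (resp refl)) (λ e (z , p) → z , resp e refl p)

  commonZero? : ∀ R → Dec (CommonZero R)
  commonZero? (g , h) = any₂? (λ x z → nonzero? x z ×-dec (eval g x z ≟ 0#) ×-dec (eval h x z ≟ 0#))
    (λ x z (n , p , r) → nonzero-resp x z n , trans (sym (eval-cong {g} ≋-refl x z)) p , trans (sym (eval-cong {h} ≋-refl x z)) r)

  dependent? : ∀ R → Dec (Dependent R)
  dependent? (g , h) = any₂? (λ β γ → nonzero? β γ ×-dec (comb β γ g h ≋? zeroC))
    (λ β γ (n , p) → nonzero-resp β γ n , ≋-trans (≋-sym (comb-congˡ g h β γ)) p)

  mulQL-cong : ∀ {p₀ p₀′ p₁ p₁′ p₂ p₂′ r₀ r₀′ r₁ r₁′} → p₀ ≈ p₀′ → p₁ ≈ p₁′ → p₂ ≈ p₂′ → r₀ ≈ r₀′ → r₁ ≈ r₁′ →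
               mulQL (p₀ , p₁ , p₂) (r₀ , r₁) ≋ mulQL (p₀′ , p₁′ , p₂′) (r₀′ , r₁′)
  mulQL-cong a b c d e = *-cong a d , +-cong (*-cong a e) (*-cong b d) , +-cong (*-cong b e) (*-cong c d) , *-cong c e

  quadraticFactor? : ∀ R → Dec (QuadraticFactor R)
  quadraticFactor? R@(g , h) = map′
    (λ (i₀ , i₁ , i₂ , j₀ , j₁ , k₀ , k₁ , e) →
      (enum i₀ , enum i₁ , enum i₂) , (enum j₀ , enum j₁) , (enum k₀ , enum k₁) , e)
    (λ ((d₀ , d₁ , d₂) , (u₀ , u₁) , (v₀ , v₁) , e , e′) →
      index d₀ , index d₁ , index d₂ , index u₀ , index u₁ , index v₀ , index v₁ ,
      ≋-trans e (mulQL-cong (i d₀) (i d₁) (i d₂) (i u₀) (i u₁)) , ≋-trans e′ (mulQL-cong (i d₀) (i d₁) (i d₂) (i v₀) (i v₁)))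
    (FinP.any? λ i₀ → FinP.any? λ i₁ → FinP.any? λ i₂ → FinP.any? λ j₀ → FinP.any? λ j₁ →
     FinP.any? λ k₀ → FinP.any? λ k₁ →
       (g ≋? mulQL (enum i₀ , enum i₁ , enum i₂) (enum j₀ , enum j₁)) ×-dec
       (h ≋? mulQL (enum i₀ , enum i₁ , enum i₂) (enum k₀ , enum k₁)))
    where
    i : ∀ x → x ≈ enum (index x)
    i x = sym (enum-index x)

  degenerate? : ∀ R → Dec (Degenerate R)
  degenerate? R = commonZero? R ⊎-dec quadraticFactor? R ⊎-dec dependent? R

  mat-injective : ∀ M x z → det M ≉ 0# → x ≉ 0# ⊎ z ≉ 0# →
    let mat a b c d = M in a * x + b * z ≉ 0# ⊎ c * x + d * z ≉ 0#
  mat-injective (mat a b c d) x z dM n with (a * x + b * z) ≟ 0# | (c * x + d * z) ≟ 0#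
  ... | no ne | _ = inj₁ ne
  ... | yes _ | no ne = inj₂ ne
  ... | yes e | yes e′ = contradiction n [ (λ n → n (*-cancel-0 dM X)) , (λ n → n (*-cancel-0 dM Z)) ]′
    where
    X : det (mat a b c d) * x ≈ 0#
    X = drop d e (drop (- b) e′ (solve 6 (λ a b c d x z → Syn.det (mat a b c d) :* x :=
          (con (+ 0) :+ d :* (a :* x :+ b :* z)) :+ :- b :* (c :* x :+ d :* z)) refl a b c d x z))
    Z : det (mat a b c d) * z ≈ 0#
    Z = drop a e′ (drop (- c) e (solve 6 (λ a b c d x z → Syn.det (mat a b c d) :* z :=
          (con (+ 0) :+ a :* (c :* x :+ d :* z)) :+ :- c :* (a :* x :+ b :* z)) refl a b c d x z))

  scale-cancel : ∀ {k p} → k ≉ 0# → scale k p ≋ zeroC → p ≋ zeroC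
  scale-cancel n (a , b , c , d) = *-cancel-0 n a , *-cancel-0 n b , *-cancel-0 n c , *-cancel-0 n d

  unscale : ∀ {k} → k ≉ 0# → Σ A λ k⁻¹ → ∀ {p r} → scale k p ≋ r → p ≋ scale k⁻¹ r
  unscale {k} n = let k⁻¹ , inv = inverse k n in k⁻¹ , λ {p} e →
    ≋-trans (≋-trans (sym (*-identityˡ _) , sym (*-identityˡ _) , sym (*-identityˡ _) , sym (*-identityˡ _))
      (scale-congˡ p (sym (trans (*-comm _ _) inv)))) (≋-trans (≋-sym (scale-scale k⁻¹ k p)) (scale-cong k⁻¹ e))

  scale-zero : ∀ k → scale k zeroC ≋ zeroC
  scale-zero k = zeroʳ k , zeroʳ k , zeroʳ k , zeroʳ k

  degenerate-orbit : ∀ {R S} → Orbit R S → Degenerate R → Degenerate S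
  degenerate-orbit {g , h} {s , t} (orbit (mat α β γ δ) M@(mat a b c d) k dB dM k≉0 (e , e′)) (inj₁ (x , z , n , gx , hx)) =
    -- The zero is carried along by `adj M`, because `M ∙ adj M` is scalar.
    inj₁ (d * x + - b * z , - c * x + a * z , mat-injective (adj M) x z (≉0-resp (sym (det-adj M)) dM) n ,
      line α β s e , line γ δ t e′)
    where
    pt : ∀ p → eval p x z ≈ 0# → eval (subst M p) (d * x + - b * z) (- c * x + a * z) ≈ 0#
    pt (cub p₀ p₁ p₂ p₃) v = drop (cube (det M)) v (solve 10 (λ a b c d x z p₀ p₁ p₂ p₃ →
      let M = mat a b c d ; p = cub p₀ p₁ p₂ p₃ in
      Syn.eval (Syn.subst M p) (d :* x :+ :- b :* z) (:- c :* x :+ a :* z) :=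
      con (+ 0) :+ Syn.cube (Syn.det M) :* Syn.eval p x z) refl a b c d x z p₀ p₁ p₂ p₃)
    eval-comb : ∀ α β p r x z → eval (comb α β p r) x z ≈ α * eval p x z + β * eval r x z
    eval-comb α β (cub p₀ p₁ p₂ p₃) (cub r₀ r₁ r₂ r₃) x z = solve 12 (λ α β p₀ p₁ p₂ p₃ r₀ r₁ r₂ r₃ x z →
      let p = cub p₀ p₁ p₂ p₃ ; r = cub r₀ r₁ r₂ r₃ in
      Syn.eval (Syn.comb α β p r) x z := α :* Syn.eval p x z :+ β :* Syn.eval r x z) refl α β p₀ p₁ p₂ p₃ r₀ r₁ r₂ r₃ x z
    eval-scale : ∀ k p x z → k * eval p x z ≈ eval (scale k p) x z
    eval-scale k (cub p₀ p₁ p₂ p₃) x z = solve 7 (λ k p₀ p₁ p₂ p₃ x z → let p = cub p₀ p₁ p₂ p₃ in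
      k :* Syn.eval p x z := Syn.eval (Syn.scale k p) x z) refl k p₀ p₁ p₂ p₃ x z
    line : ∀ α β s → scale k s ≋ comb α β (subst M g) (subst M h) → eval s (d * x + - b * z) (- c * x + a * z) ≈ 0#
    line α β s e = *-cancel-0 k≉0 (trans (eval-scale k s _ _) (trans (eval-cong e refl refl)
      (trans (eval-comb α β _ _ _ _) (trans (+-cong (trans (*-congˡ (pt g gx)) (zeroʳ α)) (trans (*-congˡ (pt h hx)) (zeroʳ β)))
        (+-identityʳ 0#)))))
  degenerate-orbit {g , h} {s , t} (orbit (mat α β γ δ) M k dB dM k≉0 (e , e′)) (inj₂ (inj₁ (d , u , v , eu , ev))) =
    let k⁻¹ , un = unscale k≉0 in
    -- The cofactors undergo the same recombination as the cubics. The outer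
    -- `combL k⁻¹ 0# _ (0# , 0#)` merely multiplies a linear form by `k⁻¹`.
    inj₂ (inj₁ (substQ M d , combL k⁻¹ 0# (combL α β (substL M u) (substL M v)) (0# , 0#) ,
      combL k⁻¹ 0# (combL γ δ (substL M u) (substL M v)) (0# , 0#) ,
      ≋-trans (un (≋-trans e (comb-cong α β (subst-cong M eu) (subst-cong M ev)))) (line k⁻¹ α β M d u v) ,
      ≋-trans (un (≋-trans e′ (comb-cong γ δ (subst-cong M eu) (subst-cong M ev)))) (line k⁻¹ γ δ M d u v)))
    where
    substQL : ∀ M d u → subst M (mulQL d u) ≋ mulQL (substQ M d) (substL M u)
    substQL (mat a b c d) (d₀ , d₁ , d₂) (u₀ , u₁) = solveC 9 (λ a b c d d₀ d₁ d₂ u₀ u₁ →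
      let M = mat a b c d ; D = d₀ , d₁ , d₂ ; u = u₀ , u₁ in
      Syn.subst M (Syn.mulQL D u) , Syn.mulQL (Syn.substQ M D) (Syn.substL M u))
      (a ∷ b ∷ c ∷ d ∷ d₀ ∷ d₁ ∷ d₂ ∷ u₀ ∷ u₁ ∷ []) ≡.refl
    mulQL-comb : ∀ i α β d u v → scale i (comb α β (mulQL d u) (mulQL d v)) ≋ mulQL d (combL i 0# (combL α β u v) (0# , 0#))
    mulQL-comb i α β (d₀ , d₁ , d₂) (u₀ , u₁) (v₀ , v₁) = solveC 10 (λ i α β d₀ d₁ d₂ u₀ u₁ v₀ v₁ →
      let D = d₀ , d₁ , d₂ ; u = u₀ , u₁ ; v = v₀ , v₁ in
      Syn.scale i (Syn.comb α β (Syn.mulQL D u) (Syn.mulQL D v)) ,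
      Syn.mulQL D (Syn.combL i (con (+ 0)) (Syn.combL α β u v) (con (+ 0) , con (+ 0))))
      (i ∷ α ∷ β ∷ d₀ ∷ d₁ ∷ d₂ ∷ u₀ ∷ u₁ ∷ v₀ ∷ v₁ ∷ []) ≡.refl
    line : ∀ i α β M d u v → scale i (comb α β (subst M (mulQL d u)) (subst M (mulQL d v))) ≋
      mulQL (substQ M d) (combL i 0# (combL α β (substL M u) (substL M v)) (0# , 0#))
    line i α β M d u v = ≋-trans (scale-cong i (comb-cong α β (substQL M d u) (substQL M d v))) (mulQL-comb i α β _ _ _)
  degenerate-orbit {g , h} {s , t} (orbit (mat α β γ δ) M k dB dM k≉0 (e , e′)) (inj₂ (inj₂ (x , y , n , v))) =
    -- A relation is a row vector and transforms by the inverse of B on the right, here up to the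
    -- determinant; hence the transposed adjugate.
    inj₂ (inj₂ (δ * x + - γ * y , - β * x + α * y ,
      mat-injective (mat δ (- γ) (- β) α) x y (≉0-resp detT dB) n , scale-cancel k≉0
      (≋-trans (≋-sym (comb-scale _ _ k s t)) (≋-trans (comb-cong _ _ e e′) (≋-trans (rearrange α β γ δ x y (subst M g) (subst M h))
        (≋-trans (scale-cong _ (≋-trans (≋-sym (subst-comb M x y g h)) (≋-trans (subst-cong M v) (vanish M)))) (scale-zero _)))))))
    where
    detT : det (mat α β γ δ) ≈ det (mat δ (- γ) (- β) α)
    detT = solve 4 (λ α β γ δ → Syn.det (mat α β γ δ) := Syn.det (mat δ (:- γ) (:- β) α)) refl α β γ δ
    rearrange : ∀ α β γ δ x y p r → comb (δ * x + - γ * y) (- β * x + α * y) (comb α β p r) (comb γ δ p r) ≋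
      scale (det (mat α β γ δ)) (comb x y p r)
    rearrange α β γ δ x y (cub p₀ p₁ p₂ p₃) (cub r₀ r₁ r₂ r₃) = f p₀ r₀ , f p₁ r₁ , f p₂ r₂ , f p₃ r₃
      where
      f : ∀ p r → (δ * x + - γ * y) * (α * p + β * r) + (- β * x + α * y) * (γ * p + δ * r) ≈
        (α * δ + - (β * γ)) * (x * p + y * r)
      f = solve 8 (λ α β γ δ x y p r → (δ :* x :+ :- γ :* y) :* (α :* p :+ β :* r) :+ (:- β :* x :+ α :* y) :* (γ :* p :+ δ :* r) :=
        (α :* δ :+ :- (β :* γ)) :* (x :* p :+ y :* r)) refl α β γ δ x y
    vanish : ∀ M → subst M zeroC ≋ zeroC
    vanish (mat a b c d) = solveC 4 (λ a b c d → let o = con (+ 0) in Syn.subst (mat a b c d) (cub o o o o) , cub o o o o)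
      (a ∷ b ∷ c ∷ d ∷ []) ≡.refl

-- Cubic rational expressions and nondegenerate pencils

module Cubics {c ℓ : Level} (K : CommutativeRing c ℓ) (q : ℕ)
             (finite : Poly.IsFiniteField K q) (char≥5 : Poly.CharAtLeast5 K) where
  open Field K q finite char≥5
  open Degeneracy K q finite char≥5
  open Poly K hiding (num)
  open import Relation.Binary.Reasoning.Setoid setoid

  -- The product on coefficient sequences, where trailing zeros of the lists leave no trace.
  conv : (ℕ → A) → (ℕ → A) → ℕ → A
  conv p r zero    = p 0 * r 0
  conv p r (suc n) = p 0 * r (suc n) + conv (p ∘ suc) r n

  Vanishes> : ℕ → (ℕ → A) → Set ℓ
  Vanishes> k p = ∀ i → k ℕ.< i → p i ≈ 0#

  drop-+ʳ : ∀ {x y z} → x ≈ y → z ≈ 0# → x + z ≈ y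
  drop-+ʳ e z≈0 = trans (+-cong e z≈0) (+-identityʳ _)

  drop-+ˡ : ∀ {x y z} → z ≈ 0# → x ≈ y → z + x ≈ y
  drop-+ˡ z≈0 e = trans (+-cong z≈0 e) (+-identityˡ _)

  kill-*ˡ : ∀ {x} y → x ≈ 0# → x * y ≈ 0#
  kill-*ˡ y e = trans (*-congʳ e) (zeroˡ y)

  kill-*ʳ : ∀ x {y} → y ≈ 0# → x * y ≈ 0#
  kill-*ʳ x e = trans (*-congˡ e) (zeroʳ x)

  conv-zeroˡ : ∀ {p} r n → (∀ i → p i ≈ 0#) → conv p r n ≈ 0#
  conv-zeroˡ r zero    z = kill-*ˡ _ (z 0)
  conv-zeroˡ r (suc n) z = drop-+ʳ (kill-*ˡ _ (z 0)) (conv-zeroˡ r n (z ∘ suc))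

  conv-cong : ∀ {p p′ r r′} → (∀ i → p i ≈ p′ i) → (∀ i → r i ≈ r′ i) → ∀ n → conv p r n ≈ conv p′ r′ n
  conv-cong e e′ zero    = *-cong (e 0) (e′ 0)
  conv-cong e e′ (suc n) = +-cong (*-cong (e 0) (e′ (suc n))) (conv-cong (e ∘ suc) e′ n)

  conv-assoc : ∀ k p r n → conv (λ i → k * p i) r n ≈ conv p (λ i → k * r i) n
  conv-assoc k p r zero    = solve 3 (λ k p r → (k :* p) :* r := p :* (k :* r)) refl k (p 0) (r 0)
  conv-assoc k p r (suc n) = +-cong (solve 3 (λ k p r → (k :* p) :* r := p :* (k :* r)) refl k (p 0) (r (suc n)))
                                    (conv-assoc k (p ∘ suc) r n)

  conv-const : ∀ p r n → Vanishes> 0 r → conv p r n ≈ p n * r 0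
  conv-const p r zero    z = refl
  conv-const p r (suc n) z = drop-+ˡ (kill-*ʳ _ (z (suc n) (s≤s z≤n))) (conv-const (p ∘ suc) r n z)

  conv-lead : ∀ k j {p r} → Vanishes> k p → Vanishes> j r → conv p r (k ℕ.+ j) ≈ p k * r j
  conv-lead zero    zero    z z′ = refl
  conv-lead zero    (suc j) {r = r} z z′ = drop-+ʳ refl (conv-zeroˡ r j (λ i → z (suc i) (s≤s z≤n)))
  conv-lead (suc k) j       z z′ =
    drop-+ˡ (kill-*ʳ _ (z′ _ (s≤s (ℕP.m≤n+m j k)))) (conv-lead k j (λ i lt → z (suc i) (s≤s lt)) z′)

  conv-vanishes : ∀ k j {p r} → Vanishes> k p → Vanishes> j r → Vanishes> (k ℕ.+ j) (conv p r)
  conv-vanishes zero    j {r = r} z z′ (suc n) lt = drop-+ʳ (kill-*ʳ _ (z′ (suc n) lt)) (conv-zeroˡ r n (λ i → z (suc i) (s≤s z≤n)))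
  conv-vanishes (suc k) j z z′ (suc n) (s≤s lt) =
    drop-+ʳ (kill-*ʳ _ (z′ (suc n) (s≤s (ℕP.≤-trans (ℕP.m≤n+m j k) (ℕP.<⇒≤ lt)))))
            (conv-vanishes k j (λ i l → z (suc i) (s≤s l)) z′ n lt)

  coeff-+ : ∀ p r i → coeff (p +ₚ r) i ≈ coeff p i + coeff r i
  coeff-+ []      r       i       = sym (+-identityˡ _)
  coeff-+ (a ∷ p) []      i       = sym (+-identityʳ _)
  coeff-+ (a ∷ p) (b ∷ r) zero    = refl
  coeff-+ (a ∷ p) (b ∷ r) (suc i) = coeff-+ p r i

  coeff-· : ∀ k p i → coeff (k ·ₚ p) i ≈ k * coeff p i
  coeff-· k []      i       = sym (zeroʳ k)
  coeff-· k (a ∷ p) zero    = refl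
  coeff-· k (a ∷ p) (suc i) = coeff-· k p i

  coeff-* : ∀ p r i → coeff (p *ₚ r) i ≈ conv (coeff p) (coeff r) i
  coeff-* []      r i       = sym (conv-zeroˡ (coeff r) i (λ _ → refl))
  coeff-* (a ∷ p) r zero    = trans (coeff-+ (a ·ₚ r) _ 0) (drop-+ʳ (coeff-· a r 0) refl)
  coeff-* (a ∷ p) r (suc i) = trans (coeff-+ (a ·ₚ r) _ (suc i)) (+-cong (coeff-· a r (suc i)) (coeff-* p r i))

  degree? : ∀ p → (∀ i → coeff p i ≈ 0#) ⊎ Σ ℕ λ k → coeff p k ≉ 0# × DegLe p k
  degree? [] = inj₁ (λ _ → refl)
  degree? (a ∷ p) with degree? p
  ... | inj₂ (k , n , z) = inj₂ (suc k , n , λ { (suc i) (s≤s lt) → z i lt })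
  ... | inj₁ z with a ≟ 0#
  ...   | yes e = inj₁ λ { zero → e ; (suc i) → z i }
  ...   | no  n = inj₂ (0 , n , λ { (suc i) _ → z i })

  cubic : Pol → Cub A
  cubic p = cub (coeff p 0) (coeff p 1) (coeff p 2) (coeff p 3)

  pencil : RatExpr → Pencil A
  pencil (g , h) = cubic g , cubic h

  pol : Cub A → Pol
  pol p = c₀ p ∷ c₁ p ∷ c₂ p ∷ c₃ p ∷ []

  ratExpr : Pencil A → RatExpr
  ratExpr (g , h) = pol g , pol h

  by-degree : ∀ {a} {P : ℕ → Set a} → P 0 → P 1 → P 2 → P 3 → (∀ i → 3 ℕ.< i → P i) → ∀ i → P i
  by-degree a b c d f 0 = a
  by-degree a b c d f 1 = b
  by-degree a b c d f 2 = c
  by-degree a b c d f 3 = d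
  by-degree a b c d f i@(suc (suc (suc (suc _)))) = f i (s≤s (s≤s (s≤s (s≤s z≤n))))

  pol-degree : ∀ p → DegLe (pol p) 3
  pol-degree p (suc (suc (suc (suc i)))) lt = refl
  pol-degree p 0 ()
  pol-degree p 1 (s≤s ())
  pol-degree p 2 (s≤s (s≤s ()))
  pol-degree p 3 (s≤s (s≤s (s≤s ())))

  zero-at-∞ : ∀ p → eval p 1# 0# ≈ c₃ p
  zero-at-∞ (cub p₀ p₁ p₂ p₃) = solve 4 (λ p₀ p₁ p₂ p₃ → Syn.eval (cub p₀ p₁ p₂ p₃) (con (+ 1)) (con (+ 0)) := p₃) refl p₀ p₁ p₂ p₃

  commonZero-∞ : ∀ {R} → c₃ (proj₁ R) ≈ 0# → c₃ (proj₂ R) ≈ 0# → CommonZero R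
  commonZero-∞ {g , h} e e′ = 1# , 0# , inj₁ nontrivial , trans (zero-at-∞ g) e , trans (zero-at-∞ h) e′

  cubic⇒nondegenerate : ∀ R → Cubic R → ¬ Degenerate (pencil R)
  cubic⇒nondegenerate (g , h) (coprime , h≉0 , dg , dh , top) = λ
    { (inj₁ (x , z , n , gx , hx)) → commonZero x z n gx hx
    ; (inj₂ (inj₁ (d , u , v , e , e′))) → quadratic d u v e e′
    ; (inj₂ (inj₂ (β , γ , n , e))) → dependent β γ n e }
    where
    top-contradiction : ¬ (coeff g 3 ≈ 0# × coeff h 3 ≈ 0#)
    top-contradiction (e , e′) = [ (λ n → n e) , (λ n → n e′) ]′ top
    quadratic : ∀ d u v → cubic g ≋ mulQL d u → ¬ (cubic h ≋ mulQL d v)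
    quadratic (d₀ , d₁ , d₂) u v eg eh = top-contradiction (vanishing (proj₂ (proj₂ (proj₂ eg))) , vanishing (proj₂ (proj₂ (proj₂ eh))))
      where
      d = d₀ ∷ d₁ ∷ d₂ ∷ []
      factor : ∀ p u → DegLe p 3 → cubic p ≋ mulQL (d₀ , d₁ , d₂) u → (d *ₚ (proj₁ u ∷ proj₂ u ∷ [])) ≈ₚ p
      factor p (u₀ , u₁) dp (e₀ , e₁ , e₂ , e₃) i = trans (coeff-* d (u₀ ∷ u₁ ∷ []) i) (by-degree
        {P = λ i → conv (coeff d) (coeff (u₀ ∷ u₁ ∷ [])) i ≈ coeff p i}
        (sym e₀) (sym e₁) (trans (drop-+ˡ (zeroʳ d₀) refl) (sym e₂))
        (trans (drop-+ˡ (zeroʳ d₀) (drop-+ˡ (zeroʳ d₁) (drop-+ʳ refl (zeroˡ u₀)))) (sym e₃))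
        (λ i lt → trans (conv-vanishes 2 1 (λ { (suc (suc (suc _))) _ → refl ; 1 (s≤s ()) ; 2 (s≤s (s≤s ())) })
                           (λ { (suc (suc _)) _ → refl ; 1 (s≤s ()) }) i lt) (sym (dp i lt))) i)
      -- Coprimality makes `d` constant; both coefficients of x³ are multiples of `d₂` and would
      -- vanish.
      d₂≈0 : d₂ ≈ 0#
      d₂≈0 = coprime d (proj₁ u ∷ proj₂ u ∷ []) (proj₁ v ∷ proj₂ v ∷ []) (factor g u dg eg) (factor h v dh eh) 2 (s≤s z≤n)
      vanishing : ∀ {x y} → x ≈ d₂ * y → x ≈ 0#
      vanishing e = trans e (kill-*ˡ _ d₂≈0)
    dependent : ∀ β γ → β ≉ 0# ⊎ γ ≉ 0# → ¬ (comb β γ (cubic g) (cubic h) ≋ zeroC)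
    dependent β γ n (e₀ , e₁ , e₂ , e₃) = [ case₁ , case₂ ]′ n
      where
      comb-all : ∀ i → β * coeff g i + γ * coeff h i ≈ 0#
      comb-all = by-degree e₀ e₁ e₂ e₃ (λ i lt → drop-+ˡ (kill-*ʳ β (dg i lt)) (kill-*ʳ γ (dh i lt)))
      vanish₀ : ∀ x → Vanishes> 0 (coeff (x ∷ []))
      vanish₀ x (suc _) _ = refl
      multiple : ∀ {x y} g h → x ≉ 0# → (∀ i → x * coeff g i + y * coeff h i ≈ 0#) →
                 Σ A λ t → (h *ₚ (- t ∷ [])) ≈ₚ g
      multiple {x} {y} g h n e with divide y n
      ... | t , y≈xt = t , λ i → trans (coeff-* h (- t ∷ []) i) (trans (conv-const (coeff h) _ i (vanish₀ _)) (rel i))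
        where
        rel : ∀ i → coeff h i * - t ≈ coeff g i
        rel i = begin
          coeff h i * - t                                          ≈⟨ solve 3 (λ g h t → h :* :- t := g :+ :- (g :+ t :* h)) refl (coeff g i) (coeff h i) t ⟩
          coeff g i + - (coeff g i + t * coeff h i)  ≈⟨ +-congˡ (trans (-‿cong (*-cancel-0 n (trans
             (solve 4 (λ x g h t → x :* (g :+ t :* h) := x :* g :+ (x :* t) :* h) refl x (coeff g i) (coeff h i) t)
             (trans (+-congˡ (*-congʳ (sym y≈xt))) (e i))))) -0#≈0#) ⟩
          coeff g i + 0#                                           ≈⟨ +-identityʳ _ ⟩
          coeff g i                                                ∎
      self : ∀ p → (p *ₚ (1# ∷ [])) ≈ₚ p
      self p i = trans (coeff-* p (1# ∷ []) i) (trans (conv-const (coeff p) _ i (vanish₀ _)) (*-identityʳ _))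
      -- If β is invertible then h divides g and itself, so it is constant by coprimality, and g,
      -- being a multiple of it, has no cubic term either.
      case₁ : ¬ (β ≉ 0#)
      case₁ n = let t , e = multiple g h n comb-all
                    h₃ = coprime h (- t ∷ []) (1# ∷ []) e (self h) 3 (s≤s z≤n)
                in top-contradiction (trans (sym (e 3)) (trans (coeff-* h (- t ∷ []) 3) (trans (conv-const (coeff h) _ 3 (vanish₀ _)) (kill-*ˡ _ h₃))) , h₃)
      case₂ : ¬ (γ ≉ 0#)
      case₂ n = let t , e = multiple h g n (λ i → trans (+-comm _ _) (comb-all i))
                    g₃ = coprime g (1# ∷ []) (- t ∷ []) (self g) e 3 (s≤s z≤n)
                in top-contradiction (g₃ , trans (sym (e 3)) (trans (coeff-* g (- t ∷ []) 3) (trans (conv-const (coeff g) _ 3 (vanish₀ _)) (kill-*ˡ _ g₃))))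
    commonZero : ∀ x z → x ≉ 0# ⊎ z ≉ 0# → eval (cubic g) x z ≈ 0# → ¬ (eval (cubic h) x z ≈ 0#)
    commonZero x z n gx hx with z ≟ 0#
    ... | yes z≈0 = top-contradiction (at-∞ g gx , at-∞ h hx)
      where
      x≉0 : x ≉ 0#
      x≉0 = [ (λ n → n) , (λ n → contradiction z≈0 n) ]′ n
      at-∞ : ∀ p → eval (cubic p) x z ≈ 0# → coeff p 3 ≈ 0#
      at-∞ p e = *-cancel-0 (cube≉0 x≉0) (trans (solve 5 (λ x p₀ p₁ p₂ p₃ → Syn.cube x :* p₃ :=
        Syn.eval (cub p₀ p₁ p₂ p₃) x (con (+ 0))) refl x (coeff p 0) (coeff p 1) (coeff p 2) (coeff p 3))
        (trans (eval-cong {cubic p} ≋-refl refl (sym z≈0)) e))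
    ... | no z≉0 with divide x z≉0
    ...   | r , x≈zr = nontrivial (coprime d (quot g) (quot h) (factor g dg gx) (factor h dh hx) 1 (s≤s z≤n))
      where
      d = - r ∷ 1# ∷ []
      quot : Pol → Pol
      -- Division by x - r with Horner's scheme; the remainder is the value at r.
      quot p = (coeff p 1 + r * (coeff p 2 + r * coeff p 3)) ∷ (coeff p 2 + r * coeff p 3) ∷ coeff p 3 ∷ []
      root : ∀ p → eval (cubic p) x z ≈ 0# → coeff p 0 + r * (coeff p 1 + r * (coeff p 2 + r * coeff p 3)) ≈ 0#
      root p e = *-cancel-0 (cube≉0 z≉0) (trans (solve 6 (λ z r p₀ p₁ p₂ p₃ →
        Syn.cube z :* (p₀ :+ r :* (p₁ :+ r :* (p₂ :+ r :* p₃))) := Syn.eval (cub p₀ p₁ p₂ p₃) (z :* r) z) refl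
        z r (coeff p 0) (coeff p 1) (coeff p 2) (coeff p 3)) (trans (eval-cong {cubic p} ≋-refl (sym x≈zr) refl) e))
      factor : ∀ p → DegLe p 3 → eval (cubic p) x z ≈ 0# → (d *ₚ quot p) ≈ₚ p
      factor p dp e i = trans (coeff-* d (quot p) i) (by-degree
        {P = λ i → conv (coeff d) (coeff (quot p)) i ≈ coeff p i}
        (trans (solve 2 (λ r y → :- r :* y := :- (r :* y)) refl r _) (sym (neg-unique (root p e))))
        (solve 3 (λ r p₁ y → :- r :* y :+ con (+ 1) :* (p₁ :+ r :* y) := p₁) refl r (coeff p 1) _)
        (trans (+-congˡ (drop-+ʳ refl (zeroˡ _)))
          (solve 3 (λ r p₂ y → :- r :* y :+ con (+ 1) :* (p₂ :+ r :* y) := p₂) refl r (coeff p 2) _))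
        (drop-+ˡ (zeroʳ (- r)) (drop-+ʳ (*-identityˡ _) (drop-+ʳ (zeroˡ _) (zeroˡ _))))
        (λ i lt → trans (conv-vanishes 1 2 (λ { (suc (suc _)) _ → refl ; 1 (s≤s ()) })
           (λ { (suc (suc (suc _))) _ → refl ; 1 (s≤s ()) ; 2 (s≤s (s≤s ())) }) i lt) (sym (dp i lt))) i)
        where
        neg-unique : ∀ {x y} → x + y ≈ 0# → x ≈ - y
        neg-unique {x} {y} e = drop 1# e (solve 2 (λ x y → x := :- y :+ con (+ 1) :* (x :+ y)) refl x y)

  conv-eq : ∀ d w {p} → (d *ₚ w) ≈ₚ pol p → ∀ i → conv (coeff d) (coeff w) i ≈ coeff (pol p) i
  conv-eq d w e i = trans (sym (coeff-* d w i)) (e i)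

  -- Leading coefficients multiply to a nonzero coefficient over a field, so a divisor of degree k
  -- leaves a cofactor of degree at most 3 - k.
  bound : ∀ k d w {p} → coeff d k ≉ 0# → DegLe d k → (d *ₚ w) ≈ₚ pol p → ∀ i → 3 ℕ.< k ℕ.+ i → coeff w i ≈ 0#
  bound k d w {p} lead dz e i lt with degree? w
  ... | inj₁ z = z i
  ... | inj₂ (j , n , z) with i ℕ.≤? j
  ...   | no i≰j = z i (ℕP.≰⇒> i≰j)
  ...   | yes i≤j = contradiction (trans (sym (conv-lead k j dz z)) (trans (conv-eq d w e (k ℕ.+ j))
            (pol-degree p _ (ℕP.≤-trans lt (ℕP.+-monoʳ-≤ k i≤j))))) (lead *≉0 n)

  -- A common divisor of exact degree 1, 2 or at least 3 produces respectively a common zero, a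
  -- quadratic factor or a linear relation. In the last case both cofactors are constants.
  nondegenerate⇒cubic : ∀ R → ¬ Degenerate R → Cubic (ratExpr R)
  nondegenerate⇒cubic R@(g , h) nd =
    coprime , (λ h≈0 → nd (inj₂ (inj₂ (0# , 1# , inj₂ nontrivial ,
      null (h≈0 0) , null (h≈0 1) , null (h≈0 2) , null (h≈0 3))))) ,
    pol-degree g , pol-degree h , top
    where
    null : ∀ {x y} → y ≈ 0# → 0# * x + 1# * y ≈ 0#
    null e = drop-+ˡ (zeroˡ _) (kill-*ʳ 1# e)
    top : c₃ g ≉ 0# ⊎ c₃ h ≉ 0#
    top with c₃ g ≟ 0# | c₃ h ≟ 0#
    ... | no n  | _     = inj₁ n
    ... | yes _ | no n  = inj₂ n
    ... | yes e | yes e′ = contradiction (inj₁ (commonZero-∞ {R} e e′)) nd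
    coprime : Coprime (pol g) (pol h)
    coprime d u v eu ev with degree? d
    ... | inj₁ z = λ i _ → z i
    ... | inj₂ (0 , _ , z) = z
    ... | inj₂ (1 , lead , z) = contradiction (inj₁ linear) nd
      where
      w₃ : ∀ w {p} → (d *ₚ w) ≈ₚ pol p → coeff w 3 ≈ 0#
      w₃ w e = bound 1 d w lead z e 3 ℕP.≤-refl
      values : ∀ w {p} → (d *ₚ w) ≈ₚ pol p → p ≋ cub (coeff d 0 * coeff w 0) (coeff d 0 * coeff w 1 + coeff d 1 * coeff w 0)
        (coeff d 0 * coeff w 2 + coeff d 1 * coeff w 1) (coeff d 1 * coeff w 2)
      values w e = sym (conv-eq d w e 0) , sym (conv-eq d w e 1) ,
        trans (sym (conv-eq d w e 2)) (+-congˡ (drop-+ʳ refl (kill-*ˡ _ (z 2 ℕP.≤-refl)))) ,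
        trans (sym (conv-eq d w e 3)) (drop-+ˡ (kill-*ʳ _ (w₃ w e)) (drop-+ʳ refl
          (drop-+ˡ (kill-*ˡ _ (z 2 ℕP.≤-refl)) (kill-*ˡ _ (z 3 (s≤s (s≤s z≤n)))))))
      root : ∀ w {p} → (d *ₚ w) ≈ₚ pol p → eval p (- coeff d 0) (coeff d 1) ≈ 0#
      root w {p} e = trans (eval-cong (values w e) refl refl) (solve 5 (λ d₀ d₁ w₀ w₁ w₂ →
        Syn.eval (cub (d₀ :* w₀) (d₀ :* w₁ :+ d₁ :* w₀) (d₀ :* w₂ :+ d₁ :* w₁) (d₁ :* w₂)) (:- d₀) d₁ := con (+ 0)) refl
        (coeff d 0) (coeff d 1) (coeff w 0) (coeff w 1) (coeff w 2))
      linear : CommonZero R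
      linear = - coeff d 0 , coeff d 1 , inj₂ lead , root u eu , root v ev
    ... | inj₂ (2 , lead , z) = contradiction (inj₂ (inj₁ quadratic)) nd
      where
      values : ∀ w {p} → (d *ₚ w) ≈ₚ pol p → p ≋ mulQL (coeff d 0 , coeff d 1 , coeff d 2) (coeff w 0 , coeff w 1)
      values w e = sym (conv-eq d w e 0) , sym (conv-eq d w e 1) ,
        trans (sym (conv-eq d w e 2)) (drop-+ˡ (kill-*ʳ _ w₂) refl) ,
        trans (sym (conv-eq d w e 3)) (drop-+ˡ (kill-*ʳ _ w₃) (drop-+ˡ (kill-*ʳ _ w₂)
          (drop-+ʳ refl (kill-*ˡ _ (z 3 ℕP.≤-refl)))))
        where
        w₂ = bound 2 d w lead z e 2 ℕP.≤-refl
        w₃ = bound 2 d w lead z e 3 (ℕP.n≤1+n 4)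
      quadratic : QuadraticFactor R
      quadratic = (coeff d 0 , coeff d 1 , coeff d 2) , (coeff u 0 , coeff u 1) , (coeff v 0 , coeff v 1) , values u eu , values v ev
    ... | inj₂ (k@(suc (suc (suc k′))) , lead , z) = contradiction (inj₂ (inj₂ dependent)) nd
      where
      const : ∀ w {p} → (d *ₚ w) ≈ₚ pol p → Vanishes> 0 (coeff w)
      const w e i lt = bound k d w lead z e i (s≤s (s≤s (s≤s (ℕP.≤-trans lt (ℕP.m≤n+m i k′)))))
      values : ∀ w {p} → (d *ₚ w) ≈ₚ pol p → ∀ i → coeff (pol p) i ≈ coeff d i * coeff w 0
      values w e i = trans (sym (conv-eq d w e i)) (conv-const (coeff d) (coeff w) i (const w e))
      relation : ∀ {β γ} → (∀ i → β * coeff (pol g) i + γ * coeff (pol h) i ≈ 0#) → comb β γ g h ≋ zeroC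
      relation f = f 0 , f 1 , f 2 , f 3
      dependent : Dependent R
      -- The relation v₀ g = u₀ h could have both coefficients zero; when u₀ = 0, the form g itself
      -- vanishes and serves as the relation.
      dependent with coeff u 0 ≟ 0#
      ... | yes u₀≈0 = 1# , 0# , inj₁ nontrivial , relation λ i →
        drop-+ʳ (kill-*ʳ 1# (trans (values u eu i) (kill-*ʳ _ u₀≈0))) (zeroˡ _)
      ... | no u₀≉0 = coeff v 0 , - coeff u 0 , inj₂ (-≉0 u₀≉0) , relation λ i →
        trans (+-cong (*-congˡ (values u eu i)) (*-congˡ (values v ev i)))
          (solve 3 (λ d u v → v :* (d :* u) :+ :- u :* (d :* v) := con (+ 0)) refl (coeff d i) (coeff u 0) (coeff v 0))

  -- The list arithmetic of polynomials is replayed on solver syntax, so that the interpretation of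
  -- `Syn-hsub3` unfolds to the coefficients of `hsub3`.
  Syn-+ : ∀ {n} → List (Polynomial n) → List (Polynomial n) → List (Polynomial n)
  Syn-+ []      r       = r
  Syn-+ (a ∷ p) []      = a ∷ p
  Syn-+ (a ∷ p) (b ∷ r) = (a :+ b) ∷ Syn-+ p r

  Syn-* : ∀ {n} → List (Polynomial n) → List (Polynomial n) → List (Polynomial n)
  Syn-* []      r = []
  Syn-* (a ∷ p) r = Syn-+ (List.map (a :*_) r) (con (+ 0) ∷ Syn-* p r)

  Syn-^ : ∀ {n} → List (Polynomial n) → ℕ → List (Polynomial n)
  Syn-^ p zero    = con (+ 1) ∷ []
  Syn-^ p (suc n) = Syn-* p (Syn-^ p n)

  Syn-hsub3 : ∀ {n} → Mat (Polynomial n) → Cub (Polynomial n) → Cub (Polynomial n)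
  Syn-hsub3 {n} (mat a b c d) (cub p₀ p₁ p₂ p₃) = toCub
    (Syn-+ (term p₀ 0) (Syn-+ (term p₁ 1) (Syn-+ (term p₂ 2) (term p₃ 3))))
    where
    term : Polynomial n → ℕ → List (Polynomial n)
    term p i = List.map (p :*_) (Syn-* (Syn-^ (b ∷ a ∷ []) i) (Syn-^ (d ∷ c ∷ []) (3 ℕ.∸ i)))
    toCub : List (Polynomial n) → Cub (Polynomial n)
    toCub (x ∷ y ∷ z ∷ w ∷ []) = cub x y z w
    toCub _ = cub (con (+ 0)) (con (+ 0)) (con (+ 0)) (con (+ 0))

  hsub3-cubic : ∀ a b c d nd p → cubic (hsub3 (mob a b c d nd) p) ≋ subst (mat a b c d) (cubic p)
  hsub3-cubic a b c d nd p = solveC 8 (λ a b c d p₀ p₁ p₂ p₃ → let M = mat a b c d ; p = cub p₀ p₁ p₂ p₃ in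
    Syn-hsub3 M p , Syn.subst M p) (a ∷ b ∷ c ∷ d ∷ coeff p 0 ∷ coeff p 1 ∷ coeff p 2 ∷ coeff p 3 ∷ []) ≡.refl

  hsub3-degree : ∀ M p → DegLe (hsub3 M p) 3
  hsub3-degree (mob a b c d _) p = λ
    { (suc (suc (suc (suc i)))) lt → refl ; 1 (s≤s ()) ; 2 (s≤s (s≤s ())) ; 3 (s≤s (s≤s (s≤s ()))) }

  -- The transform of R is k times S in both components, so the cross products agree once k is
  -- passed from one factor to the other.
  orbit⇒sameOrbit : ∀ R S → Orbit (pencil R) S → SameOrbit R (ratExpr S)
  orbit⇒sameOrbit (g , h) (s , t) (orbit (mat α β γ δ) (mat a b c d) k dB dM k≉0 (e , e′)) =
    mob α β γ δ dB , M , λ i → begin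
      coeff (pol s *ₚ h′) i                       ≈⟨ coeff-* (pol s) h′ i ⟩
      conv (coeff (pol s)) (coeff h′) i           ≈⟨ conv-cong (λ _ → refl) (line γ δ t e′) i ⟩
      conv (coeff (pol s)) (λ j → k * coeff (pol t) j) i ≈⟨ sym (conv-assoc k _ _ i) ⟩
      conv (λ j → k * coeff (pol s) j) (coeff (pol t)) i ≈⟨ conv-cong (λ j → sym (line α β s e j)) (λ _ → refl) i ⟩
      conv (coeff g′) (coeff (pol t)) i           ≈⟨ sym (coeff-* g′ (pol t) i) ⟩
      coeff (g′ *ₚ pol t) i                       ∎
    where
    M = mob a b c d dM
    G = hsub3 M g
    H = hsub3 M h
    g′ = (α ·ₚ G) +ₚ (β ·ₚ H)
    h′ = (γ ·ₚ G) +ₚ (δ ·ₚ H)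
    coeff-comb : ∀ α β i → coeff ((α ·ₚ G) +ₚ (β ·ₚ H)) i ≈ α * coeff G i + β * coeff H i
    coeff-comb α β i = trans (coeff-+ (α ·ₚ G) (β ·ₚ H) i) (+-cong (coeff-· α G i) (coeff-· β H i))
    line : ∀ α β s → scale k s ≋ comb α β (subst (mat a b c d) (cubic g)) (subst (mat a b c d) (cubic h)) →
           ∀ i → coeff ((α ·ₚ G) +ₚ (β ·ₚ H)) i ≈ k * coeff (pol s) i
    line α β s e i = trans (coeff-comb α β i) (sym (by-degree {P = λ i → k * coeff (pol s) i ≈ α * coeff G i + β * coeff H i}
      (c₀≈ e″) (c₁≈ e″) (c₂≈ e″) (c₃≈ e″)
      (λ i lt → trans (kill-*ʳ k (pol-degree s i lt))
        (sym (drop-+ˡ (kill-*ʳ α (hsub3-degree M g i lt)) (kill-*ʳ β (hsub3-degree M h i lt))))) i))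
      where
      e″ : scale k s ≋ comb α β (cubic G) (cubic H)
      e″ = ≋-trans e (comb-cong α β (≋-sym (hsub3-cubic a b c d dM g)) (≋-sym (hsub3-cubic a b c d dM h)))
      c₀≈ : ∀ {p r} → p ≋ r → c₀ p ≈ c₀ r
      c₀≈ (x , _) = x
      c₁≈ : ∀ {p r} → p ≋ r → c₁ p ≈ c₁ r
      c₁≈ (_ , x , _) = x
      c₂≈ : ∀ {p r} → p ≋ r → c₂ p ≈ c₂ r
      c₂≈ (_ , _ , x , _) = x
      c₃≈ : ∀ {p r} → p ≋ r → c₃ p ≈ c₃ r
      c₃≈ (_ , _ , _ , x) = x

-- Pigeonhole principle and counting modulo 2

injective⇒surjective : ∀ {n} (f : Fin n → Fin n) → (∀ {i j} → f i ≡ f j → i ≡ j) → ∀ y → ∃ λ x → f x ≡ y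
injective⇒surjective {suc n} f inj y with FinP.any? (λ x → f x Fin.≟ y)
... | yes r = r
-- Punching a missed value out of the codomain would leave an injection of `suc n` points into `n`.
... | no  ¬r = contradiction (FinP.injective⇒≤ {f = λ x → Fin.punchOut (missed x)}
    (λ {i} {j} e → inj (FinP.punchOut-injective (missed i) (missed j) e))) (ℕP.<⇒≱ (ℕP.n<1+n n))
  where
  missed : ∀ x → ¬ (y ≡ f x)
  missed x e = ¬r (x , ≡.sym e)

module Parity where
  -- Addition is exclusive or: a sum of truth values is the parity of the number of solutions, and
  -- `∑-comm` is double counting.
  open import Algebra.Properties.CommutativeMonoid.Sum (CommutativeRing.+-commutativeMonoid xor-∧-commutativeRing) public
    using (sum; sum-remove; sum-cong-≗; sum-replicate-zero; ∑-comm)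

  sum-none : ∀ {n} {f : Fin n → Bool} → (∀ i → f i ≡ false) → sum f ≡ false
  sum-none {n} e = ≡.trans (sum-cong-≗ e) (sum-replicate-zero n)

  sum-unique : ∀ {n} {f : Fin n → Bool} i → f i ≡ true → (∀ j → ¬ (j ≡ i) → f j ≡ false) → sum f ≡ true
  sum-unique {suc n} {f} i e u = ≡.trans (sum-remove {i = i} f)
    (≡.cong₂ _xor_ e (sum-none (λ j → u (Fin.punchIn i j) (FinP.punchInᵢ≢i i j))))

  sum-pair : ∀ {n} {f : Fin n → Bool} i j → ¬ (i ≡ j) → f i ≡ true → f j ≡ true →
             (∀ k → ¬ (k ≡ i) → ¬ (k ≡ j) → f k ≡ false) → sum f ≡ false
  sum-pair {suc n} {f} i j i≢j e e′ u = ≡.trans (sum-remove {i = i} f) (≡.cong₂ _xor_ e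
    (sum-unique (Fin.punchOut i≢j) (≡.trans (≡.cong f (FinP.punchIn-punchOut i≢j)) e′)
      (λ k k≢ → u (Fin.punchIn i k) (FinP.punchInᵢ≢i i k)
        (λ eq → k≢ (FinP.punchIn-injective i _ _ (≡.trans eq (≡.sym (FinP.punchIn-punchOut i≢j))))))))

-- Square classes

module Squares {c ℓ : Level} (K : CommutativeRing c ℓ) (q : ℕ)
             (finite : Poly.IsFiniteField K q) (char≥5 : Poly.CharAtLeast5 K) where
  open Field K q finite char≥5
  open Parity

  -≈0⇒≈ : ∀ {x y} → x - y ≈ 0# → x ≈ y
  -≈0⇒≈ {x} {y} e = drop 1# e (solve 2 (λ x y → x := y :+ con (+ 1) :* (x :- y)) refl x y)

  ≈⇒-≈0 : ∀ {x y} → x ≈ y → x - y ≈ 0#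
  ≈⇒-≈0 e = trans (+-congʳ e) (-‿inverseʳ _)

  roots : ∀ {w x y} → (w - x) * (w - y) ≈ 0# → w ≈ x ⊎ w ≈ y
  roots e with *≈0 e
  ... | inj₁ d = inj₁ (-≈0⇒≈ d)
  ... | inj₂ d = inj₂ (-≈0⇒≈ d)

  abstract
    *≈*⇒≈± : ∀ {x y} → x * x ≈ y * y → x ≈ y ⊎ x ≈ - y
    *≈*⇒≈± {x} {y} e = roots (trans (product x y) (≈⇒-≈0 e))
      where
      product : ∀ x y → (x - y) * (x - - y) ≈ x * x - y * y
      product = solve 2 (λ x y → (x :- y) :* (x :- :- y) := x :* x :- y :* y) refl

  Square : A → Set (c ⊔ ℓ)
  Square x = Σ A λ y → y * y ≈ x

  square? : ∀ x → Dec (Square x)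
  square? x = any? (λ y → y * y ≟ x) (λ e → trans (sym (*-cong e e)))

  -- If everything were a square, a choice of roots would be injective, hence onto. Then 1 and -1
  -- would both be chosen roots, of the same element 1, forcing 1 = -1.
  nonsquare : Σ A λ n → ¬ Square n
  nonsquare with any? (λ x → ¬? (square? x)) (λ e n (y , s) → n (y , trans s (sym e)))
  ... | yes r = r
  ... | no  none = contradiction two≈0 2≉0
    where
    root : ∀ x → Square x
    root x = decidable-stable (square? x) (λ n → none (x , n))
    f : Fin q → Fin q
    f i = index (proj₁ (root (enum i)))
    f-injective : ∀ {i j} → f i ≡ f j → i ≡ j
    f-injective {i} {j} e = let y≈y′ = index-injective e in
      enum-inj i j (trans (sym (proj₂ (root (enum i)))) (trans (*-cong y≈y′ y≈y′) (proj₂ (root (enum j)))))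
    two≈0 : # 2 ≈ 0#
    two≈0 with injective⇒surjective f f-injective (index 1#) | injective⇒surjective f f-injective (index (- 1#))
    ... | i , e | j , e′ = trans (+-congʳ 1≈-1) (-‿inverseˡ 1#)
      where
      square-at : ∀ {i x} → f i ≡ index x → x * x ≈ enum i
      square-at {i} e = let y≈x = index-injective e in trans (sym (*-cong y≈x y≈x)) (proj₂ (root (enum i)))
      i≡j : i ≡ j
      i≡j = enum-inj i j (trans (sym (square-at e)) (trans (solve 1 (λ x → x :* x := :- x :* :- x) refl 1#) (square-at e′)))
      1≈-1 : 1# ≈ - 1#
      1≈-1 = index-injective (≡.trans (≡.sym e) (≡.trans (≡.cong f i≡j) e′))

  half? : ∀ x → Dec (index x Fin.≤ index (- x))
  half? x = index x Fin.≤? index (- x)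

  -- Choosing one of x and - x for every x, the map sending the chosen one to x² and the
  -- other one to n x² is injective, hence onto.
  square-classes : ∀ n → ¬ Square n → ∀ x → Σ A λ y → x ≈ y * y ⊎ x ≈ n * (y * y)
  square-classes n ¬sq x with injective⇒surjective (index ∘ φ ∘ enum) φ-injective (index x)
    where
    φ : A → A
    φ x with half? x
    ... | yes _ = x * x
    ... | no  _ = n * (x * x)
    square-difference : ∀ y t → (y * y) * (t * t - n) ≈ (y * t) * (y * t) - n * (y * y)
    square-difference y t = solve 3 (λ y t n → (y :* y) :* (t :* t :- n) := (y :* t) :* (y :* t) :- n :* (y :* y)) refl y t n
    factor-n : ∀ x y → n * (x * x - y * y) ≈ n * (x * x) - n * (y * y)
    factor-n x y = solve 3 (λ n x y → n :* (x :* x :- y :* y) := n :* (x :* x) :- n :* (y :* y)) refl n x y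
    n≉0 : n ≉ 0#
    n≉0 n≈0 = ¬sq (0# , trans (zeroˡ 0#) (sym n≈0))
    mixed : ∀ {x y} → x * x ≈ n * (y * y) → x ≈ y
    mixed {x} {y} e with y ≟ 0#
    ... | yes y≈0 = trans ([ (λ z → z) , (λ z → z) ]′ (*≈0 (trans e (trans (*-congˡ (trans (*-congʳ y≈0) (zeroˡ y))) (zeroʳ n))))) (sym y≈0)
    ... | no  y≉0 with divide x y≉0
    ...   | t , x≈yt = contradiction (t , -≈0⇒≈ (*-cancel-0 (y≉0 *≉0 y≉0)
              (trans (square-difference y t) (≈⇒-≈0 (trans (sym (*-cong x≈yt x≈yt)) e))))) ¬sq
    index-neg : ∀ {x y} → x ≈ - y → index (- x) ≡ index y
    index-neg e = index-cong (trans (-‿cong e) (-‿involutive _))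
    φ-inj : ∀ x y → φ x ≈ φ y → x ≈ y
    φ-inj x y e with half? x | half? y
    ... | yes p | no  _ = mixed e
    ... | no  _ | yes p = sym (mixed (sym e))
    ... | yes p | yes p′ with *≈*⇒≈± e
    ...   | inj₁ x≈y = x≈y
    ...   | inj₂ x≈-y = index-injective (FinP.≤-antisym
              (≡.subst (index x Fin.≤_) (index-neg x≈-y) p)
              (≡.subst (index y Fin.≤_) (≡.sym (index-cong x≈-y)) p′))
    φ-inj x y e | no p | no p′ with *≈*⇒≈± (-≈0⇒≈ (*-cancel-0 n≉0 (trans (factor-n x y) (≈⇒-≈0 e))))
    ...   | inj₁ x≈y = x≈y
    ...   | inj₂ x≈-y with FinP.≤-total (index x) (index (- x))
    ...     | inj₁ le = contradiction le p
    ...     | inj₂ le = contradiction (≡.subst₂ Fin._≤_ (index-neg x≈-y) (index-cong x≈-y) le) p′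
    φ-injective : ∀ {i j} → index (φ (enum i)) ≡ index (φ (enum j)) → i ≡ j
    φ-injective {i} {j} e = enum-inj i j (φ-inj (enum i) (enum j) (index-injective e))
  ... | i , e with half? (enum i) | index-injective e
  ...   | yes _ | e′ = enum i , inj₁ (sym e′)
  ...   | no  _ | e′ = enum i , inj₂ (sym e′)

  -- The shape fits a quadratic equation with nonzero discriminant: one root determines the other,
  -- so there are none or two.
  even-solutions : ∀ {P : A → Set ℓ} (P? : ∀ x → Dec (P x)) → (∀ {x y} → x ≈ y → P x → P y) →
    (∀ x → P x → Σ A λ y → P y × x ≉ y × (∀ z → P z → z ≈ x ⊎ z ≈ y)) → sum (λ i → does (P? (enum i))) ≡ false
  even-solutions P? resp pair with any? P? resp
  ... | no none = sum-none (λ i → dec-false (P? (enum i)) (λ p → none (enum i , p)))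
  ... | yes (x , p) with pair x p
  ...   | y , p′ , x≉y , only = sum-pair (index x) (index y) (x≉y ∘ index-injective)
      (dec-true (P? _) (resp (sym (enum-index x)) p)) (dec-true (P? _) (resp (sym (enum-index y)) p′))
      (λ k k≢x k≢y → dec-false (P? (enum k)) (λ r → [ k≢x ∘ at , k≢y ∘ at ]′ (only (enum k) r)))
    where
    at : ∀ {k x} → enum k ≈ x → k ≡ index x
    at e = enum-inj _ _ (trans e (sym (enum-index _)))

  one-solution : ∀ {P : A → Set ℓ} (P? : ∀ x → Dec (P x)) → (∀ {x y} → x ≈ y → P x → P y) →
    ∀ x → P x → (∀ z → P z → z ≈ x) → sum (λ i → does (P? (enum i))) ≡ true
  one-solution P? resp x p only = sum-unique (index x) (dec-true (P? _) (resp (sym (enum-index x)) p))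
    (λ k k≢x → dec-false (P? (enum k)) (λ r → k≢x (enum-inj _ _ (trans (only (enum k) r) (sym (enum-index x))))))

  slope-cong : ∀ a m {u u′} → u ≈ u′ → slope a m u ≈ slope a m u′
  slope-cong a m e = +-congʳ (+-congʳ (*-congˡ e))

  resolvent-cong : ∀ a b m {u u′} → u ≈ u′ → resolvent a b m u ≈ resolvent a b m u′
  resolvent-cong a b m e = +-congˡ (*-cong (slope-cong a m e) (+-congʳ (*-cong e e)))

  curve-cong : ∀ a b m {x x′ u u′} → x ≈ x′ → u ≈ u′ → curve a b m x u ≈ curve a b m x′ u′
  curve-cong a b m e e′ = +-cong (+-congʳ (+-cong (*-cong (slope-cong a m e′) (*-cong e e))
    (-‿cong (*-congˡ (*-congˡ e))))) (-‿cong (*-cong e′ e′))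

  -- The parity count on the curve y² = W(x)

  module Count (a b m : A) where
    κ W f : A → A
    κ = slope a m
    W = wronskian a b m
    f = resolvent a b m
    E : A → A → A
    E = curve a b m

    E? : ∀ x u → Dec (E x u ≈ 0#)
    E? x u = E x u ≟ 0#

    E-resp : ∀ {x x′ u u′} → x ≈ x′ → u ≈ u′ → E x u ≈ 0# → E x′ u′ ≈ 0#
    E-resp e e′ = trans (sym (curve-cong a b m e e′))

    -- This is the symmetry y ↦ -y for y = u - x².
    reflect-u : ∀ x u → E x (# 2 * (x * x) - u) ≈ E x u
    reflect-u x u = solve 5 (λ a b m x u → Syn.curve a b m x (con (+ 2) :* (x :* x) :- u) := Syn.curve a b m x u) refl a b m x u

    fixed-u : ∀ x u → (# 2 * # 2) * W x ≈
      (0# + (# 2 * # 2) * E x u) + (# 2 * u - # 2 * (x * x)) * (u - (# 2 * (x * x) - u))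
    fixed-u x u = solve 5 (λ a b m x u → (con (+ 2) :* con (+ 2)) :* Syn.wronskian a b m x :=
      (con (+ 0) :+ (con (+ 2) :* con (+ 2)) :* Syn.curve a b m x u)
        :+ (con (+ 2) :* u :- con (+ 2) :* (x :* x)) :* (u :- (con (+ 2) :* (x :* x) :- u))) refl a b m x u

    other-u : ∀ x u w → (w - u) * (w - (# 2 * (x * x) - u)) ≈ E x u - E x w
    other-u x u w = solve 6 (λ a b m x u w → (w :- u) :* (w :- (con (+ 2) :* (x :* x) :- u))
      := Syn.curve a b m x u :- Syn.curve a b m x w) refl a b m x u w

    -- The two values of u correspond to ±y and could coincide only for y = 0, over a root of W.
    row : (∀ x → W x ≉ 0#) → ∀ x u → E x u ≈ 0# → Σ A λ v → E x v ≈ 0# × u ≉ v × (∀ w → E x w ≈ 0# → w ≈ u ⊎ w ≈ v)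
    row W≉0 x u p = # 2 * (x * x) - u , trans (reflect-u x u) p ,
      (λ u≈v → W≉0 x (*-cancel-0 (2≉0 *≉0 2≉0) (drop _ p (drop _ (≈⇒-≈0 u≈v) (fixed-u x u))))) ,
      λ w p′ → roots (trans (other-u x u w) (≈⇒-≈0 (trans p (sym p′))))

    flat : ∀ x u → E x u ≈ (0# + (x * x) * κ u) + (- 1#) * ((u * u + a * m) - (- (# 2 * b)) * x)
    flat x u = solve 5 (λ a b m x u → Syn.curve a b m x u :=
      (con (+ 0) :+ (x :* x) :* Syn.slope a m u) :+ (:- con (+ 1)) :* ((u :* u :+ a :* m) :- (:- (con (+ 2) :* b)) :* x))
      refl a b m x u

    flat-unique : ∀ x u z → (- (# 2 * b)) * (z - x) ≈
      ((0# + 1# * E z u) + (- (z * z)) * κ u) + 1# * ((u * u + a * m) - (- (# 2 * b)) * x)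
    flat-unique x u z = solve 6 (λ a b m x u z → (:- (con (+ 2) :* b)) :* (z :- x) :=
      ((con (+ 0) :+ con (+ 1) :* Syn.curve a b m z u) :+ (:- (z :* z)) :* Syn.slope a m u)
        :+ con (+ 1) :* ((u :* u :+ a :* m) :- (:- (con (+ 2) :* b)) :* x)) refl a b m x u z

    -- For fixed u of nonzero slope the roots in x have sum t = 2b/κ, so t - x is the other root.
    reflect-x : ∀ x u t → E (t - x) u ≈ (0# + 1# * E x u) + (# 2 * x - t) * (# 2 * b - κ u * t)
    reflect-x x u t = solve 6 (λ a b m x u t → Syn.curve a b m (t :- x) u :=
      (con (+ 0) :+ con (+ 1) :* Syn.curve a b m x u) :+ (con (+ 2) :* x :- t) :* (con (+ 2) :* b :- Syn.slope a m u :* t))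
      refl a b m x u t

    -- A root equal to its partner is a double root, at which the discriminant vanishes.
    fixed-x : ∀ x u t → (# 2 * # 2) * f u ≈
      ((0# + (- (# 2 * # 2 * κ u)) * E x u) + (# 2 * b - # 2 * (κ u * x)) * (# 2 * b - κ u * t))
        + (- ((# 2 * b - # 2 * (κ u * x)) * κ u)) * (x - (t - x))
    fixed-x x u t = solve 6 (λ a b m x u t → let κ = Syn.slope a m u ; d = con (+ 2) :* b :- con (+ 2) :* (κ :* x) in
      (con (+ 2) :* con (+ 2)) :* Syn.resolvent a b m u :=
      ((con (+ 0) :+ (:- (con (+ 2) :* con (+ 2) :* κ)) :* Syn.curve a b m x u) :+ d :* (con (+ 2) :* b :- κ :* t))
        :+ (:- (d :* κ)) :* (x :- (t :- x))) refl a b m x u t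

    other-x : ∀ x u t z → κ u * ((z - x) * (z - (t - x))) ≈
      ((0# + 1# * E z u) + (- 1#) * E x u) + (z - x) * (# 2 * b - κ u * t)
    other-x x u t z = solve 7 (λ a b m x u t z → Syn.slope a m u :* ((z :- x) :* (z :- (t :- x))) :=
      ((con (+ 0) :+ con (+ 1) :* Syn.curve a b m z u) :+ (:- con (+ 1)) :* Syn.curve a b m x u)
        :+ (z :- x) :* (con (+ 2) :* b :- Syn.slope a m u :* t)) refl a b m x u t z

    -- Slope 0 makes the equation linear in x with coefficient -2b. This single column supplies the
    -- odd count.
    flat-column : b ≉ 0# → ∀ u → κ u ≈ 0# → sum (λ i → does (E? (enum i) u)) ≡ true
    flat-column b≉0 u κ≈0 with divide (u * u + a * m) (-≉0 (2≉0 *≉0 b≉0))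
    ... | x , e = one-solution (λ x → E? x u) (λ e → E-resp e refl) x
      (drop _ κ≈0 (drop _ (≈⇒-≈0 e) (flat x u)))
      (λ z p → -≈0⇒≈ (*-cancel-0 (-≉0 (2≉0 *≉0 b≉0)) (drop _ p (drop _ κ≈0 (drop _ (≈⇒-≈0 e) (flat-unique x u z))))))

    steep-column : (∀ u → f u ≉ 0#) → ∀ u → κ u ≉ 0# → sum (λ i → does (E? (enum i) u)) ≡ false
    steep-column f≉0 u κ≉0 with divide (# 2 * b) κ≉0
    ... | t , e = even-solutions (λ x → E? x u) (λ e → E-resp e refl) λ x p → t - x ,
      drop _ p (drop _ (≈⇒-≈0 e) (reflect-x x u t)) ,
      (λ x≈ → f≉0 u (*-cancel-0 (2≉0 *≉0 2≉0) (drop _ p (drop _ (≈⇒-≈0 e) (drop _ (≈⇒-≈0 x≈) (fixed-x x u t)))))) ,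
      λ z p′ → roots (*-cancel-0 κ≉0 (drop _ p′ (drop _ p (drop _ (≈⇒-≈0 e) (other-x x u t z)))))

    column : b ≉ 0# → (∀ u → f u ≉ 0#) → ∀ u → sum (λ i → does (E? (enum i) u)) ≡ does (κ u ≟ 0#)
    column b≉0 f≉0 u = by-slope (κ u ≟ 0#)
      where
      by-slope : (d : Dec (κ u ≈ 0#)) → sum (λ i → does (E? (enum i) u)) ≡ does d
      by-slope (yes κ≈0) = flat-column b≉0 u κ≈0
      by-slope (no κ≉0)  = steep-column f≉0 u κ≉0

    one-flat : sum (λ j → does (κ (enum j) ≟ 0#)) ≡ true
    one-flat with divide (# 3 * m + a) 2≉0
    ... | u , e = one-solution (λ u → κ u ≟ 0#) (λ e → trans (sym (slope-cong a m e))) u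
      (drop _ (≈⇒-≈0 e) (solution u)) (λ z p → -≈0⇒≈ (*-cancel-0 2≉0 (drop _ p (drop _ (≈⇒-≈0 e) (unique u z)))))
      where
      solution : ∀ u → κ u ≈ 0# + (- 1#) * ((# 3 * m + a) - # 2 * u)
      solution u = solve 3 (λ a m u → Syn.slope a m u :=
        con (+ 0) :+ (:- con (+ 1)) :* ((con (+ 3) :* m :+ a) :- con (+ 2) :* u)) refl a m u
      unique : ∀ u z → # 2 * (z - u) ≈ (0# + 1# * κ z) + 1# * ((# 3 * m + a) - # 2 * u)
      unique u z = solve 4 (λ a m u z → con (+ 2) :* (z :- u) :=
        (con (+ 0) :+ con (+ 1) :* Syn.slope a m z) :+ con (+ 1) :* ((con (+ 3) :* m :+ a) :- con (+ 2) :* u)) refl a m u z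

    -- The curve is quadratic both in u and in x.  If neither the Wronskian nor the resolvent
    -- had a root, every x would carry 0 or 2 values of u and every u would carry 0 or 2 values
    -- of x, except for the u of slope 0, which carries exactly one.
    resolvent-root : b ≉ 0# → (∀ x → W x ≉ 0#) → Σ A λ u → f u ≈ 0#
    resolvent-root b≉0 W≉0 with any? (λ u → f u ≟ 0#) (λ e → trans (sym (resolvent-cong a b m e)))
    ... | yes r = r
    ... | no  none = contradiction (≡.trans (≡.sym columns)
        (≡.trans (∑-comm (λ j i → does (E? (enum i) (enum j)))) rows)) (λ ())
      where
      rows : sum (λ i → sum (λ j → does (E? (enum i) (enum j)))) ≡ false
      rows = sum-none (λ i → even-solutions (E? (enum i)) (E-resp refl) (row W≉0 (enum i)))
      columns : sum (λ j → sum (λ i → does (E? (enum i) (enum j)))) ≡ true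
      columns = ≡.trans (sum-cong-≗ (λ j → column b≉0 (λ u z → none (u , z)) (enum j))) one-flat

-- Explicit equivalences between normal forms

module Moves {c ℓ : Level} (K : CommutativeRing c ℓ) (q : ℕ)
             (finite : Poly.IsFiniteField K q) (char≥5 : Poly.CharAtLeast5 K) where
  open Field K q finite char≥5

  private
    o i : ∀ {n} → Polynomial n
    o = con (+ 0)
    i = con (+ 1)
    diag : ∀ {n} → Polynomial n → Polynomial n → Mat (Polynomial n)
    diag x y = mat x o o y

  1≉0 : 1# ≉ 0#
  1≉0 = nontrivial

  4≉0 : # 2 * # 2 ≉ 0#
  4≉0 = 2≉0 *≉0 2≉0

  abstract
    -- The substitution (x - g₂)/(3 g₃) removes the quadratic term and leaves a common factor g₃;
    -- the constant denominator removes the constant term.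
    complete-cube : ∀ g₀ g₁ g₂ g₃ h₀ → g₃ ≉ 0# → h₀ ≉ 0# →
      Orbit (cub g₀ g₁ g₂ g₃ , cub h₀ 0# 0# 0#)
            (cub 0# (# 9 * (g₁ * g₃) - # 3 * (g₂ * g₂)) 0# 1# , cub 1# 0# 0# 0#)
    complete-cube g₀ g₁ g₂ g₃ h₀ g₃≉0 h₀≉0 = solveOrbit 5 (λ g₀ g₁ g₂ g₃ h₀ →
      let g = cub g₀ g₁ g₂ g₃ ; M = mat i (:- g₂) o (con (+ 3) :* g₃) ; H = Syn.cube (con (+ 3) :* g₃) :* h₀ in
      move (g , cub h₀ o o o) (cub o (con (+ 9) :* (g₁ :* g₃) :- con (+ 3) :* (g₂ :* g₂)) o i , cub i o o o)
        (mat H (:- c₀ (Syn.subst M g)) o g₃) M (H :* g₃) (H :* g₃) (con (+ 3) :* g₃))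
      (g₀ ∷ g₁ ∷ g₂ ∷ g₃ ∷ h₀ ∷ []) ≡.refl ≡.refl ≡.refl ≡.refl
      ((cube≉0 (3≉0 *≉0 g₃≉0) *≉0 h₀≉0) *≉0 g₃≉0) (3≉0 *≉0 g₃≉0) ((cube≉0 (3≉0 *≉0 g₃≉0) *≉0 h₀≉0) *≉0 g₃≉0)

    rescale-depressed : ∀ e y → y ≉ 0# →
      Orbit (cub 0# (e * (y * y)) 0# 1# , cub 1# 0# 0# 0#) (cub 0# e 0# 1# , cub 1# 0# 0# 0#)
    rescale-depressed e y y≉0 = solveOrbit 2 (λ e y →
      move (cub o (e :* (y :* y)) o i , cub i o o o) (cub o e o i , cub i o o o)
        (diag i (Syn.cube y)) (diag y i) (Syn.cube y) (Syn.cube y) y)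
      (e ∷ y ∷ []) ≡.refl ≡.refl ≡.refl ≡.refl (cube≉0 y≉0) y≉0 (cube≉0 y≉0)

    -- Translation brings the pole -h₀/h₁ to 0, and a multiple of the new denominator h₁⁴ x clears
    -- the linear term above it.
    pole-at-0 : ∀ g h₀ h₁ → h₁ ≉ 0# → let G = subst (mat h₁ (- h₀) 0# h₁) g in
      Orbit (g , cub h₀ h₁ 0# 0#) (cub (c₀ G) 0# (c₂ G) (c₃ G) , cub 0# 1# 0# 0#)
    pole-at-0 (cub g₀ g₁ g₂ g₃) h₀ h₁ h₁≉0 = solveOrbit 6 (λ g₀ g₁ g₂ g₃ h₀ h₁ →
      let g = cub g₀ g₁ g₂ g₃ ; M = mat h₁ (:- h₀) o h₁ ; G = Syn.subst M g ; k = Syn.cube h₁ :* h₁ in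
      move (g , cub h₀ h₁ o o) (cub (c₀ G) o (c₂ G) (c₃ G) , cub o i o o)
        (mat k (:- c₁ G) o i) M k k (h₁ :* h₁))
      (g₀ ∷ g₁ ∷ g₂ ∷ g₃ ∷ h₀ ∷ h₁ ∷ []) ≡.refl ≡.refl ≡.refl ≡.refl
      (cube≉0 h₁≉0 *≉0 h₁≉0) (h₁≉0 *≉0 h₁≉0) (cube≉0 h₁≉0 *≉0 h₁≉0)

    make-monic : ∀ t₀ t₂ k → k ≉ 0# →
      Orbit (cub (k * t₀) 0# (k * t₂) k , cub 0# 1# 0# 0#) (cub t₀ 0# t₂ 1# , cub 0# 1# 0# 0#)
    make-monic t₀ t₂ k k≉0 = solveOrbit 3 (λ t₀ t₂ k →
      move (cub (k :* t₀) o (k :* t₂) k , cub o i o o) (cub t₀ o t₂ i , cub o i o o) (diag i k) (diag i i) k k i)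
      (t₀ ∷ t₂ ∷ k ∷ []) ≡.refl ≡.refl ≡.refl ≡.refl k≉0 1≉0 k≉0

    rescale-nodal : ∀ t k → k ≉ 0# →
      Orbit (cub (cube k * t) 0# k 1# , cub 0# 1# 0# 0#) (cub t 0# 1# 1# , cub 0# 1# 0# 0#)
    rescale-nodal t k k≉0 = solveOrbit 2 (λ t k →
      move (cub (Syn.cube k :* t) o k i , cub o i o o) (cub t o i i , cub o i o o)
        (diag i (k :* k)) (diag k i) (Syn.cube k) (k :* k) k)
      (t ∷ k ∷ []) ≡.refl ≡.refl ≡.refl ≡.refl (k≉0 *≉0 k≉0) k≉0 (cube≉0 k≉0)

    invert : ∀ e f₀ f₂ → Orbit (cub 0# 0# 0# e , cub f₀ 0# f₂ 0#) (cub 0# f₂ 0# f₀ , cub e 0# 0# 0#)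
    invert e f₀ f₂ = solveOrbit 3 (λ e f₀ f₂ →
      move (cub o o o e , cub f₀ o f₂ o) (cub o f₂ o f₀ , cub e o o o) (mat o i i o) (mat o i i o) i (:- i) (:- i))
      (e ∷ f₀ ∷ f₂ ∷ []) ≡.refl ≡.refl ≡.refl ≡.refl (-≉0 1≉0) (-≉0 1≉0) 1≉0

    rescale-odd : ∀ e m k l y → k ≉ 0# → l ≉ 0# → y ≉ 0# →
      Orbit (cub 0# (k * (e * (y * y))) 0# k , cub (l * ((y * y) * m)) 0# l 0#) (cub 0# e 0# 1# , cub m 0# 1# 0#)
    rescale-odd e m k l y k≉0 l≉0 y≉0 = solveOrbit 5 (λ e m k l y → let x = l :* (y :* y) ; z = k :* Syn.cube y in
      move (cub o (k :* (e :* (y :* y))) o k , cub (l :* ((y :* y) :* m)) o l o) (cub o e o i , cub m o i o)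
        (diag x z) (diag y i) (x :* z) (x :* z) y)
      (e ∷ m ∷ k ∷ l ∷ y ∷ []) ≡.refl ≡.refl ≡.refl ≡.refl
      ((l≉0 *≉0 (y≉0 *≉0 y≉0)) *≉0 (k≉0 *≉0 cube≉0 y≉0)) y≉0 ((l≉0 *≉0 (y≉0 *≉0 y≉0)) *≉0 (k≉0 *≉0 cube≉0 y≉0))

    -- x ↦ (r x + 1)/x brings the point r to ∞.
    move-to-∞₁ : ∀ r g h → let G = subst (mat r 1# 1# 0#) g ; H = subst (mat r 1# 1# 0#) h in
      c₃ H ≉ 0# → Orbit (g , h) (H , comb (c₃ H) (- c₃ G) G H)
    move-to-∞₁ r (cub g₀ g₁ g₂ g₃) (cub h₀ h₁ h₂ h₃) H₃≉0 = solveOrbit 9 (λ r g₀ g₁ g₂ g₃ h₀ h₁ h₂ h₃ →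
      let g = cub g₀ g₁ g₂ g₃ ; h = cub h₀ h₁ h₂ h₃ ; M = mat r i i o ; G = Syn.subst M g ; H = Syn.subst M h in
      move (g , h) (H , Syn.comb (c₃ H) (:- c₃ G) G H) (mat o i (c₃ H) (:- c₃ G)) M i (:- c₃ H) (:- i))
      (r ∷ g₀ ∷ g₁ ∷ g₂ ∷ g₃ ∷ h₀ ∷ h₁ ∷ h₂ ∷ h₃ ∷ []) ≡.refl ≡.refl ≡.refl ≡.refl (-≉0 H₃≉0) (-≉0 1≉0) 1≉0

    -- The variant for a pole r, where `H` loses its cubic term and `G` must be the new numerator.
    move-to-∞₂ : ∀ r g h → let G = subst (mat r 1# 1# 0#) g ; H = subst (mat r 1# 1# 0#) h in
      c₃ G ≉ 0# → Orbit (g , h) (G , comb (c₃ H) (- c₃ G) G H)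
    move-to-∞₂ r (cub g₀ g₁ g₂ g₃) (cub h₀ h₁ h₂ h₃) G₃≉0 = solveOrbit 9 (λ r g₀ g₁ g₂ g₃ h₀ h₁ h₂ h₃ →
      let g = cub g₀ g₁ g₂ g₃ ; h = cub h₀ h₁ h₂ h₃ ; M = mat r i i o ; G = Syn.subst M g ; H = Syn.subst M h in
      move (g , h) (G , Syn.comb (c₃ H) (:- c₃ G) G H) (mat i o (c₃ H) (:- c₃ G)) M i (:- c₃ G) (:- i))
      (r ∷ g₀ ∷ g₁ ∷ g₂ ∷ g₃ ∷ h₀ ∷ h₁ ∷ h₂ ∷ h₃ ∷ []) ≡.refl ≡.refl ≡.refl ≡.refl (-≉0 G₃≉0) (-≉0 1≉0) 1≉0

    -- A change of coordinate on the target makes ∞ the value at ∞.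
    lower-degree : ∀ g h → c₃ h ≉ 0# → Orbit (g , h) (h , comb (c₃ h) (- c₃ g) g h)
    lower-degree (cub g₀ g₁ g₂ g₃) (cub h₀ h₁ h₂ h₃) h₃≉0 = solveOrbit 8 (λ g₀ g₁ g₂ g₃ h₀ h₁ h₂ h₃ →
      let g = cub g₀ g₁ g₂ g₃ ; h = cub h₀ h₁ h₂ h₃ in
      move (g , h) (h , Syn.comb h₃ (:- g₃) g h) (mat o i h₃ (:- g₃)) (diag i i) i (:- h₃) i)
      (g₀ ∷ g₁ ∷ g₂ ∷ g₃ ∷ h₀ ∷ h₁ ∷ h₂ ∷ h₃ ∷ []) ≡.refl ≡.refl ≡.refl ≡.refl (-≉0 h₃≉0) 1≉0 1≉0

    -- The substitution (x - h₁)/(2 h₂) centres the two finite poles at 0. A multiple of the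
    -- denominator, whose leading coefficient is now 2 h₂², then removes x² from the numerator.
    complete-square : ∀ g h₀ h₁ h₂ → h₂ ≉ 0# →
      let M = mat 1# (- h₁) 0# (# 2 * h₂) ; G = subst M g ; H = subst M (cub h₀ h₁ h₂ 0#) in
      Orbit (g , cub h₀ h₁ h₂ 0#)
            (cub (c₂ H * c₀ G - c₂ G * c₀ H) (c₂ H * c₁ G) 0# (c₂ H * c₃ G) , cub (c₀ H) 0# (# 2 * (h₂ * h₂)) 0#)
    complete-square (cub g₀ g₁ g₂ g₃) h₀ h₁ h₂ h₂≉0 = solveOrbit 7 (λ g₀ g₁ g₂ g₃ h₀ h₁ h₂ →
      let g = cub g₀ g₁ g₂ g₃ ; h = cub h₀ h₁ h₂ o ; M = mat i (:- h₁) o (con (+ 2) :* h₂)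
          G = Syn.subst M g ; H = Syn.subst M h ; k = con (+ 2) :* (h₂ :* h₂) in
      move (g , h) (cub (c₂ H :* c₀ G :- c₂ G :* c₀ H) (c₂ H :* c₁ G) o (c₂ H :* c₃ G) , cub (c₀ H) o k o)
        (mat (c₂ H) (:- c₂ G) o i) M i k (con (+ 2) :* h₂))
      (g₀ ∷ g₁ ∷ g₂ ∷ g₃ ∷ h₀ ∷ h₁ ∷ h₂ ∷ []) ≡.refl ≡.refl ≡.refl ≡.refl (2≉0 *≉0 (h₂≉0 *≉0 h₂≉0)) (2≉0 *≉0 h₂≉0) 1≉0

    normalise-reduced : ∀ a b m k l → k ≉ 0# → l ≉ 0# →
      Orbit (cub (k * b) (k * a) 0# k , cub (l * - m) 0# l 0#) (reduced a b m)
    normalise-reduced a b m k l k≉0 l≉0 = solveOrbit 5 (λ a b m k l →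
      move (cub (k :* b) (k :* a) o k , cub (l :* (:- m)) o l o) (Syn.reduced a b m) (diag l k) (diag i i) (l :* k) (l :* k) i)
      (a ∷ b ∷ m ∷ k ∷ l ∷ []) ≡.refl ≡.refl ≡.refl ≡.refl (l≉0 *≉0 k≉0) 1≉0 (l≉0 *≉0 k≉0)

    -- The case of a pole at s, where u = -3 s² and m = s² give this b. The involution fixes 3s and
    -- -s, and (s x + 3s)/(1 - x) takes 0 and ∞ to them.
    reduced-odd : ∀ a s → s ≉ 0# →
      Orbit (reduced a (- (# 9 * (s * s) + a) * s) (s * s))
            (cub 0# (# 2 * # 2 * s * (# 54 * cube s - # 2 * (a * s))) 0# (# 2 * # 2 * s * (# 10 * cube s + # 2 * (a * s))) ,
             cub (# 8 * (s * s)) 0# (- (# 8 * (s * s))) 0#)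
    reduced-odd a s s≉0 = solveOrbit 2 (λ a s → let k = con (+ 2) :* con (+ 2) :* s in
      move (Syn.reduced a (:- (con (+ 9) :* (s :* s) :+ a) :* s) (s :* s))
           (cub o (k :* (con (+ 54) :* Syn.cube s :- con (+ 2) :* (a :* s))) o (k :* (con (+ 10) :* Syn.cube s :+ con (+ 2) :* (a :* s))) ,
            cub (con (+ 8) :* (s :* s)) o (:- (con (+ 8) :* (s :* s))) o)
           (mat k (:- (con (+ 9) :* (s :* s) :+ a)) o i) (mat s (con (+ 3) :* s) (:- i) i) i k k)
      (a ∷ s ∷ []) ≡.refl ≡.refl ≡.refl ≡.refl (4≉0 *≉0 s≉0) (4≉0 *≉0 s≉0) 1≉0

    -- After translation by s, adding k times the denominator to l times the numerator kills the
    -- constant term and leaves 2 s n at x². Only the linear coefficient has yet to become n² for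
    -- the result to be `symmetric s l n`.
    reduced-symmetric : ∀ a m u s → let n = s * s - u ; l = s * s - m ; k = # 2 * (s * n) - # 3 * (s * l) in
      l ≉ 0# → Orbit (reduced a (slope a m u * s) m)
        (cub 0# (l * (# 3 * (s * s) + a) + # 2 * (s * k)) (# 2 * (s * n)) l , cub l (# 2 * s) 1# 0#)
    reduced-symmetric a m u s l≉0 = solveOrbit 4 (λ a m u s →
      let n = s :* s :- u ; l = s :* s :- m ; k = con (+ 2) :* (s :* n) :- con (+ 3) :* (s :* l) in
      move (Syn.reduced a (Syn.slope a m u :* s) m)
        (cub o (l :* (con (+ 3) :* (s :* s) :+ a) :+ con (+ 2) :* (s :* k)) (con (+ 2) :* (s :* n)) l ,
         cub l (con (+ 2) :* s) i o)
        (mat l k o i) (mat i s o i) i l i)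
      (a ∷ m ∷ u ∷ s ∷ []) ≡.refl ≡.refl ≡.refl ≡.refl l≉0 1≉0 1≉0

    -- The transform h ↦ x³ h(n/x) squares to n³ = ν⁶, so it ∓ ν³ h are its eigenforms on the
    -- pencil. With the fixed points ν and -ν placed at 0 and ∞ they become an odd and an even
    -- cubic.
    symmetric-odd : ∀ s l ν → ν ≉ 0# → let n = ν * ν ; t = # 2 * (s * ν) in
      Orbit (symmetric s l n)
            (cub 0# (# 3 * l - n + t) 0# (l + n - t) , cub (l + n + t) 0# (# 3 * l - n - t) 0#)
    symmetric-odd s l ν ν≉0 = solveOrbit 3 (λ s l ν → let n = ν :* ν ; t = con (+ 2) :* (s :* ν) ; k = con (+ 2) :* Syn.cube ν in
      move (Syn.symmetric s l n)
           (cub o (con (+ 3) :* l :- n :+ t) o (l :+ n :- t) , cub (l :+ n :+ t) o (con (+ 3) :* l :- n :- t) o)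
           (mat i (:- Syn.cube ν) i (Syn.cube ν)) (mat ν ν (:- i) i) k k (con (+ 2) :* ν))
      (s ∷ l ∷ ν ∷ []) ≡.refl ≡.refl ≡.refl ≡.refl (2≉0 *≉0 cube≉0 ν≉0) (2≉0 *≉0 ν≉0) (2≉0 *≉0 cube≉0 ν≉0)

    rescale-symmetric : ∀ s l n y → y ≉ 0# → Orbit (symmetric (y * s) ((y * y) * l) (n * (y * y))) (symmetric s l n)
    rescale-symmetric s l n y y≉0 = solveOrbit 4 (λ s l n y →
      move (Syn.symmetric (y :* s) ((y :* y) :* l) (n :* (y :* y))) (Syn.symmetric s l n)
           (diag i (Syn.cube y)) (diag y i) ((y :* y) :* Syn.cube y) (Syn.cube y) y)
      (s ∷ l ∷ n ∷ y ∷ []) ≡.refl ≡.refl ≡.refl ≡.refl (cube≉0 y≉0) y≉0 ((y≉0 *≉0 y≉0) *≉0 cube≉0 y≉0)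

    -- The eigenform of the involution is ε (x − ν)³ + φ (x − ν)(x + ν)² up to a factor 4;
    -- multiplying by the conjugate of ε makes the leading coefficient rational.
    symmetric-twisted : ∀ s l n → let ε = l + n , - (# 2 * s) ; φ = # 3 * l - n , # 2 * s in
      n ≉ 0# → norm n ε ≉ 0# → Orbit (symmetric s l n) (twisted n (norm n ε) (mulL n φ (conj ε)))
    symmetric-twisted s l n n≉0 N≉0 = solveOrbit 3 (λ s l n →
      let ε₀ = l :+ n ; ε₁ = :- (con (+ 2) :* s) ; ε = ε₀ , ε₁ ; φ = con (+ 3) :* l :- n , con (+ 2) :* s
          4ₛ = con (+ 2) :* con (+ 2) in
      move (Syn.symmetric s l n) (Syn.twisted n (Syn.norm n ε) (Syn.mulL n φ (Syn.conj ε)))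
           (mat (4ₛ :* ε₀) (4ₛ :* (n :* (n :* ε₁))) (:- (4ₛ :* ε₁)) (:- (4ₛ :* (n :* ε₀)))) (diag i i)
           i (:- ((4ₛ :* 4ₛ :* n) :* Syn.norm n ε)) i)
      (s ∷ l ∷ n ∷ []) ≡.refl ≡.refl ≡.refl ≡.refl (-≉0 ((4≉0 *≉0 4≉0 *≉0 n≉0) *≉0 N≉0)) 1≉0 1≉0

    normalise-twisted : ∀ n ω α → ω ≉ 0# → Orbit (twisted n ω (scaleL ω α)) (twisted n 1# α)
    normalise-twisted n ω (α₀ , α₁) ω≉0 = solveOrbit 4 (λ n ω α₀ α₁ →
      move (Syn.twisted n ω (Syn.scaleL ω (α₀ , α₁))) (Syn.twisted n i (α₀ , α₁)) (diag i i) (diag i i) ω i i)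
      (n ∷ ω ∷ α₀ ∷ α₁ ∷ []) ≡.refl ≡.refl ≡.refl ≡.refl 1≉0 1≉0 ω≉0

    -- x ↦ (p x − n r)/(p − r x) multiplies x − ν by δ = p + r ν and x + ν by its conjugate.
    rotate : ∀ n α δ → norm n δ ≉ 0# → let N = norm n δ ; δ̄² = mulL n (conj δ) (conj δ) in
      Orbit (twisted n 1# α) (twisted n (N * N) (mulL n α (mulL n δ̄² δ̄²)))
    rotate n (α₀ , α₁) (p , r) N≉0 = solveOrbit 5 (λ n α₀ α₁ p r →
      let α = α₀ , α₁ ; δ = p , r ; N = Syn.norm n δ ; δ̄² = Syn.mulL n (Syn.conj δ) (Syn.conj δ)
          w = Syn.mulL n δ̄² (Syn.conj δ) in
      move (Syn.twisted n i α) (Syn.twisted n (N :* N) (Syn.mulL n α (Syn.mulL n δ̄² δ̄²)))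
           (mat (proj₁ w) (n :* proj₂ w) (proj₂ w) (proj₁ w)) (mat p (:- (n :* r)) (:- r) p) N (Syn.cube N) N)
      (n ∷ α₀ ∷ α₁ ∷ p ∷ r ∷ []) ≡.refl ≡.refl ≡.refl ≡.refl (cube≉0 N≉0) N≉0 N≉0

-- Lengths of lists

list-except : ∀ {a} {B : Set a} {q} (f : Fin q → B) (i : Fin q) →
              Σ (List B) λ xs → suc (length xs) ≡ q × (∀ j → ¬ (i ≡ j) → f j ∈ xs)
list-except {q = suc q} f i = List.tabulate (λ j → f (Fin.punchIn i j)) , ≡.cong suc (ListP.length-tabulate _) ,
  λ j i≢j → ≡.subst (λ k → f k ∈ _) (FinP.punchIn-punchOut i≢j) (∈-tabulate⁺ {f = λ j → f (Fin.punchIn i j)} (Fin.punchOut i≢j))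

length-families : ∀ {a b} {A : Set a} {B : Set b} (fs : List (A → B)) (xs : List A) →
                  length (List.concatMap (λ f → List.map f xs) fs) ≡ length fs ℕ.* length xs
length-families []       xs = ≡.refl
length-families (f ∷ fs) xs = ≡.trans (ListP.length-++ (List.map f xs))
  (≡.cong₂ ℕ._+_ (ListP.length-map f xs) (length-families fs xs))

-- The quadratic extension by a square root of n

module Classification {c ℓ : Level} (K : CommutativeRing c ℓ) (q : ℕ)
             (finite : Poly.IsFiniteField K q) (char≥5 : Poly.CharAtLeast5 K) where
  open Field K q finite char≥5
  open Degeneracy K q finite char≥5
  open Cubics K q finite char≥5
  open Squares K q finite char≥5
  open Moves K q finite char≥5

  abstract
    nonzero-list : Σ (List A) λ xs → suc (length xs) ≡ q × (∀ x → x ≉ 0# → Σ A λ y → y ∈ xs × x ≈ y)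
    nonzero-list with list-except enum (index 0#)
    ... | xs , len , member = xs , len , λ x x≉0 → enum (index x) ,
      member (index x) (λ e → x≉0 (sym (index-injective e))) , sym (enum-index x)

    a-nonsquare : Σ A λ n → ¬ Square n
    a-nonsquare = nonsquare

  module Reps (n : A) (¬sq : ¬ Square n) where

    n≉0 : n ≉ 0#
    n≉0 n≈0 = ¬sq (0# , trans (zeroˡ 0#) (sym n≈0))

    L : Set c
    L = A × A

    infix 4 _≈L_
    _≈L_ : L → L → Set ℓ
    (x , y) ≈L (x′ , y′) = (x ≈ x′) × (y ≈ y′)

    infixl 7 _·_
    _·_ : L → L → L
    _·_ = mulL n

    N : L → A
    N = norm n

    ·-cong : ∀ {x x′ y y′} → x ≈L x′ → y ≈L y′ → x · y ≈L x′ · y′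
    ·-cong (a , b) (c , d) = +-cong (*-cong a c) (*-congˡ (*-cong b d)) , +-cong (*-cong a d) (*-cong b c)

    N-cong : ∀ {x x′} → x ≈L x′ → N x ≈ N x′
    N-cong (a , b) = +-cong (*-cong a a) (-‿cong (*-congˡ (*-cong b b)))

    ≈L-trans : ∀ {x y z} → x ≈L y → y ≈L z → x ≈L z
    ≈L-trans (a , b) (c , d) = trans a c , trans b d

    ≈L-sym : ∀ {x y} → x ≈L y → y ≈L x
    ≈L-sym (a , b) = sym a , sym b

    scaleL-cong : ∀ {k l x y} → k ≈ l → x ≈L y → scaleL k x ≈L scaleL l y
    scaleL-cong e (a , b) = *-cong e a , *-cong e b

    -- A zero with y ≠ 0 would give (x/y)² = n.
    anisotropic : ∀ x → N x ≈ 0# → x ≈L (0# , 0#)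
    anisotropic (x , y) e with y ≟ 0#
    ... | yes y≈0 = [ (λ z → z) , (λ z → z) ]′ (*≈0 (drop (n * y) y≈0 (drop 1# e (expand x y)))) , y≈0
      where
      expand : ∀ x y → x * x ≈ (0# + (n * y) * y) + 1# * N (x , y)
      expand x y = solve 3 (λ n x y → x :* x := (con (+ 0) :+ (n :* y) :* y) :+ con (+ 1) :* Syn.norm n (x , y)) refl n x y
    ... | no y≉0 with divide x y≉0
    ...   | t , x≈yt = contradiction (t , -≈0⇒≈ (*-cancel-0 (y≉0 *≉0 y≉0)
        (trans (factor y t) (trans (N-cong (sym x≈yt , refl)) e)))) ¬sq
      where
      factor : ∀ y t → (y * y) * (t * t - n) ≈ N (y * t , y)
      factor y t = solve 3 (λ n y t → (y :* y) :* (t :* t :- n) := Syn.norm n (y :* t , y)) refl n y t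

    -- Any element of norm y will do, since both classes of that norm are reached from it. The
    -- search avoids surjectivity of the norm; (0, 0) stands in where it fails.
    representative : A → L
    representative y with any₂? {P = λ x z → N (x , z) ≈ y} (λ x z → N (x , z) ≟ y) (λ a b e → trans (N-cong (sym a , sym b)) e)
    ... | yes (x , z , _) = x , z
    ... | no _            = 0# , 0#

    N-representative : ∀ {y} α → N α ≈ y → N (representative y) ≈ y
    N-representative {y} α e with any₂? {P = λ x z → N (x , z) ≈ y} (λ x z → N (x , z) ≟ y) (λ a b e → trans (N-cong (sym a , sym b)) e)
    ... | yes (_ , _ , e′) = e′
    ... | no none          = contradiction (_ , _ , e) none

    abstract
      -- An element of nonsquare norm if the search finds one; otherwise 1, for which the last
      -- clause holds vacuously.
      twistor : Σ L λ γ → Σ A λ k → N γ * k ≈ 1# × (∀ γ′ → ¬ Square (N γ′) → ¬ Square (N γ))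
      twistor with any₂? (λ x z → ¬? (square? (N (x , z)))) (λ a b ns (w , e) → ns (w , trans e (N-cong (sym a , sym b))))
      ... | yes (x , z , ns) = (x , z) , proj₁ inv , proj₂ inv , λ _ _ → ns
        where
        inv : Σ A λ k → N (x , z) * k ≈ 1#
        inv = inverse (N (x , z)) (λ e → ns (0# , trans (zeroˡ 0#) (sym e)))
      ... | no none = (1# , 0#) , 1# , one , λ (x , z) ns → contradiction (x , z , ns) none
        where
        one : N (1# , 0#) * 1# ≈ 1#
        one = solve 1 (λ n → Syn.norm n (con (+ 1) , con (+ 0)) :* con (+ 1) := con (+ 1)) refl n

    γ₀ : L
    γ₀ = proj₁ twistor

    k₀ : A
    k₀ = proj₁ (proj₂ twistor)

    -- Multiplication by γ₀²/N γ₀ = γ₀/γ̄₀, an element of norm 1 leading to the second class of the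
    -- same norm.
    twist : L → L
    twist α = scaleL k₀ (α · (γ₀ · γ₀))

    -- The list of representatives

    depressed cuspidal nodal : A → Pencil A
    depressed e = cub 0# e 0# 1# , cub 1# 0# 0# 0#
    cuspidal t = cub t 0# 0# 1# , cub 0# 1# 0# 0#
    nodal t = cub t 0# 1# 1# , cub 0# 1# 0# 0#

    odd : A → A → Pencil A
    odd e m = cub 0# e 0# 1# , cub m 0# 1# 0#

    units : List A
    units = proj₁ nonzero-list

    families : List (A → Pencil A)
    families = cuspidal ∷ nodal ∷ odd 1# ∷ odd n ∷ (λ y → twisted n 1# (representative y)) ∷
      (λ y → twisted n 1# (twist (representative y))) ∷ []

    sporadic : List (Pencil A)
    sporadic = depressed 0# ∷ depressed 1# ∷ depressed n ∷ twisted n 1# (0# , 0#) ∷ []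

    reps : List (Pencil A)
    reps = sporadic ++ List.concatMap (λ F → List.map F units) families

    length-reps : length reps ≡ 4 ℕ.+ 6 ℕ.* length units
    length-reps = ≡.cong (4 ℕ.+_) (length-families families units)

    Covered : Pencil A → Set (c ⊔ ℓ)
    Covered R = Any (Orbit R) reps

    infix 3 ⊢_
    ⊢_ : Pencil A → Set (c ⊔ ℓ)
    ⊢ R = ¬ Degenerate R → Covered R

    -- Coverage is pulled back along the move; nondegeneracy goes forward, since degeneracy of `S`
    -- would return to `R` along the inverse.
    via : ∀ {R S} → Orbit R S → ⊢ S → ⊢ R
    via o f nd = Any.map (Orbit-trans o) (f (λ d → nd (degenerate-orbit (Orbit-sym o) d)))

    rewrite-by : ∀ {R S} → R ≋₂ S → ⊢ S → ⊢ R
    rewrite-by e = via (Orbit-reflexive e)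

    member : ∀ {R S} → S ∈ reps → R ≋₂ S → Covered R
    member S∈ e = Any.map (λ { ≡.refl → Orbit-reflexive e }) S∈

    unit : ∀ t → t ≉ 0# → Σ A λ y → y ∈ units × t ≈ y
    unit = proj₂ (proj₂ nonzero-list)

    in-family : ∀ {F} y → y ∈ units → Any (λ G → F ≡ G) families → F y ∈ reps
    in-family {F} y y∈ F∈ = ∈-++⁺ʳ sporadic (∈-concatMap⁺ (λ F → List.map F units)
      (Any.map (λ { ≡.refl → ∈-map⁺ F y∈ }) F∈))

    zero-at-0 : ∀ p → eval p 0# 1# ≈ c₀ p
    zero-at-0 (cub p₀ p₁ p₂ p₃) = solve 4 (λ p₀ p₁ p₂ p₃ → Syn.eval (cub p₀ p₁ p₂ p₃) (con (+ 0)) (con (+ 1)) := p₀) refl p₀ p₁ p₂ p₃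

    commonZero-0 : ∀ {R} → c₀ (proj₁ R) ≈ 0# → c₀ (proj₂ R) ≈ 0# → Degenerate R
    commonZero-0 {g , h} e e′ = inj₁ (0# , 1# , inj₂ nontrivial , trans (zero-at-0 g) e , trans (zero-at-0 h) e′)

    zero-denominator : ∀ {g h} → h ≋ zeroC → Degenerate (g , h)
    zero-denominator (a , b , c , d) = inj₂ (inj₂ (0# , 1# , inj₂ nontrivial , z a , z b , z c , z d))
      where
      z : ∀ {x y} → y ≈ 0# → 0# * x + 1# * y ≈ 0#
      z e = drop-+ˡ (zeroˡ _) (kill-*ʳ 1# e)

    -- Polynomials and rational ramification points

    depressed-covered : ∀ p → ⊢ depressed p
    depressed-covered p nd with p ≟ 0#
    ... | yes p≈0 = member (here ≡.refl) ((refl , p≈0 , refl , refl) , ≋-refl)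
    ... | no p≉0 with square-classes n ¬sq p
    ...   | y , inj₁ p≈y² = rewrite-by ((refl , trans p≈y² (sym (*-identityˡ _)) , refl , refl) , ≋-refl)
              (via (rescale-depressed 1# y (λ y≈0 → p≉0 (trans p≈y² (kill-*ˡ y y≈0))))
              (λ _ → member (there (here ≡.refl)) (≋-refl , ≋-refl))) nd
    ...   | y , inj₂ p≈ny² = rewrite-by ((refl , p≈ny² , refl , refl) , ≋-refl)
              (via (rescale-depressed n y (λ y≈0 → p≉0 (trans p≈ny² (kill-*ʳ n (kill-*ˡ y y≈0)))))
              (λ _ → member (there (there (here ≡.refl))) (≋-refl , ≋-refl))) nd

    polynomial-covered : ∀ g h₀ → ⊢ g , cub h₀ 0# 0# 0#
    polynomial-covered g h₀ nd = via (complete-cube (c₀ g) (c₁ g) (c₂ g) (c₃ g) h₀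
      (λ e → nd (inj₁ (commonZero-∞ {g , cub h₀ 0# 0# 0#} e refl))) (λ e → nd (zero-denominator (e , refl , refl , refl))))
      (depressed-covered _) nd

    -- The constant term is a unit, as numerator and denominator would otherwise share the zero 0.
    -- Scaling x normalises t₂ when it is nonzero.
    monic-pole-covered : ∀ t₀ t₂ → ⊢ cub t₀ 0# t₂ 1# , cub 0# 1# 0# 0#
    monic-pole-covered t₀ t₂ nd with t₂ ≟ 0#
    ... | yes t₂≈0 = let y , y∈ , t≈y = unit t₀ (λ e → nd (commonZero-0 e refl)) in
      member (in-family y y∈ (here ≡.refl)) ((t≈y , refl , t₂≈0 , refl) , ≋-refl)
    ... | no t₂≉0 with divide t₀ (cube≉0 t₂≉0)
    ...   | t , t₀≈ = rewrite-by ((t₀≈ , refl , refl , refl) , ≋-refl) (via (rescale-nodal t t₂ t₂≉0) leaf) nd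
      where
      leaf : ⊢ nodal t
      leaf nd = let y , y∈ , t≈y = unit t (λ e → nd (commonZero-0 e refl)) in
        member (in-family y y∈ (there (here ≡.refl))) ((t≈y , refl , refl , refl) , ≋-refl)

    pole-covered : ∀ r s t → ⊢ cub r 0# s t , cub 0# 1# 0# 0#
    pole-covered r s t nd = rewrite-by ((r≈ , refl , s≈ , refl) , ≋-refl)
      (via (make-monic t₀ t₂ t t≉0) (monic-pole-covered t₀ t₂)) nd
      where
      t≉0 : t ≉ 0#
      t≉0 e = nd (inj₁ (commonZero-∞ {cub r 0# s t , cub 0# 1# 0# 0#} e refl))
      t₀ = proj₁ (divide r t≉0)
      r≈ = proj₂ (divide r t≉0)
      t₂ = proj₁ (divide s t≉0)
      s≈ = proj₂ (divide s t≉0)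

    -- A denominator of degree at most 1 says that ∞ is a critical point with value ∞; it is totally
    -- ramified exactly when the denominator is constant.
    ramified-covered : ∀ g h₀ h₁ → ⊢ g , cub h₀ h₁ 0# 0#
    ramified-covered g h₀ h₁ nd with h₁ ≟ 0#
    ... | yes h₁≈0 = rewrite-by (≋-refl , (refl , h₁≈0 , refl , refl)) (polynomial-covered g h₀) nd
    ... | no h₁≉0 = via (pole-at-0 g h₀ h₁ h₁≉0) (pole-covered _ _ _) nd

    -- Odd functions

    -- If f₂ or e₁ vanishes, ∞ or 0 is totally ramified and a polynomial results. Otherwise scaling
    -- x changes e₁/e₃ by squares, which normalises it to 1 or n and leaves m, nonzero because 0 is
    -- no common zero.
    odd-covered : ∀ e₁ e₃ f₀ f₂ → ⊢ cub 0# e₁ 0# e₃ , cub f₀ 0# f₂ 0#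
    odd-covered e₁ e₃ f₀ f₂ nd with f₂ ≟ 0# | e₁ ≟ 0#
    ... | yes f₂≈0 | _ = rewrite-by (≋-refl , (refl , refl , f₂≈0 , refl)) (polynomial-covered _ f₀) nd
    ... | no _ | yes e₁≈0 = rewrite-by ((refl , e₁≈0 , refl , refl) , ≋-refl) (via (invert e₃ f₀ f₂) (polynomial-covered _ e₃)) nd
    ... | no f₂≉0 | no e₁≉0 = by-class (square-classes n ¬sq r)
      where
      e₃≉0 : e₃ ≉ 0#
      e₃≉0 e = nd (inj₁ (commonZero-∞ {cub 0# e₁ 0# e₃ , cub f₀ 0# f₂ 0#} e refl))
      r = proj₁ (divide e₁ e₃≉0)
      e₁≈ = proj₂ (divide e₁ e₃≉0)
      r≉0 : r ≉ 0#
      r≉0 e = e₁≉0 (trans e₁≈ (kill-*ʳ e₃ e))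
      leaf : ∀ e → Any (λ G → odd e ≡ G) families → ∀ m → ⊢ odd e m
      leaf e e∈ m nd = let y , y∈ , m≈y = unit m (λ z → nd (commonZero-0 refl z)) in
        member (in-family y y∈ e∈) (≋-refl , (m≈y , refl , refl , refl))
      step : ∀ e → Any (λ G → odd e ≡ G) families → ∀ y → y ≉ 0# → r ≈ e * (y * y) →
             Covered (cub 0# e₁ 0# e₃ , cub f₀ 0# f₂ 0#)
      step e e∈ y y≉0 r≈ = rewrite-by
        ((refl , trans e₁≈ (*-congˡ r≈) , refl , refl) , (trans f₀≈ (*-congˡ f≈) , refl , refl , refl))
        (via (rescale-odd e m e₃ f₂ y e₃≉0 f₂≉0 y≉0) (leaf e e∈ m)) nd
        where
        f = proj₁ (divide f₀ f₂≉0)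
        f₀≈ = proj₂ (divide f₀ f₂≉0)
        m = proj₁ (divide f (y≉0 *≉0 y≉0))
        f≈ = proj₂ (divide f (y≉0 *≉0 y≉0))
      by-class : Σ A (λ y → r ≈ y * y ⊎ r ≈ n * (y * y)) → _
      by-class (y , inj₁ r≈) = step 1# (there (there (here ≡.refl))) y (λ e → r≉0 (trans r≈ (kill-*ˡ y e)))
        (trans r≈ (sym (*-identityˡ _)))
      by-class (y , inj₂ r≈) = step n (there (there (there (here ≡.refl)))) y (λ e → r≉0 (trans r≈ (kill-*ʳ n (kill-*ˡ y e)))) r≈

    -- Conjugate fixed points: classes modulo squares of norm 1

    twisted-cong : ∀ {ω ω′ α α′} → ω ≈ ω′ → α ≈L α′ → twisted n ω α ≋₂ twisted n ω′ α′
    twisted-cong ω (a , b) =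
      (-‿cong (*-congˡ (*-congˡ b)) , +-cong (*-congˡ (*-congʳ ω)) (-‿cong (*-congˡ a)) , *-congˡ b , +-cong ω a) ,
      (-‿cong (+-cong (*-congʳ ω) (*-congˡ a)) , -‿cong (*-congˡ b) , +-cong a (-‿cong (*-congˡ ω)) , b)

    -- For δ = γ + τ with τ² = N γ one has δ² = 2 (p + τ) γ and N δ = 2 τ (p + τ), where p is
    -- the first component of γ.
    rotate-by-square : ∀ α α′ γ τ → τ ≉ 0# → proj₁ γ + τ ≉ 0# → τ * τ ≈ N γ →
                       α · conj γ ≈L α′ · γ → Orbit (twisted n 1# α) (twisted n 1# α′)
    rotate-by-square α α′ γ@(p , r) τ τ≉0 p+τ≉0 τ²≈N rel =
      Orbit-trans (rotate n α δ Nδ≉0) (Orbit-trans (Orbit-reflexive (twisted-cong refl coefficient))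
        (normalise-twisted n (N δ * N δ) α′ (Nδ≉0 *≉0 Nδ≉0)))
      where
      δ : L
      δ = p + τ , r
      k : A
      k = # 2 * (p + τ)
      defect : N γ - τ * τ ≈ 0#
      defect = ≈⇒-≈0 (sym τ²≈N)
      N-δ : ∀ p r τ → N (p + τ , r) ≈ (# 2 * (p + τ)) * τ + 1# * (N (p , r) - τ * τ)
      N-δ p r τ = solve 4 (λ n p r τ → Syn.norm n (p :+ τ , r) :=
        (con (+ 2) :* (p :+ τ)) :* τ :+ con (+ 1) :* (Syn.norm n (p , r) :- τ :* τ)) refl n p r τ
      Nδ≈ : N δ ≈ k * τ
      Nδ≈ = drop _ defect (N-δ p r τ)
      Nδ≉0 : N δ ≉ 0#
      Nδ≉0 = ≉0-resp (sym Nδ≈) ((2≉0 *≉0 p+τ≉0) *≉0 τ≉0)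
      square₀ : ∀ p r τ → (p + τ) * (p + τ) + n * (- r * - r) ≈ (# 2 * (p + τ)) * p + (- 1#) * (N (p , r) - τ * τ)
      square₀ p r τ = solve 4 (λ n p r τ → (p :+ τ) :* (p :+ τ) :+ n :* (:- r :* :- r) :=
        (con (+ 2) :* (p :+ τ)) :* p :+ (:- con (+ 1)) :* (Syn.norm n (p , r) :- τ :* τ)) refl n p r τ
      square₁ : ∀ p r τ → (p + τ) * - r + - r * (p + τ) ≈ (# 2 * (p + τ)) * - r
      square₁ = solve 3 (λ p r τ → (p :+ τ) :* :- r :+ :- r :* (p :+ τ) := (con (+ 2) :* (p :+ τ)) :* :- r) refl
      δ̄² : conj δ · conj δ ≈L scaleL k (conj γ)
      δ̄² = drop _ defect (square₀ p r τ) , square₁ p r τ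
      regroup : ∀ k α γ̄ → α · (scaleL k γ̄ · scaleL k γ̄) ≈L scaleL (k * k) ((α · γ̄) · γ̄)
      regroup k (a₀ , a₁) (g₀ , g₁) =
        solve 6 (λ n k a₀ a₁ g₀ g₁ → let α = a₀ , a₁ ; γ = g₀ , g₁ in
          proj₁ (Syn.mulL n α (Syn.mulL n (Syn.scaleL k γ) (Syn.scaleL k γ))) :=
          proj₁ (Syn.scaleL (k :* k) (Syn.mulL n (Syn.mulL n α γ) γ))) refl n k a₀ a₁ g₀ g₁ ,
        solve 6 (λ n k a₀ a₁ g₀ g₁ → let α = a₀ , a₁ ; γ = g₀ , g₁ in
          proj₂ (Syn.mulL n α (Syn.mulL n (Syn.scaleL k γ) (Syn.scaleL k γ))) :=
          proj₂ (Syn.scaleL (k :* k) (Syn.mulL n (Syn.mulL n α γ) γ))) refl n k a₀ a₁ g₀ g₁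
      collapse : ∀ k α γ → scaleL k ((α · γ) · conj γ) ≈L scaleL (k * N γ) α
      collapse k (a₀ , a₁) (g₀ , g₁) =
        solve 6 (λ n k a₀ a₁ g₀ g₁ → let α = a₀ , a₁ ; γ = g₀ , g₁ in
          proj₁ (Syn.scaleL k (Syn.mulL n (Syn.mulL n α γ) (Syn.conj γ))) :=
          proj₁ (Syn.scaleL (k :* Syn.norm n γ) α)) refl n k a₀ a₁ g₀ g₁ ,
        solve 6 (λ n k a₀ a₁ g₀ g₁ → let α = a₀ , a₁ ; γ = g₀ , g₁ in
          proj₂ (Syn.scaleL k (Syn.mulL n (Syn.mulL n α γ) (Syn.conj γ))) :=
          proj₂ (Syn.scaleL (k :* Syn.norm n γ) α)) refl n k a₀ a₁ g₀ g₁
      factors : k * k * N γ ≈ N δ * N δ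
      factors = trans (*-congˡ (sym τ²≈N)) (trans (solve 2 (λ k τ → k :* k :* (τ :* τ) := (k :* τ) :* (k :* τ)) refl k τ)
        (sym (*-cong Nδ≈ Nδ≈)))
      coefficient : α · ((conj δ · conj δ) · (conj δ · conj δ)) ≈L scaleL (N δ * N δ) α′
      coefficient = ≈L-trans (·-cong {α} {α} (refl , refl) (·-cong δ̄² δ̄²)) (≈L-trans (regroup k α (conj γ))
        (≈L-trans (scaleL-cong refl (·-cong rel (refl , refl))) (≈L-trans (collapse (k * k) α′ γ)
          (scaleL-cong factors (refl , refl)))))

    -- Both roots ±t of N γ can serve as τ. With p the first component of γ, p + t and p - t differ
    -- by 2t ≠ 0, so one of them is nonzero.
    rotate-orbit : ∀ α α′ γ → N γ ≉ 0# → Square (N γ) → α · conj γ ≈L α′ · γ →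
                   Orbit (twisted n 1# α) (twisted n 1# α′)
    rotate-orbit α α′ γ Nγ≉0 (t , t²≈N) rel = by-sign (proj₁ γ + t ≟ 0#)
      where
      t≉0 : t ≉ 0#
      t≉0 e = Nγ≉0 (trans (sym t²≈N) (kill-*ˡ t e))
      sum-difference : ∀ p t → # 2 * t ≈ (0# + 1# * (p + t)) + (- 1#) * (p + - t)
      sum-difference = solve 2 (λ p t → con (+ 2) :* t :=
        (con (+ 0) :+ con (+ 1) :* (p :+ t)) :+ (:- con (+ 1)) :* (p :+ :- t)) refl
      by-sign : Dec (proj₁ γ + t ≈ 0#) → Orbit (twisted n 1# α) (twisted n 1# α′)
      by-sign (no p+t≉0)  = rotate-by-square α α′ γ t t≉0 p+t≉0 t²≈N rel
      by-sign (yes p+t≈0) = rotate-by-square α α′ γ (- t) (-≉0 t≉0)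
        (λ e → (2≉0 *≉0 t≉0) (drop _ p+t≈0 (drop _ e (sum-difference (proj₁ γ) t))))
        (trans (solve 1 (λ t → :- t :* :- t := t :* t) refl t) t²≈N) rel

    shifted-norm : L → L → L
    shifted-norm α α′ = N α + proj₁ (α · conj α′) , proj₂ (α · conj α′)

    private
      γₛ : ∀ {m} → (n a b a′ b′ : Polynomial m) → Polynomial m × Polynomial m
      γₛ n a b a′ b′ = let β = Syn.mulL n (a , b) (Syn.conj (a′ , b′)) in Syn.norm n (a , b) :+ proj₁ β , proj₂ β

    N-shifted-norm : ∀ a b a′ b′ → N (shifted-norm (a , b) (a′ , b′)) ≈ N (a , b) * N (a + a′ , b + b′)
    N-shifted-norm a b a′ b′ = solve 5 (λ n a b a′ b′ →
      Syn.norm n (γₛ n a b a′ b′) := Syn.norm n (a , b) :* Syn.norm n (a :+ a′ , b :+ b′)) refl n a b a′ b′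

    shifted-norm₀ : ∀ a b a′ b′ → let γ = shifted-norm (a , b) (a′ , b′) in
      proj₁ ((a , b) · conj γ) ≈ proj₁ ((a′ , b′) · γ) + a * (N (a , b) - N (a′ , b′))
    shifted-norm₀ a b a′ b′ = solve 5 (λ n a b a′ b′ → let γ = γₛ n a b a′ b′ in
      proj₁ (Syn.mulL n (a , b) (Syn.conj γ)) :=
      proj₁ (Syn.mulL n (a′ , b′) γ) :+ a :* (Syn.norm n (a , b) :- Syn.norm n (a′ , b′))) refl n a b a′ b′

    shifted-norm₁ : ∀ a b a′ b′ → let γ = shifted-norm (a , b) (a′ , b′) in
      proj₂ ((a , b) · conj γ) ≈ proj₂ ((a′ , b′) · γ) + b * (N (a , b) - N (a′ , b′))
    shifted-norm₁ a b a′ b′ = solve 5 (λ n a b a′ b′ → let γ = γₛ n a b a′ b′ in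
      proj₂ (Syn.mulL n (a , b) (Syn.conj γ)) :=
      proj₂ (Syn.mulL n (a′ , b′) γ) :+ b :* (Syn.norm n (a , b) :- Syn.norm n (a′ , b′))) refl n a b a′ b′

    -- Hilbert 90 for α/α′, with γ = α (conj α + conj α′), or γ = ν when α′ = − α.
    quotient-of-conjugates : ∀ α α′ → N α ≉ 0# → N α ≈ N α′ → Σ L λ γ → N γ ≉ 0# × α · conj γ ≈L α′ · γ
    quotient-of-conjugates α@(a , b) α′@(a′ , b′) Nα≉0 N≈N′ = by-sum (N (a + a′ , b + b′) ≟ 0#)
      where
      norm-ν : N (0# , 1#) ≈ - n
      norm-ν = solve 1 (λ n → Syn.norm n (con (+ 0) , con (+ 1)) := :- n) refl n
      times-ν₀ : ∀ a b a′ b′ → proj₁ ((a , b) · conj (0# , 1#)) ≈ proj₁ ((a′ , b′) · (0# , 1#)) + (- n) * (b + b′)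
      times-ν₀ a b a′ b′ = solve 5 (λ n a b a′ b′ → let ν = con (+ 0) , con (+ 1) in
        proj₁ (Syn.mulL n (a , b) (Syn.conj ν)) := proj₁ (Syn.mulL n (a′ , b′) ν) :+ (:- n) :* (b :+ b′)) refl n a b a′ b′
      times-ν₁ : ∀ a b a′ b′ → proj₂ ((a , b) · conj (0# , 1#)) ≈ proj₂ ((a′ , b′) · (0# , 1#)) + (- 1#) * (a + a′)
      times-ν₁ a b a′ b′ = solve 5 (λ n a b a′ b′ → let ν = con (+ 0) , con (+ 1) in
        proj₂ (Syn.mulL n (a , b) (Syn.conj ν)) := proj₂ (Syn.mulL n (a′ , b′) ν) :+ (:- con (+ 1)) :* (a :+ a′)) refl n a b a′ b′
      by-sum : Dec (N (a + a′ , b + b′) ≈ 0#) → Σ L λ γ → N γ ≉ 0# × α · conj γ ≈L α′ · γ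
      by-sum (no sum≉0) = shifted-norm α α′ , ≉0-resp (sym (N-shifted-norm a b a′ b′)) (Nα≉0 *≉0 sum≉0) ,
        drop _ (≈⇒-≈0 N≈N′) (shifted-norm₀ a b a′ b′) , drop _ (≈⇒-≈0 N≈N′) (shifted-norm₁ a b a′ b′)
      by-sum (yes sum≈0) = let a≈ , b≈ = anisotropic _ sum≈0 in
        (0# , 1#) , ≉0-resp (sym norm-ν) (-≉0 n≉0) , drop _ b≈ (times-ν₀ a b a′ b′) , drop _ a≈ (times-ν₁ a b a′ b′)

    nonsquare-product : ∀ {x y} → ¬ Square x → ¬ Square y → Square (x * y)
    nonsquare-product {x} {y} ¬x ¬y = by-classes (square-classes n ¬sq x) (square-classes n ¬sq y)
      where
      by-classes : Σ A (λ z → x ≈ z * z ⊎ x ≈ n * (z * z)) → Σ A (λ w → y ≈ w * w ⊎ y ≈ n * (w * w)) → Square (x * y)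
      by-classes (z , inj₁ e) _ = contradiction (z , sym e) ¬x
      by-classes (z , inj₂ _) (w , inj₁ e) = contradiction (w , sym e) ¬y
      by-classes (z , inj₂ e) (w , inj₂ e′) = n * z * w , trans
        (solve 3 (λ n z w → (n :* z :* w) :* (n :* z :* w) := (n :* (z :* z)) :* (n :* (w :* w))) refl n z w)
        (sym (*-cong e e′))

    N-· : ∀ α β → N (α · β) ≈ N α * N β
    N-· (a , b) (a′ , b′) = solve 5 (λ n a b a′ b′ →
      Syn.norm n (Syn.mulL n (a , b) (a′ , b′)) := Syn.norm n (a , b) :* Syn.norm n (a′ , b′)) refl n a b a′ b′

    N-conj : ∀ α → N (conj α) ≈ N α
    N-conj (a , b) = solve 3 (λ n a b → Syn.norm n (Syn.conj (a , b)) := Syn.norm n (a , b)) refl n a b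

    -- Dividing α/α′ = γ/γ̄ by γ₀/γ̄₀ replaces γ by γ γ̄₀, whose norm is N γ · N γ₀.
    twist-relation : ∀ α α′ γ → α · conj γ ≈L α′ · γ → α · conj (γ · conj γ₀) ≈L twist α′ · (γ · conj γ₀)
    twist-relation α α′ γ rel = ≈L-trans (left α γ γ₀) (≈L-trans (·-cong rel (refl , refl))
      (≈L-trans (≈L-sym (one-times _)) (≈L-trans (scaleL-cong (sym (proj₁ (proj₂ (proj₂ twistor)))) (refl , refl))
        (≈L-sym (right k₀ α′ γ γ₀)))))
      where
      one-times : ∀ x → scaleL 1# x ≈L x
      one-times (x , y) = *-identityˡ x , *-identityˡ y
      left : ∀ α γ δ → α · conj (γ · conj δ) ≈L (α · conj γ) · δ
      left (a , b) (p , r) (s , t) =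
        solve 7 (λ n a b p r s t → let α = a , b ; γ = p , r ; δ = s , t in
          proj₁ (Syn.mulL n α (Syn.conj (Syn.mulL n γ (Syn.conj δ)))) :=
          proj₁ (Syn.mulL n (Syn.mulL n α (Syn.conj γ)) δ)) refl n a b p r s t ,
        solve 7 (λ n a b p r s t → let α = a , b ; γ = p , r ; δ = s , t in
          proj₂ (Syn.mulL n α (Syn.conj (Syn.mulL n γ (Syn.conj δ)))) :=
          proj₂ (Syn.mulL n (Syn.mulL n α (Syn.conj γ)) δ)) refl n a b p r s t
      right : ∀ k α γ δ → scaleL k (α · (δ · δ)) · (γ · conj δ) ≈L scaleL (N δ * k) ((α · γ) · δ)
      right k (a , b) (p , r) (s , t) =
        solve 8 (λ n k a b p r s t → let α = a , b ; γ = p , r ; δ = s , t in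
          proj₁ (Syn.mulL n (Syn.scaleL k (Syn.mulL n α (Syn.mulL n δ δ))) (Syn.mulL n γ (Syn.conj δ))) :=
          proj₁ (Syn.scaleL (Syn.norm n δ :* k) (Syn.mulL n (Syn.mulL n α γ) δ))) refl n k a b p r s t ,
        solve 8 (λ n k a b p r s t → let α = a , b ; γ = p , r ; δ = s , t in
          proj₂ (Syn.mulL n (Syn.scaleL k (Syn.mulL n α (Syn.mulL n δ δ))) (Syn.mulL n γ (Syn.conj δ))) :=
          proj₂ (Syn.scaleL (Syn.norm n δ :* k) (Syn.mulL n (Syn.mulL n α γ) δ))) refl n k a b p r s t

    -- Here α differs from the chosen element of its norm by γ/γ̄ = γ²/N γ, the square of an element
    -- of norm 1 if N γ is a square. Otherwise twisting turns N γ into a product of two nonsquares.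
    twisted-covered : ∀ α → ⊢ twisted n 1# α
    twisted-covered α nd with N α ≟ 0#
    ... | yes Nα≈0 = member (there (there (there (here ≡.refl)))) (twisted-cong refl (anisotropic α Nα≈0))
    ... | no Nα≉0 = by-square (square? (N γ))
      where
      y = proj₁ (unit (N α) Nα≉0)
      y∈ = proj₁ (proj₂ (unit (N α) Nα≉0))
      Nα≈y = proj₂ (proj₂ (unit (N α) Nα≉0))
      α′ : L
      α′ = representative y
      quotient = quotient-of-conjugates α α′ Nα≉0 (trans Nα≈y (sym (N-representative α Nα≈y)))
      γ = proj₁ quotient
      Nγ≉0 = proj₁ (proj₂ quotient)
      rel = proj₂ (proj₂ quotient)
      first : Any (λ G → (λ y → twisted n 1# (representative y)) ≡ G) families
      first = there (there (there (there (here ≡.refl))))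
      second : Any (λ G → (λ y → twisted n 1# (twist (representative y))) ≡ G) families
      second = there (there (there (there (there (here ≡.refl)))))
      by-square : Dec (Square (N γ)) → Covered (twisted n 1# α)
      by-square (yes sq) = via (rotate-orbit α α′ γ Nγ≉0 sq rel)
        (λ _ → member (in-family y y∈ first) (≋-refl , ≋-refl)) nd
      by-square (no ¬sqγ) = via (rotate-orbit α (twist α′) (γ · conj γ₀) (≉0-resp (sym N≈) (Nγ≉0 *≉0 Nγ₀≉0))
          (let t , e = nonsquare-product ¬sqγ ¬sqγ₀ in t , trans e (sym N≈)) (twist-relation α α′ γ rel))
        (λ _ → member (in-family y y∈ second) (≋-refl , ≋-refl)) nd
        where
        ¬sqγ₀ : ¬ Square (N γ₀)
        ¬sqγ₀ = proj₂ (proj₂ (proj₂ twistor)) γ ¬sqγ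
        Nγ₀≉0 : N γ₀ ≉ 0#
        Nγ₀≉0 e = ¬sqγ₀ (0# , trans (zeroˡ 0#) (sym e))
        N≈ : N (γ · conj γ₀) ≈ N γ * N γ₀
        N≈ = trans (N-· γ (conj γ₀)) (*-congˡ (N-conj γ₀))

    -- Reduction of a general pencil to the normal forms

    symmetric-cong : ∀ {s s′ l l′ m m′} → s ≈ s′ → l ≈ l′ → m ≈ m′ → symmetric s l m ≋₂ symmetric s′ l′ m′
    symmetric-cong s l m = (refl , *-cong m m , *-congˡ (*-cong s m) , l) , (l , *-congˡ s , refl , refl)

    symmetric-covered : ∀ s l → ⊢ symmetric s l n
    symmetric-covered s l nd = by-norm (N ε ≟ 0#)
      where
      ε φ : L
      ε = l + n , - (# 2 * s)
      φ = # 3 * l - n , # 2 * s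
      by-norm : Dec (N ε ≈ 0#) → Covered (symmetric s l n)
      -- Here ε = 0, that is s = 0 and l = -n, and x² - n divides both forms.
      by-norm (yes Nε≈0) = contradiction (inj₂ (inj₁ ((- n , 0# , 1#) , (0# , - n) , (1# , 0#) ,
          ≋₂-trans (symmetric-cong s≈0 l≈-n refl) factored))) nd
        where
        s≈0 : s ≈ 0#
        s≈0 = *-cancel-0 2≉0 (trans (sym (-‿involutive _)) (trans (-‿cong (proj₂ (anisotropic ε Nε≈0))) -0#≈0#))
        l≈-n : l ≈ - n
        l≈-n = -≈0⇒≈ (trans (+-congˡ (-‿involutive n)) (proj₁ (anisotropic ε Nε≈0)))
        factored : symmetric 0# (- n) n ≋₂ (mulQL (- n , 0# , 1#) (0# , - n) , mulQL (- n , 0# , 1#) (1# , 0#))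
        factored = solveP 1 (λ n → let o = con (+ 0) ; i = con (+ 1) ; d = :- n , o , i in
          Syn.symmetric o (:- n) n , (Syn.mulQL d (o , :- n) , Syn.mulQL d (i , o))) (n ∷ []) ≡.refl ≡.refl
      by-norm (no Nε≉0) = via (symmetric-twisted s l n n≉0 Nε≉0)
        (rewrite-by (twisted-cong refl (proj₂ (divide _ Nε≉0) , proj₂ (divide _ Nε≉0)))
          (via (normalise-twisted n (N ε) _ Nε≉0) (twisted-covered _))) nd

    reduced-cong : ∀ {a a′ b b′ m m′} → a ≈ a′ → b ≈ b′ → m ≈ m′ → reduced a b m ≋₂ reduced a′ b′ m′
    reduced-cong a b m = (b , a , refl , refl) , (-‿cong m , refl , refl , refl)

    -- With r moved to ∞ and its value made ∞, the coefficient of x² in the new denominator is the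
    -- Wronskian at r.
    critical-covered : ∀ a b m r → wronskian a b m r ≈ 0# → ⊢ reduced a b m
    critical-covered a b m r W≈0 nd = by-value (c₃ H ≟ 0#) (c₃ G ≟ 0#)
      where
      M : Mat A
      M = mat r 1# 1# 0#
      G H : Cub A
      G = subst M (proj₁ (reduced a b m))
      H = subst M (proj₂ (reduced a b m))
      value : ∀ p → eval p r 1# ≈ c₃ (subst M p)
      value (cub p₀ p₁ p₂ p₃) = solve 5 (λ r p₀ p₁ p₂ p₃ → let i = con (+ 1) ; p = cub p₀ p₁ p₂ p₃ in
        Syn.eval p r i := c₃ (Syn.subst (mat r i i (con (+ 0))) p)) refl r p₀ p₁ p₂ p₃
      double : ∀ a b m r → let M = mat r 1# 1# 0# ; G = subst M (proj₁ (reduced a b m)) ; H = subst M (proj₂ (reduced a b m)) in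
        c₂ (comb (c₃ H) (- c₃ G) G H) ≈ wronskian a b m r
      double = solve 4 (λ a b m r → let i = con (+ 1) ; M = mat r i i (con (+ 0)) ; R = Syn.reduced a b m
                                        G = Syn.subst M (proj₁ R) ; H = Syn.subst M (proj₂ R) in
        c₂ (Syn.comb (c₃ H) (:- c₃ G) G H) := Syn.wronskian a b m r) refl
      cancel : ∀ x y → x * y + - y * x ≈ 0#
      cancel = solve 2 (λ x y → x :* y :+ :- y :* x := con (+ 0)) refl
      finish : ∀ g → ⊢ g , comb (c₃ H) (- c₃ G) G H
      finish g = rewrite-by (≋-refl , (refl , refl , trans (double a b m r) W≈0 , cancel (c₃ H) (c₃ G)))
        (ramified-covered g _ _)
      by-value : Dec (c₃ H ≈ 0#) → Dec (c₃ G ≈ 0#) → Covered (reduced a b m)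
      by-value (no H₃≉0) _ = via (move-to-∞₁ r _ _ H₃≉0) (finish H) nd
      by-value (yes _) (no G₃≉0) = via (move-to-∞₂ r _ _ G₃≉0) (finish G) nd
      by-value (yes H₃≈0) (yes G₃≈0) = contradiction (inj₁ (r , 1# , inj₂ nontrivial ,
        trans (value (proj₁ (reduced a b m))) G₃≈0 , trans (value (proj₂ (reduced a b m))) H₃≈0)) nd

    -- A root u of the resolvent and s = b/slope provide the involution
    -- x ↦ s + (s² − u)/(x − s) of the four critical points.
    involution-covered : ∀ a m u s → let κ = slope a m u in
      u * u + a * m + κ * (s * s) ≈ 0# → s * s - u ≉ 0# → ⊢ reduced a (κ * s) m
    involution-covered a m u s E≈0 j≉0 = by-pole (l ≟ 0#)
      where
      κ j l : A
      κ = slope a m u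
      j = s * s - u
      l = s * s - m
      E : A → A → A → A → A
      E a m u s = u * u + a * m + slope a m u * (s * s)
      Eₛ : ∀ {k} → (a m u s : Polynomial k) → Polynomial k
      Eₛ a m u s = u :* u :+ a :* m :+ Syn.slope a m u :* (s :* s)

      -- The fixed points are s ± √j, so the square class of j decides whether they are rational or
      -- conjugate.
      by-class : l ≉ 0# → Σ A (λ y → j ≈ y * y ⊎ j ≈ n * (y * y)) → ⊢ symmetric s l j
      by-class _ (y , inj₁ j≈) = rewrite-by (symmetric-cong refl refl j≈)
        (via (symmetric-odd s l y (λ e → j≉0 (trans j≈ (kill-*ˡ y e)))) (odd-covered _ _ _ _))
      by-class _ (y , inj₂ j≈) = rewrite-by
        (symmetric-cong (proj₂ (divide s y≉0)) (proj₂ (divide l (y≉0 *≉0 y≉0))) j≈)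
        (via (rescale-symmetric _ _ n y y≉0) (symmetric-covered _ _))
        where
        y≉0 : y ≉ 0#
        y≉0 e = j≉0 (trans j≈ (kill-*ʳ n (kill-*ˡ y e)))

      -- E = 0 makes this coefficient j², so the numerator is the transform of the denominator under
      -- the involution.
      linear-term : ∀ a m u s → let j = s * s - u ; l = s * s - m ; k = # 2 * (s * j) - # 3 * (s * l) in
        l * (# 3 * (s * s) + a) + # 2 * (s * k) ≈ j * j + (- 1#) * E a m u s
      linear-term = solve 4 (λ a m u s → let j = s :* s :- u ; l = s :* s :- m ; k = con (+ 2) :* (s :* j) :- con (+ 3) :* (s :* l) in
        l :* (con (+ 3) :* (s :* s) :+ a) :+ con (+ 2) :* (s :* k) := j :* j :+ (:- con (+ 1)) :* Eₛ a m u s) refl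

      -- If s is a pole, the denominator does not yield a second member of the pencil. Instead E = 0
      -- and j ≠ 0 force u = -3 s², so j = (2s)² and the fixed points are rational.
      double-pole : ∀ a m u s → (s * s - u) * (u + # 3 * (s * s)) ≈ (0# + (- 1#) * E a m u s) + (# 3 * (s * s) - a) * (s * s - m)
      double-pole = solve 4 (λ a m u s → (s :* s :- u) :* (u :+ con (+ 3) :* (s :* s)) :=
        (con (+ 0) :+ (:- con (+ 1)) :* Eₛ a m u s) :+ (con (+ 3) :* (s :* s) :- a) :* (s :* s :- m)) refl

      slope-at-pole : ∀ a m u s → slope a m u ≈
        (- (# 9 * (s * s) + a) + # 2 * (u + # 3 * (s * s))) + # 3 * (s * s - m)
      slope-at-pole = solve 4 (λ a m u s → Syn.slope a m u :=
        (:- (con (+ 9) :* (s :* s) :+ a) :+ con (+ 2) :* (u :+ con (+ 3) :* (s :* s))) :+ con (+ 3) :* (s :* s :- m)) refl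

      j-at-pole : ∀ u s → s * s - u ≈ (0# + (# 2 * # 2 * s) * s) + (- 1#) * (u + # 3 * (s * s))
      j-at-pole = solve 2 (λ u s → s :* s :- u :=
        (con (+ 0) :+ (con (+ 2) :* con (+ 2) :* s) :* s) :+ (:- con (+ 1)) :* (u :+ con (+ 3) :* (s :* s))) refl

      by-pole : Dec (l ≈ 0#) → ⊢ reduced a (κ * s) m
      by-pole (no l≉0) = via (reduced-symmetric a m u s l≉0)
        (rewrite-by ((refl , drop _ E≈0 (linear-term a m u s) , refl , refl) , ≋-refl)
          (by-class l≉0 (square-classes n ¬sq j)))
      by-pole (yes l≈0) = rewrite-by (reduced-cong refl (*-congʳ κ≈) (sym (-≈0⇒≈ l≈0)))
        (via (reduced-odd a s s≉0) (odd-covered _ _ _ _))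
        where
        u+3s²≈0 : u + # 3 * (s * s) ≈ 0#
        u+3s²≈0 = *-cancel-0 j≉0 (drop _ E≈0 (drop _ l≈0 (double-pole a m u s)))
        κ≈ : κ ≈ - (# 9 * (s * s) + a)
        κ≈ = drop _ u+3s²≈0 (drop _ l≈0 (slope-at-pole a m u s))
        s≉0 : s ≉ 0#
        s≉0 s≈0 = j≉0 (drop _ s≈0 (drop _ u+3s²≈0 (j-at-pole u s)))

    reduced-covered : ∀ a b m → ⊢ reduced a b m
    reduced-covered a b m nd = by-critical (any? (λ r → wronskian a b m r ≟ 0#) (λ e → trans (sym (W-cong e))))
      where
      W-cong : ∀ {x y} → x ≈ y → wronskian a b m x ≈ wronskian a b m y
      W-cong e = +-congʳ (+-cong (+-cong (*-cong (*-cong e e) (*-cong e e)) (-‿cong (*-congˡ (*-cong e e)))) (-‿cong (*-congˡ (*-congˡ e))))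

      resolvent-split : ∀ a b m u s → slope a m u * (u * u + a * m + slope a m u * (s * s)) ≈
        (0# + 1# * resolvent a b m u) + (- (b + slope a m u * s)) * (b - slope a m u * s)
      resolvent-split = solve 5 (λ a b m u s → let κ = Syn.slope a m u in
        κ :* (u :* u :+ a :* m :+ κ :* (s :* s)) :=
        (con (+ 0) :+ con (+ 1) :* Syn.resolvent a b m u) :+ (:- (b :+ κ :* s)) :* (b :- κ :* s)) refl

      -- Ferrari's decomposition at x = s: the second square disappears and W(s) = j², so j = 0
      -- would make s a rational critical point.
      wronskian-at-s : ∀ a b m u s → let κ = slope a m u ; j = s * s - u in wronskian a b m s ≈
        ((0# + j * j) + (- 1#) * (u * u + a * m + κ * (s * s))) + (- (# 2 * s)) * (b - κ * s)
      wronskian-at-s = solve 5 (λ a b m u s → let κ = Syn.slope a m u ; j = s :* s :- u in Syn.wronskian a b m s :=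
        ((con (+ 0) :+ j :* j) :+ (:- con (+ 1)) :* (u :* u :+ a :* m :+ κ :* (s :* s))) :+ (:- (con (+ 2) :* s)) :* (b :- κ :* s)) refl

      slope≉0 : ∀ u → b ≉ 0# → resolvent a b m u ≈ 0# → slope a m u ≉ 0#
      slope≉0 u b≉0 f≈0 κ≈0 = (b≉0 *≉0 b≉0) (trans (sym (drop-+ʳ refl (kill-*ˡ _ κ≈0))) f≈0)

      from-root : (∀ r → wronskian a b m r ≉ 0#) → b ≉ 0# → Σ A (λ u → resolvent a b m u ≈ 0#) → Covered (reduced a b m)
      from-root W≉0 b≉0 (u , f≈0) = rewrite-by (reduced-cong refl b≈κs refl) (involution-covered a m u s E≈0 j≉0) nd
        where
        κ≉0 = slope≉0 u b≉0 f≈0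
        s = proj₁ (divide b κ≉0)
        b≈κs = proj₂ (divide b κ≉0)
        E≈0 : u * u + a * m + slope a m u * (s * s) ≈ 0#
        E≈0 = *-cancel-0 κ≉0 (drop _ f≈0 (drop _ (≈⇒-≈0 b≈κs) (resolvent-split a b m u s)))
        j≉0 : s * s - u ≉ 0#
        j≉0 j≈0 = W≉0 s (drop _ j≈0 (drop _ E≈0 (drop _ (≈⇒-≈0 b≈κs) (wronskian-at-s a b m u s))))

      by-critical : Dec (Σ A λ r → wronskian a b m r ≈ 0#) → Covered (reduced a b m)
      by-critical (yes (r , W≈0)) = critical-covered a b m r W≈0 nd
      by-critical (no none) = by-b (b ≟ 0#)
        where
        by-b : Dec (b ≈ 0#) → Covered (reduced a b m)
        by-b (yes b≈0) = rewrite-by (reduced-cong refl b≈0 refl) (odd-covered a 1# (- m) 1#) nd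
        by-b (no b≉0)  = from-root (λ r e → none (r , e)) b≉0
          (Count.resolvent-root a b m b≉0 (λ r e → none (r , e)))

    centred-covered : ∀ p₀ p₁ p₃ h₀ k → k ≉ 0# → ⊢ cub p₀ p₁ 0# p₃ , cub h₀ 0# k 0#
    centred-covered p₀ p₁ p₃ h₀ k k≉0 nd = rewrite-by
      ((proj₂ (divide p₀ p₃≉0) , proj₂ (divide p₁ p₃≉0) , refl , refl) ,
       (trans (proj₂ (divide h₀ k≉0)) (*-congˡ (sym (-‿involutive _))) , refl , refl , refl))
      (via (normalise-reduced _ _ (- proj₁ (divide h₀ k≉0)) p₃ k p₃≉0 k≉0) (reduced-covered _ _ _)) nd
      where
      p₃≉0 : p₃ ≉ 0#
      p₃≉0 e = nd (inj₁ (commonZero-∞ {cub p₀ p₁ 0# p₃ , cub h₀ 0# k 0#} e refl))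

    fixing-∞-covered : ∀ g h₀ h₁ h₂ → ⊢ g , cub h₀ h₁ h₂ 0#
    fixing-∞-covered g h₀ h₁ h₂ = by-degree₂ (h₂ ≟ 0#)
      where
      by-degree₂ : Dec (h₂ ≈ 0#) → ⊢ g , cub h₀ h₁ h₂ 0#
      by-degree₂ (yes h₂≈0) = rewrite-by (≋-refl , (refl , refl , h₂≈0 , refl)) (ramified-covered g h₀ h₁)
      by-degree₂ (no h₂≉0)  = via (complete-square g h₀ h₁ h₂ h₂≉0)
        (centred-covered _ _ _ _ _ (2≉0 *≉0 (h₂≉0 *≉0 h₂≉0)))

    all-covered : ∀ R → ⊢ R
    all-covered (g , h) = by-degree₃ (c₃ h ≟ 0#)
      where
      cancel : ∀ x y → x * y + - y * x ≈ 0#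
      cancel = solve 2 (λ x y → x :* y :+ :- y :* x := con (+ 0)) refl
      by-degree₃ : Dec (c₃ h ≈ 0#) → ⊢ g , h
      by-degree₃ (yes h₃≈0) = rewrite-by (≋-refl , (refl , refl , refl , h₃≈0)) (fixing-∞-covered g _ _ _)
      by-degree₃ (no h₃≉0)  = via (lower-degree g h h₃≉0)
        (rewrite-by (≋-refl , (refl , refl , refl , cancel (c₃ h) (c₃ g))) (fixing-∞-covered h _ _ _))

  -- The list of classes and its length

  open Reps (proj₁ a-nonsquare) (proj₂ a-nonsquare)

  nondegenerate? : ∀ R → Dec (¬ Degenerate R)
  nondegenerate? R = ¬? (degenerate? R)

  classes : List (Poly.RatExpr K)
  -- Some parameters are degenerate: in `odd e m` with m = e the factor x² + e cancels.
  classes = List.map ratExpr (List.filter nondegenerate? reps)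

  length-classes : length classes ℕ.≤ 6 ℕ.* q ℕ.∸ 2
  length-classes = begin
    length classes                           ≡⟨ ListP.length-map ratExpr (List.filter nondegenerate? reps) ⟩
    length (List.filter nondegenerate? reps) ≤⟨ ListP.length-filter nondegenerate? reps ⟩
    length reps                              ≡⟨ length-reps ⟩
    -- Four sporadic entries and six families over the q - 1 units: 4 + 6 (q - 1) = 6 q - 2.
    4 ℕ.+ 6 ℕ.* length units                 ≡⟨ ≡.cong (ℕ._∸ 2) (≡.sym (ℕP.*-suc 6 (length units))) ⟩
    6 ℕ.* suc (length units) ℕ.∸ 2           ≡⟨ ≡.cong (λ k → 6 ℕ.* k ℕ.∸ 2) (proj₁ (proj₂ nonzero-list)) ⟩
    6 ℕ.* q ℕ.∸ 2                            ∎
    where open ℕP.≤-Reasoning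

  classes-cubic : All (Poly.Cubic K) classes
  classes-cubic = AllP.map⁺ (All.map (λ {R} → nondegenerate⇒cubic R) (AllP.all-filter nondegenerate? reps))

  classes-complete : ∀ R → Poly.Cubic K R → Any (Poly.SameOrbit K R) classes
  classes-complete R R-cubic = AnyP.map⁺ (Any.map (λ {S} → orbit⇒sameOrbit R S) filtered)
    where
    nd : ¬ Degenerate (pencil R)
    nd = cubic⇒nondegenerate R R-cubic
    covered : Covered (pencil R)
    covered = all-covered (pencil R) nd
    filtered : Any (Orbit (pencil R)) (List.filter nondegenerate? reps)
    -- The representative found is equivalent to a nondegenerate pencil, so the filter keeps it.
    filtered = [ (λ p → p) , (λ ¬nd → contradiction
      (λ d → nd (degenerate-orbit (Orbit-sym (AnyP.lookup-result covered)) d)) ¬nd) ]′ (AnyP.filter⁺ nondegenerate? covered)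

open import Data.Nat using (_≤_; _*_; _∸_)

theorem6p2 : ∀ {c ℓ : Level} (K : CommutativeRing c ℓ) (q : ℕ) →
    Poly.IsFiniteField K q → Poly.CharAtLeast5 K →
    Σ (List (Poly.RatExpr K)) (λ L →
    length L ≤ 6 * q ∸ 2
    × All (Poly.Cubic K) L
    × (∀ R → Poly.Cubic K R → Any (Poly.SameOrbit K R) L))
theorem6p2 K q finite char≥5 = classes , length-classes , classes-cubic , classes-complete
  where open Classification K q finite char≥5
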